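{- With the notation of the context, the following hold. (i) $\mathcal A^3=\mathcal B^3+\mathcal D^3$, and $108t=4\alpha(1-\alpha)$. (ii) ${}_2F_1(\tfrac16,\tfrac13;1;108t)^3=\mathcal A(q)^3=(1+27u)\,\eta(\tau)^9/\eta(3\tau)^3$. (iii) Setting $C_{\mathrm{mix}}(q):=F_{\mathrm{mix}}(t(q))\cdot\frac{q}{t(q)}\cdot\frac{dt}{dq}$, one has \[ C_{\mathrm{mix}}=(1-27u)C_0=3E_{5,\chi_0,\chi_3}-27E_{5,\chi_3,\chi_0}, \] where $C_0=3E_{5,\chi_0,\chi_3}$, and moreover $u\cdot C_0=E_{5,\chi_3,\chi_0}$. (iv) $H_{\mathrm{mix}}(q):=q/t(q)=\prod_{n\ge1,\,3\nmid n}(1-q^n)^{12}\cdot(1+27u(q))^2$.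
   Context: Let $q=e^{2\pi i\tau}$, $\eta(\tau)=q^{1/24}\prod_{n\ge1}(1-q^n)$. Define $\mathcal A(q)=\sum_{m,n\in\mathbf Z}q^{m^2+mn+n^2}$, $\mathcal B=\eta(\tau)^3/\eta(3\tau)$, $\mathcal D=3\eta(3\tau)^3/\eta(\tau)$, $u=\eta(3\tau)^{12}/\eta(\tau)^{12}$, $\alpha=27u/(1+27u)$, $t=u/(1+27u)^2$, and $F_{\mathrm{mix}}(t)={}_2F_1(\tfrac16,\tfrac13;1;108t)^3$. Let $\chi_3$ be the nontrivial Dirichlet character mod $3$, $E_{5,\chi_0,\chi_3}(q)=\tfrac13+\sum_{n\ge1}\bigl(\sum_{d\mid n}\chi_3(d)d^4\bigr)q^n$ and $E_{5,\chi_3,\chi_0}(q)=\sum_{n\ge1}\bigl(\sum_{d\mid n}\chi_3(n/d)d^4\bigr)q^n$ (weight-$5$ Eisenstein series on $\Gamma_0(3)$ with character $\chi_3$). -}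

module Defs where

open import Data.Nat as ℕ using (ℕ; zero; suc; _∸_)
open import Data.Nat.Divisibility using (_∣?_; divides)
open import Relation.Nullary using (yes; no)
open import Data.Integer as ℤ using (ℤ; +_)
open import Data.Rational as ℚ using (ℚ; 0ℚ; 1ℚ; _/_)
open import Data.List using (List; []; _∷_; map; upTo; zipWith; foldr; filter; length)
open import Data.Bool using (if_then_else_)
open import Relation.Nullary.Decidable using (does)
open import Relation.Binary.PropositionalEquality using (_≡_)

-- Formal power series in q with rational coefficients:
-- a series is its coefficient function, f n = [q^n] f.

PS : Set
PS = ℕ → ℚ

infix 4 _≋_
_≋_ : PS → PS → Set
f ≋ g = ∀ n → f n ≡ g n

ℕ→ℚ : ℕ → ℚ
ℕ→ℚ n = + n / 1

sumTo : ℕ → (ℕ → ℚ) → ℚ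
sumTo zero    f = f 0
sumTo (suc n) f = sumTo n f ℚ.+ f (suc n)

const : ℚ → PS
const c zero    = c
const c (suc _) = 0ℚ

𝟙 : PS
𝟙 = const 1ℚ

qˢ : PS
qˢ 1 = 1ℚ
qˢ _ = 0ℚ

infixl 6 _⊕_ _⊖_
infixl 7 _⊛_ _·_

_⊕_ : PS → PS → PS
(f ⊕ g) n = f n ℚ.+ g n

_⊖_ : PS → PS → PS
(f ⊖ g) n = f n ℚ.- g n

_·_ : ℚ → PS → PS
(c · f) n = c ℚ.* f n

_⊛_ : PS → PS → PS
(f ⊛ g) n = sumTo n (λ k → f k ℚ.* g (n ∸ k))

infixr 8 _^ˢ_
_^ˢ_ : PS → ℕ → PS
f ^ˢ zero  = 𝟙
f ^ˢ suc k = f ⊛ (f ^ˢ k)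

shift : PS → PS
shift f zero    = 0ℚ
shift f (suc n) = f n

deriv : PS → PS
deriv f n = ℕ→ℚ (suc n) ℚ.* f (suc n)

-- Multiplicative inverse of a series with constant term 1
-- (only ever applied to series whose constant term is 1):
-- c₀ = 1, c_n = - Σ_{k=1}^{n} f k · c_{n-k}.
-- invRev f n = [c_n, c_{n-1}, …, c_0].
invRev : PS → ℕ → List ℚ
invRev f zero    = 1ℚ ∷ []
invRev f (suc n) =
  ℚ.- foldr ℚ._+_ 0ℚ (zipWith ℚ._*_ (map f (map suc (upTo (suc n)))) L) ∷ L
  where L = invRev f n

hd : List ℚ → ℚ
hd []      = 0ℚ
hd (x ∷ _) = x

inv : PS → PS
inv f n = hd (invRev f n)

-- Substitution g(x) of a series x with x 0 = 0 into g:
-- [q^n] g(x) = Σ_{k=0}^{n} g_k [q^n] x^k.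
compose : PS → PS → PS
compose g x n = sumTo n (λ k → g k ℚ.* (x ^ˢ k) n)

-- Infinite product ∏_{n≥1} P n, where P n ≡ 1 mod q^n (so the
-- coefficient of q^N is that of the finite product ∏_{n=1}^{N} P n).
finProd : (ℕ → PS) → ℕ → PS
finProd P zero    = 𝟙
finProd P (suc N) = finProd P N ⊛ P (suc N)

infProd : (ℕ → PS) → PS
infProd P N = finProd P N N

-- E k = ∏_{n≥1} (1 - q^{kn})   (so η(kτ) = q^{k/24} · E k)
E : ℕ → PS
E k = infProd (λ n → 𝟙 ⊖ qˢ ^ˢ (k ℕ.* n))

pochhammer : ℚ → ℕ → ℚ
pochhammer a zero    = 1ℚ
pochhammer a (suc k) = pochhammer a k ℚ.* (a ℚ.+ ℕ→ℚ k)

-- Gauss hypergeometric series ₂F₁(a,b;1;x) as a series in x: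
-- coefficient (a)_k (b)_k / ((1)_k k!) = (a)_k (b)_k / (k!)^2,
-- computed via 1/(k!)^2 = Π_{j=1}^{k} 1/j^2.
invFact² : ℕ → ℚ
invFact² zero    = 1ℚ
invFact² (suc k) = invFact² k ℚ.* (+ 1 / (suc k ℕ.* suc k))

₂F₁-c1 : ℚ → ℚ → PS
₂F₁-c1 a b k = pochhammer a k ℚ.* pochhammer b k ℚ.* invFact² k

-- 𝒜(q) = Σ_{m,n ∈ ℤ} q^{m²+mn+n²}; [q^N] = #{(m,n) ∈ ℤ² : m²+mn+n² = N}.
-- All solutions satisfy |m|,|n| ≤ N, so we count over [-N,N]².
intRange : ℕ → List ℤ
intRange N = map (λ i → + i ℤ.- + N) (upTo (suc (N ℕ.+ N)))

countPairs : ℕ → ℕ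
countPairs N =
  foldr ℕ._+_ 0
    (map (λ m → length (filter (λ n → (m ℤ.* m ℤ.+ m ℤ.* n ℤ.+ n ℤ.* n) ℤ.≟ + N) (intRange N)))
         (intRange N))

𝒜 : PS
𝒜 N = ℕ→ℚ (countPairs N)

-- ℬ = η(τ)³/η(3τ) = E 1 ^ 3 / E 3   (the q-powers cancel)
ℬ : PS
ℬ = E 1 ^ˢ 3 ⊛ inv (E 3)

-- 𝒟 = 3 η(3τ)³/η(τ) = q^{1/3} · 𝒟₀ with 𝒟₀ = 3 E 3 ^ 3 / E 1;
-- 𝒟 itself is not a power series in q, but 𝒟³ = q · 𝒟₀³ is.
𝒟₀ : PS
𝒟₀ = ℕ→ℚ 3 · (E 3 ^ˢ 3 ⊛ inv (E 1))

𝒟³ : PS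
𝒟³ = shift (𝒟₀ ^ˢ 3)

-- u = η(3τ)¹²/η(τ)¹² = q · E 3 ^ 12 / E 1 ^ 12
u : PS
u = shift (E 3 ^ˢ 12 ⊛ inv (E 1 ^ˢ 12))

onePlus27u : PS
onePlus27u = 𝟙 ⊕ ℕ→ℚ 27 · u

α : PS
α = (ℕ→ℚ 27 · u) ⊛ inv onePlus27u

t : PS
t = u ⊛ inv (onePlus27u ^ˢ 2)

Fmix : PS
Fmix = compose (₂F₁-c1 (+ 1 / 6) (+ 1 / 3)) (ℕ→ℚ 108 · t) ^ˢ 3

-- t = q · T with T(0) = 1; H_mix = q / t = 1 / T
tOverQ : PS
tOverQ n = t (suc n)

Hmix : PS
Hmix = inv tOverQ

Cmix : PS
Cmix = Fmix ⊛ Hmix ⊛ deriv t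

-- η(τ)⁹/η(3τ)³ = E 1 ^ 9 / E 3 ^ 3  (the q-powers cancel)
η9/η3³ : PS
η9/η3³ = E 1 ^ˢ 9 ⊛ inv (E 3 ^ˢ 3)

prodNot3 : PS
prodNot3 = infProd (λ n → if does (3 ∣? n) then 𝟙 else (𝟙 ⊖ qˢ ^ˢ n) ^ˢ 12)

χ₃ : ℕ → ℚ
χ₃ d = if does (3 ∣? d) then 0ℚ
       else (if does (3 ∣? (d ∸ 1)) then 1ℚ else ℚ.- 1ℚ)

divTerm : ℕ → (ℕ → ℕ → ℚ) → ℕ → ℚ
divTerm n g zero = 0ℚ
divTerm n g d@(suc _) with d ∣? n
... | yes (divides e _) = g d e
... | no _              = 0ℚ

divSum : ℕ → (ℕ → ℕ → ℚ) → ℚ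
divSum n g = sumTo n (divTerm n g)

d⁴ : ℕ → ℚ
d⁴ d = ℕ→ℚ (d ℕ.^ 4)

E5χ₀χ₃ : PS
E5χ₀χ₃ zero        = + 1 / 3
E5χ₀χ₃ n@(suc _)   = divSum n (λ d e → χ₃ d ℚ.* d⁴ d)

E5χ₃χ₀ : PS
E5χ₃χ₀ zero        = 0ℚ
E5χ₃χ₀ n@(suc _)   = divSum n (λ d e → χ₃ e ℚ.* d⁴ d)

C₀ : PS
C₀ = ℕ→ℚ 3 · E5χ₀χ₃

{-# OPTIONS --safe #-}
module Submission where

-- Everything is derived from first-order differential equations in δ = q d/dq, whose solutions are
-- determined by their constant terms. An Euler product has a Lambert series as its logarithmic derivative,
-- so an Eisenstein series of level 3 equals an eta quotient as soon as a convolution identity between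
-- Lambert series holds. Eight such identities suffice, and each is an instance of one Liouville-type lemma:
-- the substitution (a,b,x,y) ↦ (a,a+b,x-y,y) preserves ax + by, so suitable sums over ax + by = n telescope.
-- With A = 1 + 6 Σ χ₃(a) q^{ax}, they give the Ramanujan-type system satisfied by A, E₂(3τ) and
-- η(τ)⁹/η(3τ)³, hence A³ = ℬ³ + 𝒟³, the weight 5 identities, and A δ²A - 2 (δA)² = 6 η(τ)⁶ η(3τ)⁶, which is
-- the hypergeometric equation. Finally 𝒜 = A: by the pentagonal number theorem the coefficients of E₁³ with
-- exponents divisible by 3 are those of E₁ 𝒜, and E₁³ = E₃ ℬ where ℬ(q) = (3 A(q³) - A(q))/2.

open import Defs
open import Algebra.Bundles using (CommutativeRing; RawRing)
open import Algebra.Solver.Ring.AlmostCommutativeRing using (fromCommutativeRing; _-Raw-AlmostCommutative⟶_)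
import Algebra.Properties.Semiring.Exp
import Algebra.Solver.Ring as RingSolver
open import Data.Bool using (Bool; true; false; T; if_then_else_)
open import Data.Fin using (zero; suc)
open import Data.Integer as ℤ using (ℤ; +_)
import Data.Integer.Properties as ℤₚ
open import Data.Integer.Solver using () renaming (module +-*-Solver to ℤ-Solver)
open import Data.List as List using (List; []; _∷_; foldr; filter; length; applyUpTo)
open import Data.Maybe as Maybe using (Maybe; just; nothing; is-just; to-witness-T)
open import Data.Nat as ℕ using (ℕ; zero; suc; _∸_; z≤n; s≤s)
open import Data.Nat.Divisibility using (_∣?_; divides)
open import Data.Nat.Induction using (<-rec)
import Data.Nat.Properties as ℕₚ
open import Data.Nat.Solver using () renaming (module +-*-Solver to ℕ-Solver)
open import Data.Product using (_×_; _,_; ∃)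
open import Data.Rational as ℚ using (ℚ; 0ℚ; 1ℚ; _/_)
import Data.Rational.Properties as ℚₚ
open import Data.Rational.Unnormalised as ℚᵘ using (mkℚᵘ; *≡*)
import Data.Rational.Unnormalised.Properties as ℚᵘₚ
open import Data.Sum using (inj₁; inj₂)
open import Data.Unit using (tt)
open import Data.Vec as Vec using (Vec; []; _∷_)
open import Data.Vec.Properties using (lookup-map)
open import Level using (0ℓ)
open import Relation.Binary.Consequences using (dec⇒weaklyDec)
open import Relation.Binary.PropositionalEquality hiding (setoid)
open import Relation.Binary.Structures using (IsEquivalence)
open import Relation.Nullary using (Dec; does; yes; no; contradiction)

-- Integers in ℚ and finite sums

-- Everything happens among formal power series in q, so uniqueness for differential equations
-- replaces the finite dimension of spaces of modular forms, and the arithmetic input is the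
-- evaluation of products of two Lambert series. Three points shape the rest. The sum over the
-- hexagonal lattice satisfies no evident differential equation; the Lambert series `A` therefore
-- carries the analytic argument, and the lattice enters only through a bijection of exponents. The
-- quadratic transformation linking the parameters (1/3, 2/3) at α with (1/6, 1/3) at 4α(1 - α) is
-- not invoked: t has logarithmic derivative A²(1 - 2α), and (1 - 2α)² = 1 - 108t makes the equation
-- in t come out directly. A second order equation is solved uniquely from the constant term alone,
-- because its exponent 0 at the origin is double and the other solution is logarithmic.

fromℤ : ℤ → ℚ
fromℤ i = i / 1

toℚᵘ-fromℤ : ∀ i → ℚ.toℚᵘ (fromℤ i) ℚᵘ.≃ mkℚᵘ i 0
toℚᵘ-fromℤ i = ℚₚ.toℚᵘ-fromℚᵘ (mkℚᵘ i 0)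

fromℤ-+ : ∀ i j → fromℤ (i ℤ.+ j) ≡ fromℤ i ℚ.+ fromℤ j
fromℤ-+ i j = ℚₚ.toℚᵘ-injective (begin
  ℚ.toℚᵘ (fromℤ (i ℤ.+ j))                   ≈⟨ toℚᵘ-fromℤ (i ℤ.+ j) ⟩
  mkℚᵘ (i ℤ.+ j) 0                           ≈⟨ *≡* (cong (ℤ._* + 1) (cong₂ ℤ._+_ (sym (ℤₚ.*-identityʳ i))
      (sym (ℤₚ.*-identityʳ j)))) ⟩
  mkℚᵘ i 0 ℚᵘ.+ mkℚᵘ j 0                     ≈⟨ ℚᵘₚ.+-cong (toℚᵘ-fromℤ i) (toℚᵘ-fromℤ j) ⟨
  ℚ.toℚᵘ (fromℤ i) ℚᵘ.+ ℚ.toℚᵘ (fromℤ j)     ≈⟨ ℚₚ.toℚᵘ-homo-+ (fromℤ i) (fromℤ j) ⟨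
  ℚ.toℚᵘ (fromℤ i ℚ.+ fromℤ j)               ∎)
  where open ℚᵘₚ.≃-Reasoning

fromℤ-* : ∀ i j → fromℤ (i ℤ.* j) ≡ fromℤ i ℚ.* fromℤ j
fromℤ-* i j = ℚₚ.toℚᵘ-injective (begin
  ℚ.toℚᵘ (fromℤ (i ℤ.* j))                   ≈⟨ toℚᵘ-fromℤ (i ℤ.* j) ⟩
  mkℚᵘ i 0 ℚᵘ.* mkℚᵘ j 0                     ≈⟨ ℚᵘₚ.*-cong (toℚᵘ-fromℤ i) (toℚᵘ-fromℤ j) ⟨
  ℚ.toℚᵘ (fromℤ i) ℚᵘ.* ℚ.toℚᵘ (fromℤ j)     ≈⟨ ℚₚ.toℚᵘ-homo-* (fromℤ i) (fromℤ j) ⟨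
  ℚ.toℚᵘ (fromℤ i ℚ.* fromℤ j)               ∎)
  where open ℚᵘₚ.≃-Reasoning

fromℤ-neg : ∀ i → fromℤ (ℤ.- i) ≡ ℚ.- fromℤ i
fromℤ-neg i = ℚₚ.toℚᵘ-injective (begin
  ℚ.toℚᵘ (fromℤ (ℤ.- i))       ≈⟨ toℚᵘ-fromℤ (ℤ.- i) ⟩
  ℚᵘ.- mkℚᵘ i 0                ≈⟨ ℚᵘₚ.-‿cong (toℚᵘ-fromℤ i) ⟨
  ℚᵘ.- ℚ.toℚᵘ (fromℤ i)        ≈⟨ ℚₚ.toℚᵘ-homo‿- (fromℤ i) ⟨
  ℚ.toℚᵘ (ℚ.- fromℤ i)         ∎)
  where open ℚᵘₚ.≃-Reasoning

fromℤ-injective : ∀ {i j} → fromℤ i ≡ fromℤ j → i ≡ j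
fromℤ-injective {i} {j} eq with ℚᵘₚ.≃-trans (ℚᵘₚ.≃-sym (toℚᵘ-fromℤ i))
    (ℚᵘₚ.≃-trans (ℚᵘₚ.≃-reflexive (cong ℚ.toℚᵘ eq)) (toℚᵘ-fromℤ j))
... | *≡* p = trans (sym (ℤₚ.*-identityʳ i)) (trans p (ℤₚ.*-identityʳ j))

ℤ-rawRing : RawRing _ _
ℤ-rawRing = CommutativeRing.rawRing ℤₚ.+-*-commutativeRing

module ℚ-Solver where
  morphism : ℤ-rawRing -Raw-AlmostCommutative⟶ fromCommutativeRing ℚₚ.+-*-commutativeRing
  morphism = record
    { ⟦_⟧ = fromℤ ; +-homo = fromℤ-+ ; *-homo = fromℤ-* ; -‿homo = fromℤ-neg
    ; 0-homo = refl ; 1-homo = refl }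
  _coefficient≟_ : ∀ i j → Maybe (fromℤ i ≡ fromℤ j)
  i coefficient≟ j = Maybe.map (cong fromℤ) (dec⇒weaklyDec ℤ._≟_ i j)
  open RingSolver ℤ-rawRing (fromCommutativeRing ℚₚ.+-*-commutativeRing) morphism _coefficient≟_ public
  #_ : ∀ {k} → ℕ → Polynomial k
  # n = con (+ n)

ι : ℕ → ℚ
ι = ℕ→ℚ

ι-+ : ∀ m n → ι (m ℕ.+ n) ≡ ι m ℚ.+ ι n
ι-+ m n = fromℤ-+ (+ m) (+ n)

ι-* : ∀ m n → ι (m ℕ.* n) ≡ ι m ℚ.* ι n
ι-* m n = trans (cong fromℤ (ℤₚ.pos-* m n)) (fromℤ-* (+ m) (+ n))

ι-suc : ∀ n → ι (suc n) ≡ 1ℚ ℚ.+ ι n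
ι-suc n = ι-+ 1 n

ι-injective : ∀ {m n} → ι m ≡ ι n → m ≡ n
ι-injective eq = ℤₚ.+-injective (fromℤ-injective eq)

-- Half-open and peeled from the front, unlike the inclusive `sumTo`: empty ranges exist, and the
-- recursion `⊛-suc` for the Cauchy product becomes immediate.
∑ : ℕ → (ℕ → ℚ) → ℚ
∑ zero    f = 0ℚ
∑ (suc n) f = f 0 ℚ.+ ∑ n (λ i → f (suc i))

∑-cong : ∀ n {f g : ℕ → ℚ} → (∀ i → i ℕ.< n → f i ≡ g i) → ∑ n f ≡ ∑ n g
∑-cong zero    h = refl
∑-cong (suc n) h = cong₂ ℚ._+_ (h 0 (s≤s z≤n)) (∑-cong n (λ i i<n → h (suc i) (s≤s i<n)))

∑-cong′ : ∀ n {f g : ℕ → ℚ} → (∀ i → f i ≡ g i) → ∑ n f ≡ ∑ n g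
∑-cong′ n h = ∑-cong n (λ i _ → h i)

∑-zero : ∀ n {f : ℕ → ℚ} → (∀ i → i ℕ.< n → f i ≡ 0ℚ) → ∑ n f ≡ 0ℚ
∑-zero zero    h = refl
∑-zero (suc n) h = cong₂ ℚ._+_ (h 0 (s≤s z≤n)) (∑-zero n (λ i i<n → h (suc i) (s≤s i<n)))

∑-+ : ∀ n (f g : ℕ → ℚ) → ∑ n (λ i → f i ℚ.+ g i) ≡ ∑ n f ℚ.+ ∑ n g
∑-+ zero    f g = refl
∑-+ (suc n) f g = trans (cong ((f 0 ℚ.+ g 0) ℚ.+_) (∑-+ n _ _))
  (solve 4 (λ a b c d → (a :+ b) :+ (c :+ d) := (a :+ c) :+ (b :+ d)) refl (f 0) (g 0) (∑ n (λ i → f (suc i)))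
      (∑ n (λ i → g (suc i))))
  where open ℚ-Solver

∑-*ˡ : ∀ n c (f : ℕ → ℚ) → ∑ n (λ i → c ℚ.* f i) ≡ c ℚ.* ∑ n f
∑-*ˡ zero    c f = sym (ℚₚ.*-zeroʳ c)
∑-*ˡ (suc n) c f = trans (cong (c ℚ.* f 0 ℚ.+_) (∑-*ˡ n c _)) (sym (ℚₚ.*-distribˡ-+ c (f 0) _))

∑-*ʳ : ∀ n (f : ℕ → ℚ) c → ∑ n (λ i → f i ℚ.* c) ≡ ∑ n f ℚ.* c
∑-*ʳ n f c = trans (∑-cong′ n (λ i → ℚₚ.*-comm (f i) c)) (trans (∑-*ˡ n c f) (ℚₚ.*-comm c (∑ n f)))

∑-neg : ∀ n (f : ℕ → ℚ) → ∑ n (λ i → ℚ.- f i) ≡ ℚ.- ∑ n f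
∑-neg zero    f = refl
∑-neg (suc n) f = trans (cong (ℚ.- f 0 ℚ.+_) (∑-neg n _)) (sym (ℚₚ.neg-distrib-+ (f 0) _))

∑-swap : ∀ m n (f : ℕ → ℕ → ℚ) → ∑ m (λ i → ∑ n (λ j → f i j)) ≡ ∑ n (λ j → ∑ m (λ i → f i j))
∑-swap zero    n f = sym (∑-zero n (λ _ _ → refl))
∑-swap (suc m) n f = trans (cong (∑ n (f 0) ℚ.+_) (∑-swap m n _)) (sym (∑-+ n (f 0) _))

∑-split : ∀ m n (f : ℕ → ℚ) → ∑ (m ℕ.+ n) f ≡ ∑ m f ℚ.+ ∑ n (λ i → f (m ℕ.+ i))
∑-split zero    n f = sym (ℚₚ.+-identityˡ _)
∑-split (suc m) n f = trans (cong (f 0 ℚ.+_) (∑-split m n _)) (sym (ℚₚ.+-assoc (f 0) _ _))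

∑-last : ∀ n (f : ℕ → ℚ) → ∑ (suc n) f ≡ ∑ n f ℚ.+ f n
∑-last zero    f = ℚₚ.+-comm (f 0) 0ℚ
∑-last (suc n) f = trans (cong (f 0 ℚ.+_) (∑-last n _)) (sym (ℚₚ.+-assoc (f 0) _ _))

∑-extend : ∀ {m n} (f : ℕ → ℚ) → m ℕ.≤ n → (∀ i → m ℕ.≤ i → f i ≡ 0ℚ) → ∑ n f ≡ ∑ m f
∑-extend {m} f m≤n h with ℕₚ.m≤n⇒∃[o]m+o≡n m≤n
... | o , refl = trans (∑-split m o f) (trans (cong (∑ m f ℚ.+_) (∑-zero o (λ i _ → h (m ℕ.+ i) (ℕₚ.m≤m+n m i))))
    (ℚₚ.+-identityʳ _))

sumTo-∑ : ∀ n f → sumTo n f ≡ ∑ (suc n) f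
sumTo-∑ zero    f = sym (ℚₚ.+-identityʳ (f 0))
sumTo-∑ (suc n) f = trans (cong (ℚ._+ f (suc n)) (sumTo-∑ n f)) (sym (∑-last (suc n) f))

-- The ring of power series

tail : PS → PS
tail f n = f (suc n)

-- The ring laws below are inductions on the coefficient index through this recursion; replacing f
-- by `tail f` avoids reindexing with `n ∸ k`.
⊛-suc : ∀ f g n → (f ⊛ g) (suc n) ≡ f 0 ℚ.* g (suc n) ℚ.+ (tail f ⊛ g) n
⊛-suc f g n = trans (sumTo-∑ (suc n) _) (cong (f 0 ℚ.* g (suc n) ℚ.+_) (sym (sumTo-∑ n _)))

-- Locality of the product: this is what later allows infinite products and sums to be truncated
-- coefficient by coefficient.
⊛-cong-≤ : ∀ {f f′ g g′} n → (∀ k → k ℕ.≤ n → f k ≡ f′ k) → (∀ k → k ℕ.≤ n → g k ≡ g′ k) →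
           (f ⊛ g) n ≡ (f′ ⊛ g′) n
⊛-cong-≤ zero    p q = cong₂ ℚ._*_ (p 0 z≤n) (q 0 z≤n)
⊛-cong-≤ {f} {f′} {g} {g′} (suc n) p q = trans (⊛-suc f g n) (trans
  (cong₂ ℚ._+_ (cong₂ ℚ._*_ (p 0 z≤n) (q (suc n) ℕₚ.≤-refl))
               (⊛-cong-≤ n (λ k k≤n → p (suc k) (s≤s k≤n)) (λ k k≤n → q k (ℕₚ.m≤n⇒m≤1+n k≤n))))
  (sym (⊛-suc f′ g′ n)))

-- Peeling a term off f, flipping, and peeling a term off g leaves `tail g ⊛ tail f` two indices
-- lower; hence the induction with step two.
⊛-comm′ : ∀ n f g → (f ⊛ g) n ≡ (g ⊛ f) n
⊛-comm′ zero f g = ℚₚ.*-comm (f 0) (g 0)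
⊛-comm′ (suc zero) f g = trans (⊛-suc f g 0) (trans
  (solve 4 (λ a b c d → a :* d :+ b :* c := c :* b :+ d :* a) refl (f 0) (f 1) (g 0) (g 1))
  (sym (⊛-suc g f 0)))
  where open ℚ-Solver
⊛-comm′ (suc (suc n)) f g = begin
  (f ⊛ g) (suc (suc n))                                                        ≡⟨ step f g (⊛-comm′ (suc n) (tail f) g) ⟩
  f 0 ℚ.* g (suc (suc n)) ℚ.+ (g 0 ℚ.* f (suc (suc n)) ℚ.+ (tail g ⊛ tail f) n)
      ≡⟨ cong (λ z → f 0 ℚ.* g (suc (suc n)) ℚ.+ (g 0 ℚ.* f (suc (suc n)) ℚ.+ z)) (⊛-comm′ n (tail g) (tail f)) ⟩
  f 0 ℚ.* g (suc (suc n)) ℚ.+ (g 0 ℚ.* f (suc (suc n)) ℚ.+ (tail f ⊛ tail g) n)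
    ≡⟨ solve 3 (λ a b c → a :+ (b :+ c) := b :+ (a :+ c)) refl (f 0 ℚ.* g (suc (suc n))) (g 0 ℚ.* f (suc (suc n)))
        ((tail f ⊛ tail g) n) ⟩
  g 0 ℚ.* f (suc (suc n)) ℚ.+ (f 0 ℚ.* g (suc (suc n)) ℚ.+ (tail f ⊛ tail g) n) ≡⟨ step g f (⊛-comm′ (suc n) (tail g) f) ⟨
  (g ⊛ f) (suc (suc n))                                                        ∎
  where
  open ≡-Reasoning
  open ℚ-Solver using (solve; _:=_; _:+_)
  step : ∀ f g → (tail f ⊛ g) (suc n) ≡ (g ⊛ tail f) (suc n) → (f ⊛ g) (suc (suc n)) ≡ f 0 ℚ.* g (suc (suc n)) ℚ.+
      (g 0 ℚ.* f (suc (suc n)) ℚ.+ (tail g ⊛ tail f) n)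
  step f g ih = trans (⊛-suc f g (suc n))
    (cong (f 0 ℚ.* g (suc (suc n)) ℚ.+_) (trans ih (⊛-suc g (tail f) n)))

⊛-distribʳ′ : ∀ n f g h → ((g ⊕ h) ⊛ f) n ≡ (g ⊛ f) n ℚ.+ (h ⊛ f) n
⊛-distribʳ′ zero    f g h = ℚₚ.*-distribʳ-+ (f 0) (g 0) (h 0)
⊛-distribʳ′ (suc n) f g h = trans (⊛-suc (g ⊕ h) f n) (trans
  (cong ((g 0 ℚ.+ h 0) ℚ.* f (suc n) ℚ.+_) (⊛-distribʳ′ n f (tail g) (tail h))) (trans
  (solve 5 (λ a b c d e → (a :+ b) :* c :+ (d :+ e) := (a :* c :+ d) :+ (b :* c :+ e)) refl
    (g 0) (h 0) (f (suc n)) ((tail g ⊛ f) n) ((tail h ⊛ f) n))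
  (sym (cong₂ ℚ._+_ (⊛-suc g f n) (⊛-suc h f n)))))
  where open ℚ-Solver

·-⊛′ : ∀ n c f g → ((c · f) ⊛ g) n ≡ c ℚ.* (f ⊛ g) n
·-⊛′ zero    c f g = ℚₚ.*-assoc c (f 0) (g 0)
·-⊛′ (suc n) c f g = trans (⊛-suc (c · f) g n) (trans
  (cong (c ℚ.* f 0 ℚ.* g (suc n) ℚ.+_) (·-⊛′ n c (tail f) g)) (trans
  (solve 4 (λ c a b d → c :* a :* b :+ c :* d := c :* (a :* b :+ d)) refl c (f 0) (g (suc n)) ((tail f ⊛ g) n))
  (cong (c ℚ.*_) (sym (⊛-suc f g n)))))
  where open ℚ-Solver

⊛-assoc′ : ∀ n f g h → ((f ⊛ g) ⊛ h) n ≡ (f ⊛ (g ⊛ h)) n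
⊛-assoc′ zero    f g h = ℚₚ.*-assoc (f 0) (g 0) (h 0)
⊛-assoc′ (suc n) f g h = begin
  ((f ⊛ g) ⊛ h) (suc n)                                                      ≡⟨ ⊛-suc (f ⊛ g) h n ⟩
  f 0 ℚ.* g 0 ℚ.* h (suc n) ℚ.+ (tail (f ⊛ g) ⊛ h) n                        
      ≡⟨ cong (f 0 ℚ.* g 0 ℚ.* h (suc n) ℚ.+_) (⊛-cong-≤ {tail (f ⊛ g)} {(f 0 · tail g) ⊕ (tail f ⊛ g)} {h} {h} n
      (λ k _ → ⊛-suc f g k) (λ _ _ → refl)) ⟩
  f 0 ℚ.* g 0 ℚ.* h (suc n) ℚ.+ (((f 0 · tail g) ⊕ (tail f ⊛ g)) ⊛ h) n     
      ≡⟨ cong (f 0 ℚ.* g 0 ℚ.* h (suc n) ℚ.+_) (trans (⊛-distribʳ′ n h (f 0 · tail g) (tail f ⊛ g))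
      (cong₂ ℚ._+_ (·-⊛′ n (f 0) (tail g) h) (⊛-assoc′ n (tail f) g h))) ⟩
  f 0 ℚ.* g 0 ℚ.* h (suc n) ℚ.+ (f 0 ℚ.* (tail g ⊛ h) n ℚ.+ (tail f ⊛ (g ⊛ h)) n)
    ≡⟨ solve 5 (λ a b c d e → a :* b :* c :+ (a :* d :+ e) := a :* (b :* c :+ d) :+ e) refl (f 0) (g 0) (h (suc n))
        ((tail g ⊛ h) n) ((tail f ⊛ (g ⊛ h)) n) ⟩
  f 0 ℚ.* (g 0 ℚ.* h (suc n) ℚ.+ (tail g ⊛ h) n) ℚ.+ (tail f ⊛ (g ⊛ h)) n   
      ≡⟨ cong (λ z → f 0 ℚ.* z ℚ.+ (tail f ⊛ (g ⊛ h)) n) (⊛-suc g h n) ⟨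
  f 0 ℚ.* (g ⊛ h) (suc n) ℚ.+ (tail f ⊛ (g ⊛ h)) n                           ≡⟨ ⊛-suc f (g ⊛ h) n ⟨
  (f ⊛ (g ⊛ h)) (suc n)                                                      ∎
  where
  open ≡-Reasoning
  open ℚ-Solver using (solve; _:=_; _:+_; _:*_)

const-⊛′ : ∀ n c f → (const c ⊛ f) n ≡ c ℚ.* f n
const-⊛′ zero    c f = refl
const-⊛′ (suc n) c f = trans (⊛-suc (const c) f n) (trans (cong (c ℚ.* f (suc n) ℚ.+_) (zero-⊛ n)) (ℚₚ.+-identityʳ _))
  where
  zero-⊛ : ∀ n → ((λ _ → 0ℚ) ⊛ f) n ≡ 0ℚ
  zero-⊛ zero    = ℚₚ.*-zeroˡ (f 0)
  zero-⊛ (suc n) = trans (⊛-suc (λ _ → 0ℚ) f n) (cong₂ ℚ._+_ (ℚₚ.*-zeroˡ (f (suc n))) (zero-⊛ n))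

δᶠ : PS → PS
δᶠ f n = ι n ℚ.* f n

tail-δ : ∀ f n → tail (δᶠ f) n ≡ δᶠ (tail f) n ℚ.+ tail f n
tail-δ f n = trans (cong (ℚ._* f (suc n)) (ι-suc n))
  (solve 2 (λ a b → (# 1 :+ a) :* b := a :* b :+ b) refl (ι n) (f (suc n)))
  where open ℚ-Solver

δ-⊛′ : ∀ n f g → ι n ℚ.* (f ⊛ g) n ≡ (δᶠ f ⊛ g) n ℚ.+ (f ⊛ δᶠ g) n
δ-⊛′ zero f g = solve 2 (λ a b → # 0 :* (a :* b) := # 0 :* a :* b :+ a :* (# 0 :* b)) refl (f 0) (g 0)
  where open ℚ-Solver
δ-⊛′ (suc n) f g = begin
  ι (suc n) ℚ.* (f ⊛ g) (suc n)   ≡⟨ cong₂ ℚ._*_ (ι-suc n) (⊛-suc f g n) ⟩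
  (1ℚ ℚ.+ ι n) ℚ.* (f 0 ℚ.* g (suc n) ℚ.+ (tail f ⊛ g) n)
    ≡⟨ solve 4 (λ k a b c → (# 1 :+ k) :* (a :* b :+ c) := a :* ((# 1 :+ k) :* b) :+ c :+ k :* c) refl (ι n) (f 0) (g (suc n))
        ((tail f ⊛ g) n) ⟩
  f 0 ℚ.* ((1ℚ ℚ.+ ι n) ℚ.* g (suc n)) ℚ.+ (tail f ⊛ g) n ℚ.+ ι n ℚ.* (tail f ⊛ g) n
    ≡⟨ cong₂ (λ x y → f 0 ℚ.* (x ℚ.* g (suc n)) ℚ.+ (tail f ⊛ g) n ℚ.+ y) (sym (ι-suc n)) (δ-⊛′ n (tail f) g) ⟩
  f 0 ℚ.* δᶠ g (suc n) ℚ.+ (tail f ⊛ g) n ℚ.+ ((δᶠ (tail f) ⊛ g) n ℚ.+ (tail f ⊛ δᶠ g) n)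
    ≡⟨ solve 6 (λ a x b c d e → a :* x :+ b :+ (c :+ d) := # 0 :* a :* e :+ (c :+ b) :+ (a :* x :+ d)) refl
         (f 0) (δᶠ g (suc n)) ((tail f ⊛ g) n) ((δᶠ (tail f) ⊛ g) n) ((tail f ⊛ δᶠ g) n) (g (suc n)) ⟩
  δᶠ f 0 ℚ.* g (suc n) ℚ.+ ((δᶠ (tail f) ⊛ g) n ℚ.+ (tail f ⊛ g) n) ℚ.+ (f 0 ℚ.* δᶠ g (suc n) ℚ.+ (tail f ⊛ δᶠ g) n)
    ≡⟨ cong₂ ℚ._+_ (trans (cong (δᶠ f 0 ℚ.* g (suc n) ℚ.+_) (trans (sym (⊛-distribʳ′ n g (δᶠ (tail f)) (tail f)))
        (⊛-cong-≤ {_} {tail (δᶠ f)} {g} {g} n (λ k _ → sym (tail-δ f k)) (λ _ _ → refl)))) (sym (⊛-suc (δᶠ f) g n)))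
                   (sym (⊛-suc f (δᶠ g) n)) ⟩
  (δᶠ f ⊛ g) (suc n) ℚ.+ (f ⊛ δᶠ g) (suc n) ∎
  where
  open ≡-Reasoning
  open ℚ-Solver using (solve; _:=_; _:+_; _:*_; #_)

-- _≋_ unfolds to a function type, from which Agda cannot recover the two series;
-- for the same reason the ring operations used for reasoning are opaque copies.
infix 4 _≈_
record _≈_ (f g : PS) : Set where
  constructor ⟪_⟫
  field at : f ≋ g
open _≈_ public

≈-isEquivalence : IsEquivalence _≈_
≈-isEquivalence = record
  { refl  = ⟪ (λ _ → refl) ⟫
  ; sym   = λ p → ⟪ (λ n → sym (at p n)) ⟫
  ; trans = λ p q → ⟪ (λ n → trans (at p n) (at q n)) ⟫ }

infixl 6 _+_ _-_
infixl 7 _*_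

opaque
  _+_ _*_ : PS → PS → PS
  _+_ = _⊕_
  _*_ = _⊛_

  -_ δ : PS → PS
  (- f) n = ℚ.- f n
  δ = δᶠ

  K : ℤ → PS
  K i = const (fromℤ i)

  +-at : ∀ f g n → (f + g) n ≡ f n ℚ.+ g n
  +-at f g n = refl

  *-at : ∀ f g n → (f * g) n ≡ (f ⊛ g) n
  *-at f g n = refl

  neg-at : ∀ f n → (- f) n ≡ ℚ.- f n
  neg-at f n = refl

  δ-at : ∀ f n → δ f n ≡ ι n ℚ.* f n
  δ-at f n = refl

  K-at : ∀ i n → K i n ≡ const (fromℤ i) n
  K-at i n = refl

_-_ : PS → PS → PS
f - g = f + (- g)

0# 1# : PS
0# = K (+ 0)
1# = K (+ 1)

0#-at : ∀ n → 0# n ≡ 0ℚ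
0#-at n = trans (K-at (+ 0) n) (const-0 n)
  where
  const-0 : ∀ n → const 0ℚ n ≡ 0ℚ
  const-0 zero    = refl
  const-0 (suc n) = refl

opaque
  unfolding _+_

  δ-cong : ∀ {f g} → f ≈ g → δ f ≈ δ g
  δ-cong p = ⟪ (λ n → cong (ι n ℚ.*_) (at p n)) ⟫

  δ-+ : ∀ f g → δ (f + g) ≈ δ f + δ g
  δ-+ f g = ⟪ (λ n → ℚₚ.*-distribˡ-+ (ι n) (f n) (g n)) ⟫

  δ-neg : ∀ f → δ (- f) ≈ - δ f
  δ-neg f = ⟪ (λ n → sym (ℚₚ.neg-distribʳ-* (ι n) (f n))) ⟫

  δ-* : ∀ f g → δ (f * g) ≈ δ f * g + f * δ g
  δ-* f g = ⟪ (λ n → δ-⊛′ n f g) ⟫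

  δ-K : ∀ i → δ (K i) ≈ 0#
  δ-K i = ⟪ (λ { zero → ℚₚ.*-zeroˡ (fromℤ i) ; (suc n) → ℚₚ.*-zeroʳ (ι (suc n)) }) ⟫

  private
    *-cong′ : ∀ {f f′ g g′} → f ≈ f′ → g ≈ g′ → f * g ≈ f′ * g′
    *-cong′ p q = ⟪ (λ n → ⊛-cong-≤ n (λ k _ → at p k) (λ k _ → at q k)) ⟫

    *-comm′ : ∀ f g → f * g ≈ g * f
    *-comm′ f g = ⟪ (λ n → ⊛-comm′ n f g) ⟫

    +-idˡ : ∀ f → 0# + f ≈ f
    +-idˡ f = ⟪ (λ n → trans (cong (ℚ._+ f n) (0#-at n)) (ℚₚ.+-identityˡ (f n))) ⟫

    +-comm′ : ∀ f g → f + g ≈ g + f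
    +-comm′ f g = ⟪ (λ n → ℚₚ.+-comm (f n) (g n)) ⟫

    +-invˡ : ∀ f → - f + f ≈ 0#
    +-invˡ f = ⟪ (λ n → trans (ℚₚ.+-inverseˡ (f n)) (sym (0#-at n))) ⟫

    *-idˡ : ∀ f → 1# * f ≈ f
    *-idˡ f = ⟪ (λ n → trans (const-⊛′ n 1ℚ f) (ℚₚ.*-identityˡ (f n))) ⟫

    distribʳ′ : ∀ f g h → (g + h) * f ≈ g * f + h * f
    distribʳ′ f g h = ⟪ (λ n → ⊛-distribʳ′ n f g h) ⟫

    +-cong′ : ∀ {f f′ g g′} → f ≈ f′ → g ≈ g′ → f + g ≈ f′ + g′
    +-cong′ p q = ⟪ (λ n → cong₂ ℚ._+_ (at p n) (at q n)) ⟫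

    neg-cong′ : ∀ {f g} → f ≈ g → - f ≈ - g
    neg-cong′ p = ⟪ (λ n → cong ℚ.-_ (at p n)) ⟫

    +-assoc′ : ∀ f g h → (f + g) + h ≈ f + (g + h)
    +-assoc′ f g h = ⟪ (λ n → ℚₚ.+-assoc (f n) (g n) (h n)) ⟫

    *-assoc′ : ∀ f g h → (f * g) * h ≈ f * (g * h)
    *-assoc′ f g h = ⟪ (λ n → ⊛-assoc′ n f g h) ⟫

  K-+ : ∀ i j → K (i ℤ.+ j) ≈ K i + K j
  K-+ i j = ⟪ (λ { zero → fromℤ-+ i j ; (suc n) → refl }) ⟫

  K-* : ∀ i j → K (i ℤ.* j) ≈ K i * K j
  K-* i j = ⟪ (λ { zero → fromℤ-* i j ; (suc n) → sym (trans (const-⊛′ (suc n) (fromℤ i) (K j)) (ℚₚ.*-zeroʳ (fromℤ i))) }) ⟫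

  K-neg : ∀ i → K (ℤ.- i) ≈ - K i
  K-neg i = ⟪ (λ { zero → fromℤ-neg i ; (suc n) → refl }) ⟫

  K-*-at : ∀ i f n → (K i * f) n ≡ fromℤ i ℚ.* f n
  K-*-at i f n = const-⊛′ n (fromℤ i) f

private
  module E = IsEquivalence ≈-isEquivalence

PS-ring : CommutativeRing 0ℓ 0ℓ
PS-ring = record
  { Carrier = PS ; _≈_ = _≈_ ; _+_ = _+_ ; _*_ = _*_ ; -_ = -_ ; 0# = 0# ; 1# = 1#
  ; isCommutativeRing = record
    { isRing = record
      { +-isAbelianGroup = record
        { isGroup = record
          { isMonoid = record
            { isSemigroup = record
              { isMagma = record { isEquivalence = ≈-isEquivalence ; ∙-cong = +-cong′ }
              ; assoc = +-assoc′ }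
            ; identity = +-idˡ , (λ f → E.trans (+-comm′ f 0#) (+-idˡ f)) }
          ; inverse = +-invˡ , (λ f → E.trans (+-comm′ f (- f)) (+-invˡ f))
          ; ⁻¹-cong = neg-cong′ }
        ; comm = +-comm′ }
      ; *-cong = *-cong′
      ; *-assoc = *-assoc′
      ; *-identity = *-idˡ , (λ f → E.trans (*-comm′ f 1#) (*-idˡ f))
      ; distrib = (λ f g h → E.trans (*-comm′ f (g + h)) (E.trans (distribʳ′ f g h) (+-cong′ (*-comm′ g f) (*-comm′ h f))))
                , distribʳ′ }
    ; *-comm = *-comm′ } }

open CommutativeRing PS-ring using
  (+-cong; *-cong; -‿cong; +-assoc; +-comm; *-assoc; *-comm; *-identityˡ; *-identityʳ; +-identityˡ; +-identityʳ; zeroˡ; zeroʳ)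
  renaming (setoid to ≈-setoid; refl to ≈-refl; sym to ≈-sym; trans to ≈-trans)
open module Exp = Algebra.Properties.Semiring.Exp (CommutativeRing.semiring PS-ring) using (_^_; ^-homo-*)

module PS-Reasoning where
  open import Relation.Binary.Reasoning.Setoid ≈-setoid public

module PS-Solver where
  morphism : ℤ-rawRing -Raw-AlmostCommutative⟶ fromCommutativeRing PS-ring
  morphism = record
    { ⟦_⟧ = K ; +-homo = K-+ ; *-homo = K-* ; -‿homo = K-neg ; 0-homo = ≈-refl ; 1-homo = ≈-refl }
  K-cong : ∀ {i j} → i ≡ j → K i ≈ K j
  K-cong refl = ≈-refl
  _coefficient≟_ : ∀ i j → Maybe (K i ≈ K j)
  i coefficient≟ j = Maybe.map K-cong (dec⇒weaklyDec ℤ._≟_ i j)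
  open RingSolver ℤ-rawRing (fromCommutativeRing PS-ring) morphism _coefficient≟_ public
  #_ : ∀ {k} → ℕ → Polynomial k
  # n = con (+ n)

*-0 : ∀ f g → (f * g) 0 ≡ f 0 ℚ.* g 0
*-0 f g = *-at f g 0

*-suc : ∀ f g n → (f * g) (suc n) ≡ f 0 ℚ.* g (suc n) ℚ.+ (tail f * g) n
*-suc f g n = trans (*-at f g (suc n)) (trans (⊛-suc f g n) (cong (f 0 ℚ.* g (suc n) ℚ.+_) (sym (*-at (tail f) g n))))

*-cong-≤ : ∀ f f′ g g′ n → (∀ k → k ℕ.≤ n → f k ≡ f′ k) → (∀ k → k ℕ.≤ n → g k ≡ g′ k) → (f * g) n ≡ (f′ * g′) n
*-cong-≤ f f′ g g′ n p q = trans (*-at f g n) (trans (⊛-cong-≤ n p q) (sym (*-at f′ g′ n)))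

minus-at : ∀ f g n → (f - g) n ≡ f n ℚ.- g n
minus-at f g n = trans (+-at f (- g) n) (cong (f n ℚ.+_) (neg-at g n))

ℚ-cancelˡ : ∀ {c x y : ℚ} → c ≢ 0ℚ → c ℚ.* x ≡ c ℚ.* y → x ≡ y
ℚ-cancelˡ {c} {x} {y} c≢0 eq = trans (sym (undo x)) (trans (cong (ℚ.1/ c ℚ.*_) eq) (undo y))
  where
  instance
    c-nonZero : ℚ.NonZero c
    c-nonZero = ℚ.≢-nonZero c≢0
  undo : ∀ z → ℚ.1/ c ℚ.* (c ℚ.* z) ≡ z
  undo z = trans (sym (ℚₚ.*-assoc (ℚ.1/ c) c z)) (trans (cong (ℚ._* z) (ℚₚ.*-inverseˡ c)) (ℚₚ.*-identityˡ z))

ι-suc≢0 : ∀ n → ι (suc n) ≢ 0ℚ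
ι-suc≢0 n eq with ι-injective {suc n} {0} eq
... | ()

K-cancel : ∀ n {f g} → K (+ suc n) * f ≈ K (+ suc n) * g → f ≈ g
K-cancel n {f} {g} p = ⟪ (λ k → ℚ-cancelˡ (ι-suc≢0 n)
  (trans (sym (K-*-at (+ suc n) f k)) (trans (at p k) (K-*-at (+ suc n) g k)))) ⟫

-- Logarithmic derivatives and infinite products

strong-induction : {P : ℕ → Set} → (∀ n → (∀ k → k ℕ.< n → P k) → P n) → ∀ n → P n
strong-induction {P} step = <-rec P (λ n ih → step n (λ k k<n → ih k<n))

-- The logarithmic derivative s = δf / f, written without division so that it makes sense for every
-- f.
LogD : PS → PS → Set
LogD f s = δ f ≈ f * s

δ-minus : ∀ f g → δ (f - g) ≈ δ f - δ g
δ-minus f g = ≈-trans (δ-+ f (- g)) (+-cong ≈-refl (δ-neg g))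

ℚ-⊖≡0 : ∀ {x y : ℚ} → x ℚ.- y ≡ 0ℚ → x ≡ y
ℚ-⊖≡0 {x} {y} eq = trans (solve 2 (λ x y → x := (x :- y) :+ y) refl x y) (trans (cong (ℚ._+ y) eq) (ℚₚ.+-identityˡ y))
  where open ℚ-Solver

-≈0 : ∀ {f g} → (∀ n → (f - g) n ≡ 0ℚ) → f ≈ g
-≈0 {f} {g} h = ⟪ (λ n → ℚ-⊖≡0 (trans (sym (minus-at f g n)) (h n))) ⟫

*-vanishes : ∀ {f g} n → (∀ k → k ℕ.≤ n → g k ≡ 0ℚ) → (f * g) n ≡ 0ℚ
*-vanishes {f} {g} n h = trans (*-cong-≤ f f g 0# n (λ _ _ → refl) (λ k k≤n → trans (h k k≤n) (sym (0#-at k))))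
    (trans (at (zeroʳ f) n) (0#-at n))

-- The difference h satisfies δh = s h. Since s has no constant term, (n + 1) times the coefficient
-- of h at n + 1 only involves lower coefficients of h, and all of them vanish in turn.
LogD-unique : ∀ {f g s} → s 0 ≡ 0ℚ → LogD f s → LogD g s → f 0 ≡ g 0 → f ≈ g
LogD-unique {f} {g} {s} s0 df dg f0≡g0 = -≈0 (strong-induction step)
  where
  h : PS
  h = f - g
  dh : δ h ≈ s * h
  dh = begin
    δ (f - g)         ≈⟨ δ-minus f g ⟩
    δ f - δ g         ≈⟨ +-cong df (-‿cong dg) ⟩
    f * s - g * s     ≈⟨ solve 3 (λ f g s → f :* s :- g :* s := s :* (f :- g)) ≈-refl f g s ⟩
    s * (f - g)       ∎
    where open PS-Reasoning
          open PS-Solver using (solve; _:=_; _:*_; _:-_)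
  step : ∀ n → (∀ k → k ℕ.< n → h k ≡ 0ℚ) → h n ≡ 0ℚ
  step zero    _  = trans (minus-at f g 0) (trans (cong (ℚ._- g 0) f0≡g0) (ℚₚ.+-inverseʳ (g 0)))
  step (suc n) ih = ℚ-cancelˡ (ι-suc≢0 n) (begin
    ι (suc n) ℚ.* h (suc n)                      ≡⟨ δ-at h (suc n) ⟨
    δ h (suc n)                                  ≡⟨ at dh (suc n) ⟩
    (s * h) (suc n)                              ≡⟨ *-suc s h n ⟩
    s 0 ℚ.* h (suc n) ℚ.+ (tail s * h) n         ≡⟨ cong₂ (λ a b → a ℚ.* h (suc n) ℚ.+ b) s0
        (*-vanishes n (λ k k≤n → ih k (s≤s k≤n))) ⟩
    0ℚ ℚ.* h (suc n) ℚ.+ 0ℚ                      ≡⟨ solve 2 (λ x y → # 0 :* x :+ # 0 := y :* # 0) refl (h (suc n)) (ι (suc n)) ⟩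
    ι (suc n) ℚ.* 0ℚ                             ∎)
    where open ≡-Reasoning
          open ℚ-Solver using (solve; _:=_; _:*_; _:+_; #_)

LogD-* : ∀ {f g s r} → LogD f s → LogD g r → LogD (f * g) (s + r)
LogD-* {f} {g} {s} {r} df dg = ≈-trans (δ-* f g) (≈-trans (+-cong (*-cong df ≈-refl) (*-cong ≈-refl dg))
  (solve 4 (λ f g s r → f :* s :* g :+ f :* (g :* r) := f :* g :* (s :+ r)) ≈-refl f g s r))
  where open PS-Solver

LogD-1 : LogD 1# 0#
LogD-1 = ≈-trans (δ-K (+ 1)) (≈-sym (zeroʳ 1#))

LogD-cong : ∀ {f g s r} → f ≈ g → s ≈ r → LogD f s → LogD g r
LogD-cong f≈g s≈r df = ≈-trans (δ-cong (≈-sym f≈g)) (≈-trans df (*-cong f≈g s≈r))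

LogD-^ : ∀ {f s} n → LogD f s → LogD (f ^ n) (K (+ n) * s)
LogD-^ {f} {s} zero    df = LogD-cong ≈-refl (≈-sym (zeroˡ s)) LogD-1
LogD-^ {f} {s} (suc n) df = LogD-cong ≈-refl
  (≈-trans (solve 2 (λ s k → s :+ k :* s := (# 1 :+ k) :* s) ≈-refl s (K (+ n)))
           (*-cong (≈-sym (K-+ (+ 1) (+ n))) ≈-refl))
  (LogD-* df (LogD-^ n df))
  where open PS-Solver

-- The list product inside `invRev`, with the index function p left free: dropping the first entry
-- shifts p, so the induction needs this generality.
invDot : (ℕ → ℚ) → (ℕ → ℕ) → PS → ℕ → ℚ
invDot f p L n = foldr ℚ._+_ 0ℚ (List.zipWith ℚ._*_ (List.map f (List.map suc (applyUpTo p (suc n)))) (invRev L n))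

invDot-* : ∀ f p L n → invDot f p L n ≡ ((λ k → f (suc (p k))) * inv L) n
invDot-* f p L zero    = trans (ℚₚ.+-identityʳ _) (sym (*-0 (λ k → f (suc (p k))) (inv L)))
invDot-* f p L (suc n) = trans (cong (f (suc (p 0)) ℚ.* inv L (suc n) ℚ.+_) (invDot-* f (λ k → p (suc k)) L n))
  (sym (*-suc (λ k → f (suc (p k))) (inv L) n))

*-inv : ∀ f → f 0 ≡ 1ℚ → f * inv f ≈ 1#
*-inv f f0 = ⟪ go ⟫
  where
  go : f * inv f ≋ 1#
  go zero    = trans (*-0 f (inv f)) (trans (ℚₚ.*-identityʳ (f 0)) (trans f0 (sym (K-at (+ 1) 0))))
  go (suc n) = trans (*-suc f (inv f) n) (trans (cong₂ (λ a b → a ℚ.* (ℚ.- b) ℚ.+ (tail f * inv f) n) f0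
      (invDot-* f (λ k → k) f n)) (trans
    (solve 1 (λ x → # 1 :* (:- x) :+ x := # 0) refl ((tail f * inv f) n)) (sym (K-at (+ 1) (suc n)))))
    where open ℚ-Solver

inv-unique : ∀ {f g h} → f * g ≈ 1# → f * h ≈ 1# → g ≈ h
inv-unique {f} {g} {h} fg fh = begin
  g             ≈⟨ *-identityʳ g ⟨
  g * 1#         ≈⟨ *-cong ≈-refl fh ⟨
  g * (f * h)   ≈⟨ solve 3 (λ f g h → g :* (f :* h) := (f :* g) :* h) ≈-refl f g h ⟩
  f * g * h     ≈⟨ *-cong fg ≈-refl ⟩
  1# * h         ≈⟨ *-identityˡ h ⟩
  h             ∎
  where open PS-Reasoning
        open PS-Solver using (solve; _:=_; _:*_)

≈inv : ∀ {f g} → f 0 ≡ 1ℚ → f * g ≈ 1# → g ≈ inv f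
≈inv {f} f0 fg = inv-unique {f} fg (*-inv f f0)

*-cancelˡ : ∀ {f g h} → f 0 ≡ 1ℚ → f * g ≈ f * h → g ≈ h
*-cancelˡ {f} {g} {h} f0 eq = begin
  g                  ≈⟨ *-identityˡ g ⟨
  1# * g              ≈⟨ *-cong (*-inv f f0) ≈-refl ⟨
  f * inv f * g      ≈⟨ solve 3 (λ f i g → f :* i :* g := i :* (f :* g)) ≈-refl f (inv f) g ⟩
  inv f * (f * g)    ≈⟨ *-cong ≈-refl eq ⟩
  inv f * (f * h)    ≈⟨ solve 3 (λ f i g → i :* (f :* g) := f :* i :* g) ≈-refl f (inv f) h ⟩
  f * inv f * h      ≈⟨ *-cong (*-inv f f0) ≈-refl ⟩
  1# * h              ≈⟨ *-identityˡ h ⟩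
  h                  ∎
  where open PS-Reasoning
        open PS-Solver using (solve; _:=_; _:*_)

LogD-inv : ∀ {f s} → f 0 ≡ 1ℚ → LogD f s → LogD (inv f) (- s)
LogD-inv {f} {s} f0 df = *-cancelˡ {f} f0 (begin
  f * δ i                    ≈⟨ solve 4 (λ f s i d → f :* d := (f :* s :* i :+ f :* d) :- f :* i :* s) ≈-refl f s i (δ i) ⟩
  (f * s * i + f * δ i) + - (f * i * s)
                             ≈⟨ +-cong (≈-trans (+-cong (*-cong (≈-sym df) ≈-refl) ≈-refl) (≈-trans (≈-sym (δ-* f i)) (≈-trans (δ-cong (*-inv f f0)) (δ-K (+ 1))))) ≈-refl ⟩
  0# + - (f * i * s)       ≈⟨ solve 3 (λ f i s → # 0 :+ :- (f :* i :* s) := f :* (i :* :- s)) ≈-refl f i s ⟩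
  f * (i * - s)            ∎)
  where
  i : PS
  i = inv f
  open PS-Reasoning
  open PS-Solver using (solve; _:=_; _:*_; _:+_; _:-_; :-_; #_)

-- kd m is both the Kronecker delta and the monomial q^m.
kd : ℕ → ℕ → ℚ
kd zero    zero    = 1ℚ
kd zero    (suc n) = 0ℚ
kd (suc m) zero    = 0ℚ
kd (suc m) (suc n) = kd m n

kd-refl : ∀ n → kd n n ≡ 1ℚ
kd-refl zero    = refl
kd-refl (suc n) = kd-refl n

kd-≢ : ∀ {m n} → m ≢ n → kd m n ≡ 0ℚ
kd-≢ {zero}  {zero}  ne = contradiction refl ne
kd-≢ {zero}  {suc n} ne = refl
kd-≢ {suc m} {zero}  ne = refl
kd-≢ {suc m} {suc n} ne = kd-≢ (λ eq → ne (cong suc eq))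

kd-> : ∀ {m n} → n ℕ.< m → kd m n ≡ 0ℚ
kd-> n<m = kd-≢ (λ eq → ℕₚ.<-irrefl (sym eq) n<m)

kd-+ˡ : ∀ k m n → kd (k ℕ.+ m) (k ℕ.+ n) ≡ kd m n
kd-+ˡ zero    m n = refl
kd-+ˡ (suc k) m n = kd-+ˡ k m n

kd-subst : ∀ (f : ℕ → ℚ) m n → f m ℚ.* kd m n ≡ f n ℚ.* kd m n
kd-subst f m n with m ℕ.≟ n
... | yes refl = refl
... | no m≢n   = trans (cong (f m ℚ.*_) (kd-≢ m≢n)) (trans (ℚₚ.*-zeroʳ (f m))
    (sym (trans (cong (f n ℚ.*_) (kd-≢ m≢n)) (ℚₚ.*-zeroʳ (f n)))))

kd-* : ∀ m f i → (kd m * f) (m ℕ.+ i) ≡ f i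
kd-* zero    f i = at (≈-trans (*-cong {kd 0} {1#} ⟪ (λ { zero → sym (K-at (+ 1) 0) ; (suc n) → sym (K-at (+ 1) (suc n)) }) ⟫
    ≈-refl) (*-identityˡ f)) i
kd-* (suc m) f i = trans (*-suc (kd (suc m)) f (m ℕ.+ i)) (trans (cong₂ ℚ._+_ (ℚₚ.*-zeroˡ (f (suc (m ℕ.+ i)))) (kd-* m f i))
    (ℚₚ.+-identityˡ (f i)))

kd-*-< : ∀ m f i → i ℕ.< m → (kd m * f) i ≡ 0ℚ
kd-*-< m f i i<m = trans (at (*-comm (kd m) f) i) (*-vanishes i (λ k k≤i → kd-> (ℕₚ.≤-<-trans k≤i i<m)))

kd-*-kd : ∀ m n → kd m * kd n ≈ kd (m ℕ.+ n)
kd-*-kd m n = ⟪ go ⟫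
  where
  go : ∀ i → (kd m * kd n) i ≡ kd (m ℕ.+ n) i
  go i with ℕₚ.<-≤-connex i m
  ... | inj₁ i<m = trans (kd-*-< m (kd n) i i<m) (sym (kd-> (ℕₚ.<-≤-trans i<m (ℕₚ.m≤m+n m n))))
  ... | inj₂ m≤i with ℕₚ.m≤n⇒∃[o]m+o≡n m≤i
  ...   | j , refl = trans (kd-* m (kd n) j) (sym (kd-+ˡ m n j))

1#-at : ∀ n → 1# n ≡ kd 0 n
1#-at zero    = K-at (+ 1) 0
1#-at (suc n) = K-at (+ 1) (suc n)

shift-≈ : ∀ f → shift f ≈ kd 1 * f
shift-≈ f = ⟪ (λ { zero → sym (kd-*-< 1 f 0 ℕₚ.≤-refl) ; (suc n) → sym (kd-* 1 f n) }) ⟫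

⊛→* : ∀ {f f′ g g′} → f ≈ f′ → g ≈ g′ → f ⊛ g ≈ f′ * g′
⊛→* {f} {f′} {g} {g′} p q = ≈-trans ⟪ (λ n → sym (*-at f g n)) ⟫ (*-cong p q)

⊕→+ : ∀ {f f′ g g′} → f ≈ f′ → g ≈ g′ → f ⊕ g ≈ f′ + g′
⊕→+ {f} {f′} {g} {g′} p q = ≈-trans ⟪ (λ n → sym (+-at f g n)) ⟫ (+-cong p q)

⊖→- : ∀ {f f′ g g′} → f ≈ f′ → g ≈ g′ → f ⊖ g ≈ f′ - g′
⊖→- {f} {f′} {g} {g′} p q = ≈-trans ⟪ (λ n → sym (minus-at f g n)) ⟫ (+-cong p (-‿cong q))

·→* : ∀ n {f g} → f ≈ g → ι n · f ≈ K (+ n) * g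
·→* n {f} {g} p = ⟪ (λ k → trans (cong (ι n ℚ.*_) (at p k)) (sym (K-*-at (+ n) g k))) ⟫

𝟙→1# : 𝟙 ≈ 1#
𝟙→1# = ⟪ (λ n → sym (K-at (+ 1) n)) ⟫

^ˢ→^ : ∀ n {f g} → f ≈ g → f ^ˢ n ≈ g ^ n
^ˢ→^ zero    p = 𝟙→1#
^ˢ→^ (suc n) p = ⊛→* p (^ˢ→^ n p)

qˢ^ : ∀ n → qˢ ^ˢ n ≈ kd n
qˢ^ zero    = ≈-trans 𝟙→1# ⟪ 1#-at ⟫
qˢ^ (suc n) = ≈-trans (⊛→* {qˢ} {kd 1} {qˢ ^ˢ n} ⟪ (λ { zero → refl ; (suc zero) → refl ; (suc (suc n)) → refl }) ⟫ (qˢ^ n))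
    (kd-*-kd 1 n)

-- q^m / (1 - q^m)
D : ℕ → PS
D m i = ∑ i (λ x → kd (suc x ℕ.* m) i)

D-+ : ∀ m j → D (suc m) (suc m ℕ.+ j) ≡ kd 0 j ℚ.+ D (suc m) j
D-+ m j = cong₂ ℚ._+_
  (trans (cong (λ z → kd z (suc m ℕ.+ j)) (ℕₚ.*-identityˡ (suc m))) (trans
      (cong (λ z → kd z (suc m ℕ.+ j)) (sym (ℕₚ.+-identityʳ (suc m)))) (kd-+ˡ (suc m) 0 j)))
  (trans (∑-cong′ (m ℕ.+ j) (λ x → kd-+ˡ (suc m) (suc x ℕ.* suc m) j))
         (∑-extend (λ x → kd (suc x ℕ.* suc m) j) (ℕₚ.m≤n+m j m)
           (λ x j≤x → kd-> (ℕₚ.<-≤-trans (s≤s j≤x) (ℕₚ.m≤m*n (suc x) (suc m))))))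

-- δ(1 - q^m) = -m q^m, and `core` is the geometric series identity D = q^m + q^m D.
LogD-1-q^ : ∀ m → LogD (1# - kd (suc m)) (- (K (+ suc m) * D (suc m)))
LogD-1-q^ m = ≈-trans (≈-trans (δ-minus 1# (kd M)) (+-cong (δ-K (+ 1)) ≈-refl)) (≈-trans ⟪ pt ⟫
  (solve 3 (λ a k d → :- (k :* d) :+ k :* (a :* d) := (# 1 :- a) :* (:- (k :* d))) ≈-refl (kd M) (K (+ M)) (D M)))
  where
  open PS-Solver using (solve; _:=_; _:*_; _:-_; _:+_; :-_; #_)
  module Q = ℚ-Solver
  M : ℕ
  M = suc m
  lhs : ∀ i → (0# - δ (kd M)) i ≡ ℚ.- (ι M ℚ.* kd M i)
  lhs i = trans (minus-at 0# (δ (kd M)) i) (trans (cong₂ ℚ._-_ (0#-at i) (trans (δ-at (kd M) i) (sym (kd-subst ι M i))))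
      (ℚₚ.+-identityˡ _))
  rhs : ∀ i → (- (K (+ M) * D M) + K (+ M) * (kd M * D M)) i ≡ (ℚ.- (ι M ℚ.* D M i)) ℚ.+ ι M ℚ.* (kd M * D M) i
  rhs i = trans (+-at (- (K (+ M) * D M)) (K (+ M) * (kd M * D M)) i)
    (cong₂ ℚ._+_ (trans (neg-at (K (+ M) * D M) i) (cong ℚ.-_ (K-*-at (+ M) (D M) i))) (K-*-at (+ M) (kd M * D M) i))
  core : ∀ i → D M i ≡ kd M i ℚ.+ (kd M * D M) i
  core i with ℕₚ.<-≤-connex i M
  ... | inj₁ i<M = trans (∑-zero i (λ x _ → kd-> (ℕₚ.<-≤-trans i<M (ℕₚ.m≤n*m M (suc x)))))
      (sym (cong₂ ℚ._+_ (kd-> i<M) (kd-*-< M (D M) i i<M)))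
  ... | inj₂ M≤i with ℕₚ.m≤n⇒∃[o]m+o≡n M≤i
  ...   | j , refl = trans (D-+ m j) (sym (cong₂ ℚ._+_ (trans (cong (λ z → kd z (M ℕ.+ j)) (sym (ℕₚ.+-identityʳ M)))
      (kd-+ˡ M 0 j)) (kd-* M (D M) j)))
  pt : ∀ i → (0# - δ (kd M)) i ≡ (- (K (+ M) * D M) + K (+ M) * (kd M * D M)) i
  pt i = trans (lhs i) (trans
    (Q.solve 3 (λ k a b → Q.:- (k Q.:* a) Q.:= (Q.:- (k Q.:* (a Q.:+ b))) Q.:+ k Q.:* b) refl (ι M) (kd M i) ((kd M * D M) i))
    (trans (cong (λ z → (ℚ.- (ι M ℚ.* z)) ℚ.+ ι M ℚ.* (kd M * D M) i) (sym (core i))) (sym (rhs i))))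

-- Convergence in the q-adic sense: `unit` makes coefficient k of the partial products constant from
-- the k-th on, and `small` does the same for the partial sums of logarithmic derivatives.
record Factor (P : ℕ → PS) (s : ℕ → PS) : Set where
  field
    unit  : ∀ n k → k ℕ.≤ n → P (suc n) k ≡ 1# k
    logD  : ∀ n → LogD (P (suc n)) (s (suc n))
    small : ∀ n k → k ℕ.≤ n → s (suc n) k ≡ 0ℚ

finProd-stable : ∀ {P} → (∀ n k → k ℕ.≤ n → P (suc n) k ≡ 1# k) → ∀ k j → finProd P (j ℕ.+ k) k ≡ infProd P k
finProd-stable {P} unit k zero    = refl
finProd-stable {P} unit k (suc j) = trans
  (⊛-cong-≤ {F} {F} {P (suc (j ℕ.+ k))} {1#} k (λ _ _ → refl) (λ i i≤k → unit (j ℕ.+ k) i (ℕₚ.≤-trans i≤k (ℕₚ.m≤n+m k j))))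
  (trans (sym (*-at F 1# k)) (trans (at (*-identityʳ F) k) (finProd-stable unit k j)))
  where
  F : PS
  F = finProd P (j ℕ.+ k)

finProd-infProd : ∀ {P} → (∀ n k → k ℕ.≤ n → P (suc n) k ≡ 1# k) → ∀ {k N} → k ℕ.≤ N → finProd P N k ≡ infProd P k
finProd-infProd {P} unit {k} k≤N with ℕₚ.m≤n⇒∃[o]m+o≡n k≤N
... | o , refl = trans (cong (λ z → finProd P z k) (ℕₚ.+-comm k o)) (finProd-stable unit k o)

-- At coefficient N both sides see only the first N factors, where the product rule for finite
-- products applies.
infProd-LogD : ∀ {P s} → Factor P s → LogD (infProd P) (λ j → ∑ j (λ i → s (suc i) j))
infProd-LogD {P} {s} F = ⟪ pt ⟫
  where
  open Factor F
  S : ℕ → PS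
  S N j = ∑ N (λ i → s (suc i) j)
  fin : ∀ N → LogD (finProd P N) (S N)
  fin zero    = LogD-cong (≈-sym 𝟙→1#) ⟪ 0#-at ⟫ LogD-1
  fin (suc N) = LogD-cong (≈-sym (⊛→* {finProd P N} {g = P (suc N)} ≈-refl ≈-refl)) ⟪
      (λ j → trans (+-at (S N) (s (suc N)) j) (sym (∑-last N (λ i → s (suc i) j)))) ⟫ (LogD-* (fin N) (logD N))
  pt : δ (infProd P) ≋ infProd P * (λ j → ∑ j (λ i → s (suc i) j))
  pt N = trans (δ-at (infProd P) N) (trans (sym (δ-at (finProd P N) N))
      (trans (at (fin N) N) (*-cong-≤ (finProd P N) (infProd P) (S N) (λ j → ∑ j (λ i → s (suc i) j)) N
    (λ k k≤N → finProd-infProd unit k≤N)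
    (λ k k≤N → ∑-extend (λ i → s (suc i) k) k≤N (λ i k≤i → small i k k≤i)))))

-- Convolution of Lambert series

∑-cong₂ : ∀ m n {f g : ℕ → ℕ → ℚ} → (∀ i j → f i j ≡ g i j) → ∑ m (λ i → ∑ n (f i)) ≡ ∑ m (λ i → ∑ n (g i))
∑-cong₂ m n h = ∑-cong′ m (λ i → ∑-cong′ n (h i))

-- The pairs i < d < n, listed by i with d = i + k + 1 on one side and by d on the other.
∑-upper : ∀ n (F : ℕ → ℕ → ℚ) →
  ∑ n (λ i → ∑ (n ∸ suc i) (λ k → F i (i ℕ.+ suc k))) ≡ ∑ n (λ d → ∑ d (λ i → F i d))
∑-upper zero    F = refl
∑-upper (suc n) F = begin
  ∑ n (λ k → F 0 (suc k)) ℚ.+ ∑ n (λ i → ∑ (n ∸ suc i) (λ k → F (suc i) (suc (i ℕ.+ suc k))))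
    ≡⟨ cong (∑ n (λ k → F 0 (suc k)) ℚ.+_) (∑-upper n (λ i j → F (suc i) (suc j))) ⟩
  ∑ n (λ k → F 0 (suc k)) ℚ.+ ∑ n (λ d → ∑ d (λ i → F (suc i) (suc d)))
    ≡⟨ ∑-+ n (λ k → F 0 (suc k)) (λ d → ∑ d (λ i → F (suc i) (suc d))) ⟨
  ∑ n (λ d → F 0 (suc d) ℚ.+ ∑ d (λ i → F (suc i) (suc d)))
    ≡⟨ ℚₚ.+-identityˡ _ ⟨
  0ℚ ℚ.+ ∑ n (λ d → F 0 (suc d) ℚ.+ ∑ d (λ i → F (suc i) (suc d))) ∎
  where open ≡-Reasoning

∑-trichotomy′ : ∀ n (F : ℕ → ℕ → ℚ) →
  ∑ n (λ i → ∑ n (F i)) ≡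
  ∑ n (λ i → F i i) ℚ.+ (∑ n (λ i → ∑ (n ∸ suc i) (λ k → F i (i ℕ.+ suc k))) ℚ.+ ∑ n
      (λ i → ∑ (n ∸ suc i) (λ k → F (i ℕ.+ suc k) i)))
∑-trichotomy′ zero    F = refl
∑-trichotomy′ (suc n) F = begin
  (F 0 0 ℚ.+ r) ℚ.+ ∑ n (λ i → F (suc i) 0 ℚ.+ ∑ n (λ j → F (suc i) (suc j)))
    ≡⟨ cong ((F 0 0 ℚ.+ r) ℚ.+_) (trans (∑-+ n _ _) (cong (c ℚ.+_) (∑-trichotomy′ n (λ i j → F (suc i) (suc j))))) ⟩
  (F 0 0 ℚ.+ r) ℚ.+ (c ℚ.+ (d ℚ.+ (up ℚ.+ low)))
    ≡⟨ solve 6 (λ a r c d u l → (a :+ r) :+ (c :+ (d :+ (u :+ l))) := (a :+ d) :+ ((r :+ u) :+ (c :+ l))) refl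
        (F 0 0) r c d up low ⟩
  (F 0 0 ℚ.+ d) ℚ.+ ((r ℚ.+ up) ℚ.+ (c ℚ.+ low)) ∎
  where
  open ≡-Reasoning
  open ℚ-Solver using (solve; _:=_; _:+_)
  r c d up low : ℚ
  r = ∑ n (λ j → F 0 (suc j))
  c = ∑ n (λ i → F (suc i) 0)
  d = ∑ n (λ i → F (suc i) (suc i))
  up = ∑ n (λ i → ∑ (n ∸ suc i) (λ k → F (suc i) (suc (i ℕ.+ suc k))))
  low = ∑ n (λ i → ∑ (n ∸ suc i) (λ k → F (suc (i ℕ.+ suc k)) (suc i)))

∑-extend-∸ : ∀ n (F : ℕ → ℕ → ℚ) → (∀ i j → n ℕ.≤ j → F i j ≡ 0ℚ) →
  ∑ n (λ i → ∑ n (λ k → F i (i ℕ.+ suc k))) ≡ ∑ n (λ i → ∑ (n ∸ suc i) (λ k → F i (i ℕ.+ suc k)))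
∑-extend-∸ n F h = ∑-cong′ n (λ i → ∑-extend (λ k → F i (i ℕ.+ suc k)) (ℕₚ.m∸n≤m n (suc i))
  (λ k le → h i (i ℕ.+ suc k) (ℕₚ.≤-trans (ℕₚ.≤-trans (ℕₚ.m≤n+m∸n n (suc i)) (ℕₚ.+-monoʳ-≤ (suc i) le))
      (ℕₚ.≤-reflexive (sym (ℕₚ.+-suc i k))))))

-- The shortened ranges of `∑-trichotomy′` are extended to full ones, harmlessly because F vanishes
-- beyond n; with uniform ranges the order of summation can be exchanged freely.
∑-trichotomy : ∀ n (F : ℕ → ℕ → ℚ) → (∀ i j → n ℕ.≤ j → F i j ≡ 0ℚ) → (∀ i j → n ℕ.≤ i → F i j ≡ 0ℚ) →
  ∑ n (λ i → ∑ n (F i)) ≡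
  ∑ n (λ i → F i i) ℚ.+ (∑ n (λ i → ∑ n (λ k → F i (i ℕ.+ suc k))) ℚ.+ ∑ n (λ i → ∑ n (λ k → F (i ℕ.+ suc k) i)))
∑-trichotomy n F h₁ h₂ = trans (∑-trichotomy′ n F) (cong₂ (λ u l → ∑ n (λ i → F i i) ℚ.+ (u ℚ.+ l))
  (sym (∑-extend-∸ n F h₁)) (sym (∑-extend-∸ n (λ i j → F j i) (λ i j → h₂ j i))))

∑-telescope : ∀ n (H : ℕ → ℚ) → ∑ n (λ i → H (suc i) ℚ.- H i) ≡ H n ℚ.- H 0
∑-telescope zero    H = sym (ℚₚ.+-inverseʳ (H 0))
∑-telescope (suc n) H = trans (cong (H 1 ℚ.- H 0 ℚ.+_) (∑-telescope n (λ i → H (suc i))))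
  (solve 3 (λ a b c → (a :- b) :+ (c :- a) := c :- b) refl (H 1) (H 0) (H (suc n)))
  where open ℚ-Solver

-- With x = i + 1 and y = j + 1 the weight depends only on x + y = d + 1. For fixed d the variable x
-- runs from 1 to d, and the differences in x telescope.
∑-antidiagonal : ∀ n (H : ℕ → ℕ → ℚ) (φ : ℕ → ℚ) → (∀ d → n ℕ.≤ d → φ d ≡ 0ℚ) →
  ∑ n (λ i → ∑ n (λ j → (H (suc (suc i)) (suc i ℕ.+ suc j) ℚ.- H (suc i) (suc i ℕ.+ suc j)) ℚ.* φ (i ℕ.+ suc j))) ≡
  ∑ n (λ d → (H (suc d) (suc d) ℚ.- H 1 (suc d)) ℚ.* φ d)
∑-antidiagonal n H φ φ0 = trans (∑-extend-∸ n W (λ i d n≤d → trans (cong ((H (suc (suc i)) (suc d) ℚ.- H (suc i) (suc d)) ℚ.*_)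
    (φ0 d n≤d)) (ℚₚ.*-zeroʳ (H (suc (suc i)) (suc d) ℚ.- H (suc i) (suc d)))))
  (trans (∑-upper n W) (∑-cong′ n (λ d → trans (∑-*ʳ d (λ i → H (suc (suc i)) (suc d) ℚ.- H (suc i) (suc d)) (φ d))
    (cong (ℚ._* φ d) (∑-telescope d (λ i → H (suc i) (suc d)))))))
  where
  W : ℕ → ℕ → ℚ
  W i d = (H (suc (suc i)) (suc d) ℚ.- H (suc i) (suc d)) ℚ.* φ d

minus-distribʳ : ∀ x y k → x ℚ.* k ℚ.- y ℚ.* k ≡ (x ℚ.- y) ℚ.* k
minus-distribʳ = solve 3 (λ x y k → x :* k :- y :* k := (x :- y) :* k) refl
  where open ℚ-Solver

-- Lam h = Σ_{a,x ≥ 1} h(a,x) q^{ax}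
Lam : (ℕ → ℕ → ℚ) → PS
Lam h n = ∑ n (λ a → ∑ n (λ x → h (suc a) (suc x) ℚ.* kd (suc a ℕ.* suc x) n))

-- The coefficient of q^n in the sum of f(a,b,x,y) q^(ax + by) over positive integers; a variable
-- above n would make the exponent exceed n.
Ω : (ℕ → ℕ → ℕ → ℕ → ℚ) → ℕ → ℚ
Ω f n = ∑ n (λ a → ∑ n (λ b → ∑ n (λ x → ∑ n (λ y →
  f (suc a) (suc b) (suc x) (suc y) ℚ.* kd (suc a ℕ.* suc x ℕ.+ suc b ℕ.* suc y) n))))

vanish : ∀ (c : ℚ) {m n} → n ℕ.< m → c ℚ.* kd m n ≡ 0ℚ
vanish c n<m = trans (cong (c ℚ.*_) (kd-> n<m)) (ℚₚ.*-zeroʳ c)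

Lam-bound : ∀ h {k n} → k ℕ.≤ n → Lam h k ≡ ∑ n (λ a → ∑ n (λ x → h (suc a) (suc x) ℚ.* kd (suc a ℕ.* suc x) k))
Lam-bound h {k} {n} k≤n = sym (trans
  (∑-extend (λ a → ∑ n (λ x → h (suc a) (suc x) ℚ.* kd (suc a ℕ.* suc x) k)) k≤n
    (λ a k≤a → ∑-zero n (λ x _ → vanish (h (suc a) (suc x)) (ℕₚ.<-≤-trans (s≤s k≤a) (ℕₚ.m≤m*n (suc a) (suc x))))))
  (∑-cong′ k (λ a → ∑-extend (λ x → h (suc a) (suc x) ℚ.* kd (suc a ℕ.* suc x) k) k≤n
    (λ x k≤x → vanish (h (suc a) (suc x)) (ℕₚ.<-≤-trans (s≤s k≤x) (ℕₚ.m≤n*m (suc x) (suc a)))))))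

∑-* : ∀ m (F : ℕ → PS) g n → ((λ i → ∑ m (λ a → F a i)) * g) n ≡ ∑ m (λ a → (F a * g) n)
∑-* zero    F g n = trans (at (≈-trans (*-cong {_} {0#} ⟪ (λ k → sym (0#-at k)) ⟫ ≈-refl) (zeroˡ g)) n) (0#-at n)
∑-* (suc m) F g n = trans (at (≈-trans (*-cong {_} {F 0 + r} ⟪ (λ i → sym (+-at (F 0) r i)) ⟫ (≈-refl {g}))
    (≈-trans (solve 3 (λ a b g → (a :+ b) :* g := a :* g :+ b :* g) ≈-refl (F 0) r g) ≈-refl)) n)
  (trans (+-at (F 0 * g) (r * g) n) (cong ((F 0 * g) n ℚ.+_) (∑-* m (λ a → F (suc a)) g n)))
  where
  open PS-Solver using (solve; _:=_; _:*_; _:+_)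
  r : PS
  r i = ∑ m (λ a → F (suc a) i)

scale-* : ∀ c f g n → ((λ i → c ℚ.* f i) * g) n ≡ c ℚ.* (f * g) n
scale-* c f g n = trans (*-at (λ i → c ℚ.* f i) g n) (trans (·-⊛′ n c f g) (cong (c ℚ.*_) (sym (*-at f g n))))

Lam-* : ∀ h k n → (Lam h * Lam k) n ≡ Ω (λ a b x y → h a x ℚ.* k b y) n
Lam-* h k n = begin
  (Lam h * Lam k) n
    ≡⟨ *-cong-≤ (Lam h) (L h) (Lam k) (L k) n (λ i i≤n → Lam-bound h i≤n) (λ i i≤n → Lam-bound k i≤n) ⟩
  (L h * L k) n
    ≡⟨ expand h (L k) ⟩
  ∑ n (λ a → ∑ n (λ x → h (suc a) (suc x) ℚ.* (kd (suc a ℕ.* suc x) * L k) n))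
    ≡⟨ ∑-cong₂ n n (λ a x → cong (h (suc a) (suc x) ℚ.*_) (trans (at (*-comm (kd (suc a ℕ.* suc x)) (L k)) n)
        (expand k (kd (suc a ℕ.* suc x))))) ⟩
  ∑ n (λ a → ∑ n (λ x → h (suc a) (suc x) ℚ.* ∑ n (λ b → ∑ n (λ y → k (suc b) (suc y) ℚ.*
      (kd (suc b ℕ.* suc y) * kd (suc a ℕ.* suc x)) n))))
    ≡⟨ ∑-cong₂ n n (λ a x → trans (sym (∑-*ˡ n (h (suc a) (suc x)) _))
        (∑-cong′ n (λ b → trans (sym (∑-*ˡ n (h (suc a) (suc x)) _)) (∑-cong′ n (λ y →
         trans (sym (ℚₚ.*-assoc (h (suc a) (suc x)) (k (suc b) (suc y)) _)) (cong (h (suc a) (suc x) ℚ.* k (suc b) (suc y) ℚ.*_)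
           (trans (at (kd-*-kd (suc b ℕ.* suc y) (suc a ℕ.* suc x)) n)
               (cong (λ z → kd z n) (ℕₚ.+-comm (suc b ℕ.* suc y) (suc a ℕ.* suc x)))))))))) ⟩
  ∑ n (λ a → ∑ n (λ x → ∑ n (λ b → ∑ n (λ y → h (suc a) (suc x) ℚ.* k (suc b) (suc y) ℚ.* kd
      (suc a ℕ.* suc x ℕ.+ suc b ℕ.* suc y) n))))
    ≡⟨ ∑-cong′ n (λ a → ∑-swap n n (λ x b → ∑ n (λ y → h (suc a) (suc x) ℚ.* k (suc b) (suc y) ℚ.* kd
        (suc a ℕ.* suc x ℕ.+ suc b ℕ.* suc y) n))) ⟩
  Ω (λ a b x y → h a x ℚ.* k b y) n ∎
  where
  open ≡-Reasoning
  L : (ℕ → ℕ → ℚ) → PS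
  L h k = ∑ n (λ a → ∑ n (λ x → h (suc a) (suc x) ℚ.* kd (suc a ℕ.* suc x) k))
  expand : ∀ h g → (L h * g) n ≡ ∑ n (λ a → ∑ n (λ x → h (suc a) (suc x) ℚ.* (kd (suc a ℕ.* suc x) * g) n))
  expand h g = trans (∑-* n (λ a i → ∑ n (λ x → h (suc a) (suc x) ℚ.* kd (suc a ℕ.* suc x) i)) g n)
    (∑-cong′ n (λ a → trans (∑-* n (λ x i → h (suc a) (suc x) ℚ.* kd (suc a ℕ.* suc x) i) g n)
      (∑-cong′ n (λ x → scale-* (h (suc a) (suc x)) (kd (suc a ℕ.* suc x)) g n))))

-- The substitution (a,b,x,y) ↦ (a, a+b, x-y, y) preserves ax + by and maps x > y onto a < b.
-- If f(a,a+c,x,y) = g(a,c,x+y,y) - g(a,a+c,x,y), then over a < b the sum of f telescopes, and only the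
-- contributions of a = b and of x = y survive.
record Convolution (f : ℕ → ℕ → ℕ → ℕ → ℚ) : Set where
  field
    g     : ℕ → ℕ → ℕ → ℕ → ℚ
    f-sym : ∀ a b x y → f a b x y ≡ f b a y x
    g-sym : ∀ a b x y → g a b x y ≡ g b a y x
    step  : ∀ a c x y → f a (a ℕ.+ c) x y ≡ g a c (y ℕ.+ x) y ℚ.- g a (a ℕ.+ c) x y
    H₁    : ℕ → ℕ → ℕ → ℚ
    H₁-Δ  : ∀ a x y → f a a x y ℚ.+ g a a x y ≡ H₁ a (suc x) (x ℕ.+ y) ℚ.- H₁ a x (x ℕ.+ y)
    H₂    : ℕ → ℕ → ℕ → ℚ
    H₂-Δ  : ∀ a b x → g a b x x ≡ H₂ (suc a) (a ℕ.+ b) x ℚ.- H₂ a (a ℕ.+ b) x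

  boundary : ℕ → ℕ → ℚ
  boundary a x = (H₁ a x x ℚ.- H₁ a 1 x) ℚ.- (H₂ a a x ℚ.- H₂ 1 a x)

module _ (n : ℕ) where

  -- `lower` is the part a < b with b = a + c, `upper` the part in which x is replaced by y + x.
  -- Both are written over the same (a,c,x,y) with the same exponent, so that they can be compared
  -- term by term.
  diag₁ diag₂ lower upper : (ℕ → ℕ → ℕ → ℕ → ℚ) → ℚ
  diag₁ f = ∑ n (λ a → ∑ n (λ x → ∑ n (λ y → f (suc a) (suc a) (suc x) (suc y) ℚ.* kd (suc a ℕ.* suc x ℕ.+ suc a ℕ.* suc y) n)))
  diag₂ f = ∑ n (λ x → ∑ n (λ a → ∑ n (λ b → f (suc a) (suc b) (suc x) (suc x) ℚ.* kd (suc a ℕ.* suc x ℕ.+ suc b ℕ.* suc x) n)))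
  lower f = ∑ n (λ a → ∑ n (λ c → ∑ n (λ x → ∑ n (λ y →
    f (suc a) (suc a ℕ.+ suc c) (suc x) (suc y) ℚ.* kd (suc a ℕ.* suc x ℕ.+ (suc a ℕ.+ suc c) ℕ.* suc y) n))))
  upper f = ∑ n (λ a → ∑ n (λ c → ∑ n (λ x → ∑ n (λ y →
    f (suc a) (suc c) (suc y ℕ.+ suc x) (suc y) ℚ.* kd (suc a ℕ.* suc x ℕ.+ (suc a ℕ.+ suc c) ℕ.* suc y) n))))

  big₁ : ∀ a x b y → n ℕ.≤ a → n ℕ.< suc a ℕ.* suc x ℕ.+ suc b ℕ.* suc y
  big₁ a x b y n≤a = ℕₚ.<-≤-trans (s≤s n≤a) (ℕₚ.≤-trans (ℕₚ.m≤m*n (suc a) (suc x)) (ℕₚ.m≤m+n (suc a ℕ.* suc x) (suc b ℕ.* suc y)))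

  big₂ : ∀ a x b y → n ℕ.≤ b → n ℕ.< suc a ℕ.* suc x ℕ.+ suc b ℕ.* suc y
  big₂ a x b y n≤b = ℕₚ.<-≤-trans (s≤s n≤b) (ℕₚ.≤-trans (ℕₚ.m≤m*n (suc b) (suc y)) (ℕₚ.m≤n+m (suc b ℕ.* suc y) (suc a ℕ.* suc x)))

  big₃ : ∀ a x b y → n ℕ.≤ x → n ℕ.< suc a ℕ.* suc x ℕ.+ suc b ℕ.* suc y
  big₃ a x b y n≤x = ℕₚ.<-≤-trans (s≤s n≤x) (ℕₚ.≤-trans (ℕₚ.m≤n*m (suc x) (suc a)) (ℕₚ.m≤m+n (suc a ℕ.* suc x) (suc b ℕ.* suc y)))

  big₄ : ∀ a x b y → n ℕ.≤ y → n ℕ.< suc a ℕ.* suc x ℕ.+ suc b ℕ.* suc y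
  big₄ a x b y n≤y = ℕₚ.<-≤-trans (s≤s n≤y) (ℕₚ.≤-trans (ℕₚ.m≤n*m (suc y) (suc b)) (ℕₚ.m≤n+m (suc b ℕ.* suc y) (suc a ℕ.* suc x)))

  module _ (f : ℕ → ℕ → ℕ → ℕ → ℚ) (f-sym : ∀ a b x y → f a b x y ≡ f b a y x) where

    -- Exchanging (a,x) with (b,y) preserves f and the exponent, so the halves a < b and a > b
    -- agree; `Ω-by-xy` does the same for x and y.
    Ω-by-ab : Ω f n ≡ diag₁ f ℚ.+ (lower f ℚ.+ lower f)
    Ω-by-ab = trans
      (∑-trichotomy n (λ a b → ∑ n (λ x → ∑ n (λ y → f (suc a) (suc b) (suc x) (suc y) ℚ.* kd
          (suc a ℕ.* suc x ℕ.+ suc b ℕ.* suc y) n)))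
        (λ a b n≤b → ∑-zero n (λ x _ → ∑-zero n (λ y _ → vanish (f (suc a) (suc b) (suc x) (suc y)) (big₂ a x b y n≤b))))
        (λ a b n≤a → ∑-zero n (λ x _ → ∑-zero n (λ y _ → vanish (f (suc a) (suc b) (suc x) (suc y)) (big₁ a x b y n≤a)))))
      (cong (λ z → diag₁ f ℚ.+ (lower f ℚ.+ z)) (∑-cong₂ n n (λ a c → trans (∑-swap n n _) (∑-cong₂ n n (λ x y →
        cong₂ ℚ._*_ (f-sym (suc a ℕ.+ suc c) (suc a) (suc y) (suc x)) (cong (λ z → kd z n)
            (ℕₚ.+-comm ((suc a ℕ.+ suc c) ℕ.* suc y) (suc a ℕ.* suc x))))))))

    Ω-by-xy : Ω f n ≡ diag₂ f ℚ.+ (upper f ℚ.+ upper f)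
    Ω-by-xy = trans reorder (trans
      (∑-trichotomy n G
        (λ x y n≤y → ∑-zero n (λ a _ → ∑-zero n (λ b _ → vanish (f (suc a) (suc b) (suc x) (suc y)) (big₄ a x b y n≤y))))
        (λ x y n≤x → ∑-zero n (λ a _ → ∑-zero n (λ b _ → vanish (f (suc a) (suc b) (suc x) (suc y)) (big₃ a x b y n≤x)))))
      (cong₂ (λ u v → diag₂ f ℚ.+ (u ℚ.+ v)) below above))
      where
      open ℕ-Solver using (solve; _:=_; _:+_; _:*_)
      G : ℕ → ℕ → ℚ
      G x y = ∑ n (λ a → ∑ n (λ b → f (suc a) (suc b) (suc x) (suc y) ℚ.* kd (suc a ℕ.* suc x ℕ.+ suc b ℕ.* suc y) n))
      reorder : Ω f n ≡ ∑ n (λ x → ∑ n (G x))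
      reorder = trans (∑-cong′ n (λ a → trans (∑-swap n n _) (∑-cong′ n (λ x → ∑-swap n n _))))
        (trans (∑-swap n n _) (∑-cong′ n (λ x → ∑-swap n n _)))
      unorder : (F : ℕ → ℕ → ℕ → ℕ → ℚ) → ∑ n (λ y → ∑ n (λ x → ∑ n (λ a → ∑ n (λ c → F a c x y)))) ≡ ∑ n
          (λ a → ∑ n (λ c → ∑ n (λ x → ∑ n (λ y → F a c x y))))
      unorder F = trans (∑-swap n n _) (trans (∑-cong′ n (λ x → ∑-swap n n _)) (trans (∑-swap n n _)
        (∑-cong′ n (λ a → trans (∑-cong′ n (λ x → ∑-swap n n _)) (∑-swap n n _)))))
      -- The invariance behind the whole method: a(x + y) + cy = ax + (a + c)y.
      shear : ∀ a c x y → suc a ℕ.* (suc y ℕ.+ suc x) ℕ.+ suc c ℕ.* suc y ≡ suc a ℕ.* suc x ℕ.+ (suc a ℕ.+ suc c) ℕ.* suc y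
      shear a c x y = solve 4 (λ a c x y → a :* (y :+ x) :+ c :* y := a :* x :+ (a :+ c) :* y) refl (suc a) (suc c) (suc x) (suc y)
      above : ∑ n (λ y → ∑ n (λ x → G (y ℕ.+ suc x) y)) ≡ upper f
      above = trans (∑-cong₂ n n (λ y x → ∑-cong₂ n n (λ a c → cong (λ z → f (suc a) (suc c) (suc y ℕ.+ suc x)
          (suc y) ℚ.* kd z n) (shear a c x y))))
        (unorder (λ a c x y → f (suc a) (suc c) (suc y ℕ.+ suc x) (suc y) ℚ.* kd
            (suc a ℕ.* suc x ℕ.+ (suc a ℕ.+ suc c) ℕ.* suc y) n))
      below : ∑ n (λ y → ∑ n (λ x → G y (y ℕ.+ suc x))) ≡ upper f
      below = trans (∑-cong₂ n n (λ y x → trans (∑-swap n n _) (∑-cong₂ n n (λ a c →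
          cong₂ (λ u z → u ℚ.* kd z n) (f-sym (suc c) (suc a) (suc y) (suc y ℕ.+ suc x))
            (trans (ℕₚ.+-comm (suc c ℕ.* suc y) (suc a ℕ.* (suc y ℕ.+ suc x))) (shear a c x y))))))
        (unorder (λ a c x y → f (suc a) (suc c) (suc y ℕ.+ suc x) (suc y) ℚ.* kd
            (suc a ℕ.* suc x ℕ.+ (suc a ℕ.+ suc c) ℕ.* suc y) n))

module _ {f} (C : Convolution f) where
  open Convolution C

  -- `Ω g` is split once along a = b and once along x = y. The condition `step` turns `lower f` into
  -- `upper g - lower g`, so the unknown `Ω g` cancels and only sums over the two diagonals remain,
  -- which telescope through `H₁` and `H₂`.
  convolution : ∀ n → Ω f n ≡ Lam boundary n
  convolution n = begin
    Ω f n
      ≡⟨ Ω-by-ab n f f-sym ⟩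
    diag₁ n f ℚ.+ (lower n f ℚ.+ lower n f)
      ≡⟨ cong (λ z → diag₁ n f ℚ.+ (z ℚ.+ z)) lower-f ⟩
    diag₁ n f ℚ.+ ((upper n g ℚ.- lower n g) ℚ.+ (upper n g ℚ.- lower n g))
      ≡⟨ solve 3 (λ d u l → d :+ ((u :- l) :+ (u :- l)) := d :+ (u :+ u) :- (l :+ l)) refl (diag₁ n f) (upper n g) (lower n g) ⟩
    diag₁ n f ℚ.+ (upper n g ℚ.+ upper n g) ℚ.- (lower n g ℚ.+ lower n g)
      ≡⟨ cong₂ (λ u l → diag₁ n f ℚ.+ u ℚ.- l) (two-up (diag₂ n g) (sym (Ω-by-xy n g g-sym)))
          (two-up (diag₁ n g) (sym (Ω-by-ab n g g-sym))) ⟩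
    diag₁ n f ℚ.+ (Ω g n ℚ.- diag₂ n g) ℚ.- (Ω g n ℚ.- diag₁ n g)
      ≡⟨ solve 4 (λ d o a b → d :+ (o :- b) :- (o :- a) := d :+ a :- b) refl (diag₁ n f) (Ω g n) (diag₁ n g) (diag₂ n g) ⟩
    diag₁ n f ℚ.+ diag₁ n g ℚ.- diag₂ n g
      ≡⟨ cong₂ ℚ._-_ diag₁-H diag₂-H ⟩
    Lam (λ a x → H₁ a x x ℚ.- H₁ a 1 x) n ℚ.- Lam (λ a x → H₂ a a x ℚ.- H₂ 1 a x) n
      ≡⟨ Lam-minus ⟩
    Lam boundary n ∎
    where
    open ≡-Reasoning
    open ℚ-Solver using (solve; _:=_; _:+_; _:-_)
    two-up : ∀ d {u o} → d ℚ.+ u ≡ o → u ≡ o ℚ.- d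
    two-up d {u} eq = trans (solve 2 (λ d u → u := (d :+ u) :- d) refl d u) (cong (ℚ._- d) eq)
    ∑-minus : ∀ (F G : ℕ → ℚ) → ∑ n F ℚ.- ∑ n G ≡ ∑ n (λ i → F i ℚ.- G i)
    ∑-minus F G = sym (trans (∑-+ n F (λ i → ℚ.- G i)) (cong (∑ n F ℚ.+_) (∑-neg n G)))
    lower-f : lower n f ≡ upper n g ℚ.- lower n g
    lower-f = sym (trans (∑-minus _ _) (∑-cong′ n (λ a → trans (∑-minus _ _)
        (∑-cong′ n (λ c → trans (∑-minus _ _) (∑-cong′ n (λ x → trans (∑-minus _ _) (∑-cong′ n (λ y →
      trans (minus-distribʳ (g (suc a) (suc c) (suc y ℕ.+ suc x) (suc y)) (g (suc a) (suc a ℕ.+ suc c) (suc x) (suc y))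
          (kd (suc a ℕ.* suc x ℕ.+ (suc a ℕ.+ suc c) ℕ.* suc y) n)) (cong
          (ℚ._* kd (suc a ℕ.* suc x ℕ.+ (suc a ℕ.+ suc c) ℕ.* suc y) n) (sym (step (suc a) (suc c) (suc x) (suc y)))))))))))))
    diag₁-H : diag₁ n f ℚ.+ diag₁ n g ≡ Lam (λ a x → H₁ a x x ℚ.- H₁ a 1 x) n
    diag₁-H = trans (sym (∑-+ n _ _)) (∑-cong′ n (λ a → trans (trans (sym (∑-+ n _ _))
        (∑-cong′ n (λ x → trans (sym (∑-+ n _ _)) (∑-cong′ n (λ y →
        trans (sym (ℚₚ.*-distribʳ-+ (kd (suc a ℕ.* suc x ℕ.+ suc a ℕ.* suc y) n) (f (suc a) (suc a) (suc x) (suc y))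
            (g (suc a) (suc a) (suc x) (suc y))))
          (cong₂ ℚ._*_ (H₁-Δ (suc a) (suc x) (suc y)) (cong (λ z → kd z n) (sym (ℕₚ.*-distribˡ-+ (suc a) (suc x) (suc y))))))))))
      (∑-antidiagonal n (H₁ (suc a)) (λ d → kd (suc a ℕ.* suc d) n) (λ d n≤d → kd->
          (ℕₚ.<-≤-trans (s≤s n≤d) (ℕₚ.m≤n*m (suc d) (suc a)))))))
    diag₂-H : diag₂ n g ≡ Lam (λ a x → H₂ a a x ℚ.- H₂ 1 a x) n
    diag₂-H = trans (∑-cong′ n (λ x → trans (∑-cong₂ n n (λ a b →
          cong₂ ℚ._*_ (H₂-Δ (suc a) (suc b) (suc x)) (cong (λ z → kd z n) (sym (ℕₚ.*-distribʳ-+ (suc x) (suc a) (suc b))))))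
        (∑-antidiagonal n (λ a d → H₂ a d (suc x)) (λ d → kd (suc d ℕ.* suc x) n)
            (λ d n≤d → kd-> (ℕₚ.<-≤-trans (s≤s n≤d) (ℕₚ.m≤m*n (suc d) (suc x)))))))
      (∑-swap n n _)
    Lam-minus : Lam (λ a x → H₁ a x x ℚ.- H₁ a 1 x) n ℚ.- Lam (λ a x → H₂ a a x ℚ.- H₂ 1 a x) n ≡ Lam boundary n
    Lam-minus = trans (∑-minus _ _) (∑-cong′ n (λ a → trans (∑-minus _ _) (∑-cong′ n (λ x →
      minus-distribʳ (H₁ (suc a) (suc x) (suc x) ℚ.- H₁ (suc a) 1 (suc x)) (H₂ (suc a) (suc a) (suc x) ℚ.- H₂ 1 (suc a) (suc x))
          (kd (suc a ℕ.* suc x) n)))))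

-- Certificates for convolution identities

module Certificates where

  open ℚ-Solver using (Polynomial; op; [+]; [*]; con; var; _:^_; :-_; _:+_; _:*_; _:-_; ⟦_⟧; #_)

  data Tri : Set where
    r₀ r₁ r₂ : Tri

  next : Tri → Tri
  next r₀ = r₁
  next r₁ = r₂
  next r₂ = r₀

  infixl 6 _+₃_ _-₃_
  _+₃_ : Tri → Tri → Tri
  r₀ +₃ s = s
  r₁ +₃ s = next s
  r₂ +₃ s = next (next s)

  _-₃_ : Tri → Tri → Tri
  r -₃ r₀ = r
  r -₃ r₁ = next (next r)
  r -₃ r₂ = next r

  next-+₃ : ∀ r s → next r +₃ s ≡ next (r +₃ s)
  next-+₃ r₀ s = refl
  next-+₃ r₁ s = refl
  next-+₃ r₂ r₀ = refl
  next-+₃ r₂ r₁ = refl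
  next-+₃ r₂ r₂ = refl

  res : ℕ → Tri
  res zero    = r₀
  res (suc n) = next (res n)

  res-+ : ∀ a b → res (a ℕ.+ b) ≡ res a +₃ res b
  res-+ zero    b = refl
  res-+ (suc a) b = trans (cong next (res-+ a b)) (sym (next-+₃ (res a) (res b)))

  sgn : Tri → ℤ
  sgn r₀ = + 0
  sgn r₁ = + 1
  sgn r₂ = ℤ.- + 1

  isZero : Tri → ℤ
  isZero r₀ = + 1
  isZero r₁ = + 0
  isZero r₂ = + 0

  -- Polynomial identities with residue-dependent coefficients are decided by normalisation, one residue class at a time.
  Eqn : ℕ → Set
  Eqn k = Polynomial k × Polynomial k

  Holds : ∀ {k} → Eqn k → Set
  Holds (l , r) = ∀ ρ → ⟦ l ⟧ ρ ≡ ⟦ r ⟧ ρ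

  decide : ∀ {k} (e : Eqn k) → Maybe (Holds e)
  decide (l , r) = Maybe.map
    (λ eq ρ → trans (sym (ℚ-Solver.correct l ρ)) (trans (ℚ-Solver.⟦ eq ⟧N-cong ρ) (ℚ-Solver.correct r ρ)))
    (ℚ-Solver.normalise l ℚ-Solver.≟N ℚ-Solver.normalise r)

  allTri : ∀ {P : Tri → Set} → (∀ r → Maybe (P r)) → Maybe (∀ r → P r)
  allTri {P} d with d r₀ | d r₁ | d r₂
  ... | just x | just y | just z = just λ { r₀ → x ; r₁ → y ; r₂ → z }
  ... | _      | _      | _      = nothing

  all₂ : ∀ {k} (e : Tri → Tri → Eqn k) → Maybe (∀ q r → Holds (e q r))
  all₂ e = allTri (λ q → allTri (λ r → decide (e q r)))

  all₃ : ∀ {k} (e : Tri → Tri → Tri → Eqn k) → Maybe (∀ q r s → Holds (e q r s))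
  all₃ e = allTri (λ q → all₂ (e q))

  all₄ : ∀ {k} (e : Tri → Tri → Tri → Tri → Eqn k) → Maybe (∀ q r s v → Holds (e q r s v))
  all₄ e = allTri (λ q → all₃ (e q))

  -- Substitution inside the syntax keeps shifted arguments such as a + c or x - 1 within reach of
  -- the normaliser.
  sub : ∀ {j k} → Polynomial j → Vec (Polynomial k) j → Polynomial k
  sub (op ⊙ l r) σ = op ⊙ (sub l σ) (sub r σ)
  sub (con c)    σ = con c
  sub (var i)    σ = Vec.lookup σ i
  sub (l :^ n)   σ = sub l σ :^ n
  sub (:- l)     σ = :- sub l σ

  sub-eval : ∀ {j k} (l : Polynomial j) (σ : Vec (Polynomial k) j) ρ → ⟦ sub l σ ⟧ ρ ≡ ⟦ l ⟧ (Vec.map (λ r → ⟦ r ⟧ ρ) σ)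
  sub-eval (op [+] l r) σ ρ = cong₂ ℚ._+_ (sub-eval l σ ρ) (sub-eval r σ ρ)
  sub-eval (op [*] l r) σ ρ = cong₂ ℚ._*_ (sub-eval l σ ρ) (sub-eval r σ ρ)
  sub-eval (con c)      σ ρ = refl
  sub-eval (var i)      σ ρ = sym (lookup-map i (λ r → ⟦ r ⟧ ρ) σ)
  sub-eval (l :^ n)     σ ρ = cong (λ z → z ^ℚ n) (sub-eval l σ ρ)
    where open import Algebra.Properties.Semiring.Exp (CommutativeRing.semiring ℚₚ.+-*-commutativeRing) renaming (_^_ to _^ℚ_)
  sub-eval (:- l)       σ ρ = cong ℚ.-_ (sub-eval l σ ρ)

  x₀ x₁ : Polynomial 2
  x₀ = var zero
  x₁ = var (suc zero)

  one : ∀ {k} → Polynomial k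
  one = # 1

  ⟨_∣_⟩ : ∀ {k} → Polynomial k → Polynomial k → Vec (Polynomial k) 2
  ⟨ l ∣ r ⟩ = l ∷ r ∷ []

  -- Coefficients may depend on the residues mod 3 of all arguments. The polynomial variables are a
  -- in `Form₁`, a and x in `Form₂`, a and b in `Form₄`; in `Form₄` the arguments x and y enter
  -- through their residues alone.
  Form₁ : Set
  Form₁ = Tri → Tri → Polynomial 1

  Form₂ : Set
  Form₂ = Tri → Tri → Polynomial 2

  Form₄ : Set
  Form₄ = Tri → Tri → Tri → Tri → Polynomial 2

  ev₁ : Form₁ → ℕ → ℕ → ℚ
  ev₁ h a x = ⟦ h (res a) (res x) ⟧ (ι a ∷ [])

  ev₂ : Form₂ → ℕ → ℕ → ℚ
  ev₂ h a x = ⟦ h (res a) (res x) ⟧ (ι a ∷ ι x ∷ [])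

  ev₄ : Form₄ → ℕ → ℕ → ℕ → ℕ → ℚ
  ev₄ f a b x y = ⟦ f (res a) (res b) (res x) (res y) ⟧ (ι a ∷ ι b ∷ [])

  infixr 7 _⊗_
  _⊗_ : Form₁ → Form₁ → Form₄
  (h ⊗ k) ra rb rx ry = sub (h ra rx) (x₀ ∷ []) :* sub (k rb ry) (x₁ ∷ [])

  ⊗-eval : ∀ h k a b x y → ev₄ (h ⊗ k) a b x y ≡ ev₁ h a x ℚ.* ev₁ k b y
  ⊗-eval h k a b x y = cong₂ ℚ._*_ (sub-eval (h (res a) (res x)) _ _) (sub-eval (k (res b) (res y)) _ _)

  symm : Form₄ → Form₄
  symm h ra rb rx ry = h ra rb rx ry :+ sub (h rb ra ry rx) ⟨ x₁ ∣ x₀ ⟩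

  symm-sym : ∀ h a b x y → ev₄ (symm h) a b x y ≡ ev₄ (symm h) b a y x
  symm-sym h a b x y = trans (cong (ev₄ h a b x y ℚ.+_) (swap a b x y))
    (trans (ℚₚ.+-comm (ev₄ h a b x y) (ev₄ h b a y x)) (cong (ev₄ h b a y x ℚ.+_) (sym (swap b a y x))))
    where
    swap : ∀ a b x y → ⟦ sub (h (res b) (res a) (res y) (res x)) ⟨ x₁ ∣ x₀ ⟩ ⟧ (ι a ∷ ι b ∷ []) ≡ ev₄ h b a y x
    swap a b x y = sub-eval (h (res b) (res a) (res y) (res x)) ⟨ x₁ ∣ x₀ ⟩ (ι a ∷ ι b ∷ [])

  data Kind : Set where
    plain derived : Kind

  -- Σ c (2 Lam h · Lam k), and Σ c Lam h or Σ c δ(Lam h)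
  Quadratic Linear : Set
  Quadratic = List (ℤ × Form₁ × Form₁)
  Linear    = List (Kind × ℤ × Form₁)

  -- Each product is symmetrised because `Convolution` asks for a symmetric f; this is the source of
  -- the doubled products in `quad`.
  quadForm : Quadratic → Form₄
  quadForm []                 ra rb rx ry = # 0
  quadForm ((c , h , k) ∷ qs) ra rb rx ry = con c :* ((h ⊗ k) ra rb rx ry :+ (k ⊗ h) ra rb rx ry) :+ quadForm qs ra rb rx ry

  quadForm-sym : ∀ qs a b x y → ev₄ (quadForm qs) a b x y ≡ ev₄ (quadForm qs) b a y x
  quadForm-sym []                 a b x y = refl
  quadForm-sym ((c , h , k) ∷ qs) a b x y = cong₂ (λ w z → fromℤ c ℚ.* w ℚ.+ z)
    (trans (ℚₚ.+-comm (ev₄ (h ⊗ k) a b x y) (ev₄ (k ⊗ h) a b x y)) (cong₂ ℚ._+_ (flip k h) (flip h k)))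
    (quadForm-sym qs a b x y)
    where
    flip : ∀ h k → ev₄ (h ⊗ k) a b x y ≡ ev₄ (k ⊗ h) b a y x
    flip h k = trans (⊗-eval h k a b x y) (trans (ℚₚ.*-comm (ev₁ h a x) (ev₁ k b y)) (sym (⊗-eval k h b a y x)))

  -- On the support of q^(ax) the operator δ multiplies by ax, whence the factor `x₀ :* x₁` in the
  -- derived case.
  linTerm : Kind → ℤ → Form₁ → Form₂
  linTerm plain   c h ra rx = con c :* sub (h ra rx) (x₀ ∷ [])
  linTerm derived c h ra rx = con c :* (x₀ :* x₁ :* sub (h ra rx) (x₀ ∷ []))

  linForm : Linear → Form₂
  linForm []                 ra rx = # 0
  linForm ((κ , c , h) ∷ ls) ra rx = linTerm κ c h ra rx :+ linForm ls ra rx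

  ⟪_⟫₁ : Form₁ → PS
  ⟪ h ⟫₁ = Lam (ev₁ h)

  quad : Quadratic → PS
  quad []                 = 0#
  quad ((c , h , k) ∷ qs) = K c * (⟪ h ⟫₁ * ⟪ k ⟫₁ + ⟪ h ⟫₁ * ⟪ k ⟫₁) + quad qs

  linear : Linear → PS
  linear []                       = 0#
  linear ((plain   , c , h) ∷ ls) = K c * ⟪ h ⟫₁ + linear ls
  linear ((derived , c , h) ∷ ls) = K c * δ ⟪ h ⟫₁ + linear ls

  Ω-cong : ∀ {f g} n → (∀ a b x y → f a b x y ≡ g a b x y) → Ω f n ≡ Ω g n
  Ω-cong n h = ∑-cong₂ n n (λ a b → ∑-cong₂ n n (λ x y → cong (ℚ._* kd (suc a ℕ.* suc x ℕ.+ suc b ℕ.* suc y) n)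
      (h (suc a) (suc b) (suc x) (suc y))))

  Ω-+ : ∀ f g n → Ω (λ a b x y → f a b x y ℚ.+ g a b x y) n ≡ Ω f n ℚ.+ Ω g n
  Ω-+ f g n = trans (∑-cong′ n (λ a → trans (∑-cong′ n (λ b → trans (∑-cong′ n (λ x → trans (∑-cong′ n (λ y →
    ℚₚ.*-distribʳ-+ (kd (suc a ℕ.* suc x ℕ.+ suc b ℕ.* suc y) n) (f (suc a) (suc b) (suc x) (suc y))
        (g (suc a) (suc b) (suc x) (suc y))))
    (∑-+ n _ _))) (∑-+ n _ _))) (∑-+ n _ _))) (∑-+ n _ _)

  Ω-scale : ∀ c f n → Ω (λ a b x y → c ℚ.* f a b x y) n ≡ c ℚ.* Ω f n
  Ω-scale c f n = trans (∑-cong′ n (λ a → trans (∑-cong′ n (λ b → trans (∑-cong′ n (λ x → trans (∑-cong′ n (λ y →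
    ℚₚ.*-assoc c (f (suc a) (suc b) (suc x) (suc y)) (kd (suc a ℕ.* suc x ℕ.+ suc b ℕ.* suc y) n))) (∑-*ˡ n c _)))
        (∑-*ˡ n c _))) (∑-*ˡ n c _))) (∑-*ˡ n c _)

  quad-Ω : ∀ qs n → quad qs n ≡ Ω (ev₄ (quadForm qs)) n
  quad-Ω [] n = trans (0#-at n) (sym (∑-zero n (λ a _ → ∑-zero n (λ b _ → ∑-zero n
      (λ x _ → ∑-zero n (λ y _ → ℚₚ.*-zeroˡ (kd (suc a ℕ.* suc x ℕ.+ suc b ℕ.* suc y) n)))))))
  quad-Ω ((c , h , k) ∷ qs) n = begin
    (K c * (hk + hk) + quad qs) n                         ≡⟨ +-at (K c * (hk + hk)) (quad qs) n ⟩
    (K c * (hk + hk)) n ℚ.+ quad qs n                     ≡⟨ cong₂ ℚ._+_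
        (trans (K-*-at c (hk + hk) n) (cong (fromℤ c ℚ.*_) (+-at hk hk n))) (quad-Ω qs n) ⟩
    fromℤ c ℚ.* (hk n ℚ.+ hk n) ℚ.+ Ω (ev₄ (quadForm qs)) n
      ≡⟨ cong₂ (λ y z → fromℤ c ℚ.* (y ℚ.+ z) ℚ.+ Ω (ev₄ (quadForm qs)) n) (prod h k)
          (trans (at (*-comm ⟪ h ⟫₁ ⟪ k ⟫₁) n) (prod k h)) ⟩
    fromℤ c ℚ.* (Ω (ev₄ (h ⊗ k)) n ℚ.+ Ω (ev₄ (k ⊗ h)) n) ℚ.+ Ω (ev₄ (quadForm qs)) n
      ≡⟨ cong (λ z → fromℤ c ℚ.* z ℚ.+ Ω (ev₄ (quadForm qs)) n) (Ω-+ (ev₄ (h ⊗ k)) (ev₄ (k ⊗ h)) n) ⟨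
    fromℤ c ℚ.* Ω (λ a b x y → ev₄ (h ⊗ k) a b x y ℚ.+ ev₄ (k ⊗ h) a b x y) n ℚ.+ Ω (ev₄ (quadForm qs)) n
      ≡⟨ cong (ℚ._+ Ω (ev₄ (quadForm qs)) n) (Ω-scale (fromℤ c) (λ a b x y → ev₄ (h ⊗ k) a b x y ℚ.+ ev₄ (k ⊗ h) a b x y) n) ⟨
    Ω (λ a b x y → fromℤ c ℚ.* (ev₄ (h ⊗ k) a b x y ℚ.+ ev₄ (k ⊗ h) a b x y)) n ℚ.+ Ω (ev₄ (quadForm qs)) n
      ≡⟨ Ω-+ (λ a b x y → fromℤ c ℚ.* (ev₄ (h ⊗ k) a b x y ℚ.+ ev₄ (k ⊗ h) a b x y)) (ev₄ (quadForm qs)) n ⟨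
    Ω (ev₄ (quadForm ((c , h , k) ∷ qs))) n ∎
    where
    open ≡-Reasoning
    hk : PS
    hk = ⟪ h ⟫₁ * ⟪ k ⟫₁
    prod : ∀ h k → (⟪ h ⟫₁ * ⟪ k ⟫₁) n ≡ Ω (ev₄ (h ⊗ k)) n
    prod h k = trans (Lam-* (ev₁ h) (ev₁ k) n) (Ω-cong n (λ a b x y → sym (⊗-eval h k a b x y)))

  Lam-cong : ∀ {f g} n → (∀ a x → f a x ≡ g a x) → Lam f n ≡ Lam g n
  Lam-cong n h = ∑-cong₂ n n (λ a x → cong (ℚ._* kd (suc a ℕ.* suc x) n) (h (suc a) (suc x)))

  Lam-+ : ∀ f g n → Lam (λ a x → f a x ℚ.+ g a x) n ≡ Lam f n ℚ.+ Lam g n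
  Lam-+ f g n = trans (∑-cong′ n (λ a → trans (∑-cong′ n (λ x →
    ℚₚ.*-distribʳ-+ (kd (suc a ℕ.* suc x) n) (f (suc a) (suc x)) (g (suc a) (suc x)))) (∑-+ n _ _))) (∑-+ n _ _)

  Lam-scale : ∀ c f n → Lam (λ a x → c ℚ.* f a x) n ≡ c ℚ.* Lam f n
  Lam-scale c f n = trans (∑-cong′ n (λ a → trans (∑-cong′ n (λ x →
    ℚₚ.*-assoc c (f (suc a) (suc x)) (kd (suc a ℕ.* suc x) n))) (∑-*ˡ n c _))) (∑-*ˡ n c _)

  Lam-δ : ∀ f n → Lam (λ a x → ι a ℚ.* ι x ℚ.* f a x) n ≡ δ (Lam f) n
  Lam-δ f n = trans (trans (∑-cong′ n (λ a → trans (∑-cong′ n (λ x → pt (suc a) (suc x))) (∑-*ˡ n (ι n) _))) (∑-*ˡ n (ι n) _))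
      (sym (δ-at (Lam f) n))
    where
    open ℚ-Solver using (solve; _:=_)
    pt : ∀ a x → ι a ℚ.* ι x ℚ.* f a x ℚ.* kd (a ℕ.* x) n ≡ ι n ℚ.* (f a x ℚ.* kd (a ℕ.* x) n)
    pt a x = begin
      ι a ℚ.* ι x ℚ.* f a x ℚ.* kd (a ℕ.* x) n      ≡⟨ cong (λ z → z ℚ.* f a x ℚ.* kd (a ℕ.* x) n) (ι-* a x) ⟨
      ι (a ℕ.* x) ℚ.* f a x ℚ.* kd (a ℕ.* x) n      ≡⟨ solve 3 (λ i f k → i :* f :* k := f :* (i :* k)) refl (ι (a ℕ.* x))
          (f a x) (kd (a ℕ.* x) n) ⟩
      f a x ℚ.* (ι (a ℕ.* x) ℚ.* kd (a ℕ.* x) n)    ≡⟨ cong (f a x ℚ.*_) (kd-subst ι (a ℕ.* x) n) ⟩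
      f a x ℚ.* (ι n ℚ.* kd (a ℕ.* x) n)            ≡⟨ solve 3 (λ i f k → f :* (i :* k) := i :* (f :* k)) refl (ι n) (f a x)
          (kd (a ℕ.* x) n) ⟩
      ι n ℚ.* (f a x ℚ.* kd (a ℕ.* x) n)            ∎
      where open ≡-Reasoning

  linear-Lam : ∀ ls n → linear ls n ≡ Lam (ev₂ (linForm ls)) n
  linear-Lam [] n = trans (0#-at n) (sym (∑-zero n (λ a _ → ∑-zero n (λ x _ → ℚₚ.*-zeroˡ (kd (suc a ℕ.* suc x) n)))))
  linear-Lam ((plain , c , h) ∷ ls) n = trans (+-at (K c * ⟪ h ⟫₁) (linear ls) n)
    (trans (cong₂ ℚ._+_ (trans (K-*-at c ⟪ h ⟫₁ n) (trans (sym (Lam-scale (fromℤ c) (ev₁ h) n))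
        (Lam-cong n (λ a x → cong (fromℤ c ℚ.*_) (sym (sub-eval (h (res a) (res x)) (x₀ ∷ []) (ι a ∷ ι x ∷ [])))))))
            (linear-Lam ls n))
      (sym (Lam-+ (ev₂ (linTerm plain c h)) (ev₂ (linForm ls)) n)))
  linear-Lam ((derived , c , h) ∷ ls) n = trans (+-at (K c * δ ⟪ h ⟫₁) (linear ls) n)
    (trans (cong₂ ℚ._+_ (trans (K-*-at c (δ ⟪ h ⟫₁) n) (trans (cong (fromℤ c ℚ.*_) (sym (Lam-δ (ev₁ h) n)))
        (trans (sym (Lam-scale (fromℤ c) (λ a x → ι a ℚ.* ι x ℚ.* ev₁ h a x) n))
        (Lam-cong n (λ a x → cong (λ z → fromℤ c ℚ.* (ι a ℚ.* ι x ℚ.* z))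
            (sym (sub-eval (h (res a) (res x)) (x₀ ∷ []) (ι a ∷ ι x ∷ [])))))))) (linear-Lam ls n))
      (sym (Lam-+ (ev₂ (linTerm derived c h)) (ev₂ (linForm ls)) n)))

  -- H₁⁰ and H₂⁰ are the antiderivatives required by `Convolution` on the class 0 mod 3 of the
  -- summation variable; the other two classes follow by adding one summand at a time.
  record Certificate : Set where
    field
      quadratic : Quadratic
      lin       : Linear
      ĥ         : Form₄
      H₁⁰       : Tri → Tri → Polynomial 2
      H₂⁰       : Tri → Tri → Polynomial 2

    -- Only half of g is supplied; symmetrising it yields `g-sym` without any check.
    f̂ ĝ : Form₄
    f̂ = quadForm quadratic
    ĝ = symm ĥ

    Ĥ₁ Ĥ₂ : Tri → Tri → Tri → Polynomial 2
    Ĥ₁ ra r₀ rd = H₁⁰ ra rd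
    -- The added summand sits at x - 1, and its y is d - (x - 1). After three such steps the class 0
    -- recurs, and it is there that `Δ₁` really tests `H₁⁰`.
    Ĥ₁ ra r₁ rd = sub (H₁⁰ ra rd) ⟨ x₀ ∣ x₁ :- one ⟩ :+ sub (f̂ ra ra r₀ rd :+ ĝ ra ra r₀ rd) ⟨ x₀ ∣ x₀ ⟩
    Ĥ₁ ra r₂ rd = sub (Ĥ₁ ra r₁ rd) ⟨ x₀ ∣ x₁ :- one ⟩ :+ sub (f̂ ra ra r₁ (rd -₃ r₁) :+ ĝ ra ra r₁ (rd -₃ r₁)) ⟨ x₀ ∣ x₀ ⟩
    Ĥ₂ r₀ rd rx = H₂⁰ rd rx
    Ĥ₂ r₁ rd rx = sub (H₂⁰ rd rx :+ sub (ĝ r₀ rd rx rx) ⟨ x₀ ∣ x₁ :- x₀ ⟩) ⟨ x₀ :- one ∣ x₁ ⟩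
    Ĥ₂ r₂ rd rx = sub (Ĥ₂ r₁ rd rx :+ sub (ĝ r₁ (rd -₃ r₁) rx rx) ⟨ x₀ ∣ x₁ :- x₀ ⟩) ⟨ x₀ :- one ∣ x₁ ⟩

    shear : Tri → Tri → Tri → Tri → Eqn 2
    shear ra rc rx ry = sub (f̂ ra (ra +₃ rc) rx ry) ⟨ x₀ ∣ x₀ :+ x₁ ⟩ , ĝ ra rc (ry +₃ rx) ry :- sub
        (ĝ ra (ra +₃ rc) rx ry) ⟨ x₀ ∣ x₀ :+ x₁ ⟩

    Δ₁ Δ₂ : Tri → Tri → Tri → Eqn 2
    Δ₁ ra rx ry = sub (f̂ ra ra rx ry :+ ĝ ra ra rx ry) ⟨ x₀ ∣ x₀ ⟩ , sub
        (Ĥ₁ ra (next rx) (rx +₃ ry)) ⟨ x₀ ∣ one :+ x₁ ⟩ :- Ĥ₁ ra rx (rx +₃ ry)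
    Δ₂ ra rb rx = ĝ ra rb rx rx , sub (Ĥ₂ (next ra) (ra +₃ rb) rx) ⟨ one :+ x₀ ∣ x₀ :+ x₁ ⟩ :- sub
        (Ĥ₂ ra (ra +₃ rb) rx) ⟨ x₀ ∣ x₀ :+ x₁ ⟩

    total : Tri → Tri → Eqn 2
    total ra rx = (Ĥ₁ ra rx rx :- sub (Ĥ₁ ra r₁ rx) ⟨ x₀ ∣ one ⟩) :- (sub (Ĥ₂ ra ra rx) ⟨ x₀ ∣ x₀ ⟩ :- sub
        (Ĥ₂ r₁ ra rx) ⟨ one ∣ x₀ ⟩) , linForm lin ra rx

    Valid : Set
    Valid = (∀ q r s v → Holds (shear q r s v)) ×
            (∀ q r s → Holds (Δ₁ q r s)) × (∀ q r s → Holds (Δ₂ q r s)) × (∀ q r → Holds (total q r))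

    valid? : Maybe Valid
    valid? = Maybe.zip (all₄ shear) (Maybe.zip (all₃ Δ₁) (Maybe.zip (all₃ Δ₂) (all₂ total)))

  module _ (C : Certificate) where
    open Certificate C

    private
      fᵛ gᵛ : ℕ → ℕ → ℕ → ℕ → ℚ
      fᵛ = ev₄ f̂
      gᵛ = ev₄ ĝ
      Hᵛ₁ Hᵛ₂ : ℕ → ℕ → ℕ → ℚ
      Hᵛ₁ a x d = ⟦ Ĥ₁ (res a) (res x) (res d) ⟧ (ι a ∷ ι x ∷ [])
      Hᵛ₂ a d x = ⟦ Ĥ₂ (res a) (res d) (res x) ⟧ (ι a ∷ ι d ∷ [])

      at₂ : ∀ (l : Polynomial 2) {a a′ b b′} → a ≡ a′ → b ≡ b′ → ⟦ l ⟧ (a ∷ b ∷ []) ≡ ⟦ l ⟧ (a′ ∷ b′ ∷ [])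
      at₂ l refl refl = refl

      ev-+ : ∀ (h : Form₄) a c x y → ev₄ h a (a ℕ.+ c) x y ≡ ⟦ sub (h (res a) (res a +₃ res c) (res x)
          (res y)) ⟨ x₀ ∣ x₀ :+ x₁ ⟩ ⟧ (ι a ∷ ι c ∷ [])
      ev-+ h a c x y = trans (cong₂ (λ r b → ⟦ h (res a) r (res x) (res y) ⟧ (ι a ∷ b ∷ [])) (res-+ a c) (ι-+ a c))
          (sym (sub-eval (h (res a) (res a +₃ res c) (res x) (res y)) _ _))

    sound : Valid → quad quadratic ≈ linear lin
    sound (shr , δ₁ , δ₂ , tot) = ⟪ (λ n → trans (quad-Ω quadratic n) (trans (convolution conv n)
        (trans (Lam-cong n total-eq) (sym (linear-Lam lin n))))) ⟫
      where
      conv : Convolution fᵛ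
      conv = record
        { g     = gᵛ
        ; f-sym = quadForm-sym quadratic
        ; g-sym = symm-sym ĥ
        ; step  = λ a c x y → trans (ev-+ f̂ a c x y) (trans (shr (res a) (res c) (res x) (res y) (ι a ∷ ι c ∷ []))
            (cong₂ (λ r z → ⟦ ĝ (res a) (res c) r (res y) ⟧ (ι a ∷ ι c ∷ []) ℚ.- z) (sym (res-+ y x)) (sym (ev-+ ĝ a c x y))))
        ; H₁    = Hᵛ₁
        ; H₁-Δ  = λ a x y → trans (sym (sub-eval (f̂ (res a) (res a) (res x) (res y) :+ ĝ (res a) (res a) (res x)
            (res y)) ⟨ x₀ ∣ x₀ ⟩ (ι a ∷ ι x ∷ [])))
            (trans (δ₁ (res a) (res x) (res y) (ι a ∷ ι x ∷ []))
            (cong₂ (λ s v → s ℚ.- v)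
              (trans (sub-eval (Ĥ₁ (res a) (res (suc x)) (res x +₃ res y)) _ _)
                (trans (at₂ (Ĥ₁ (res a) (res (suc x)) (res x +₃ res y)) refl (sym (ι-suc x)))
                    (cong (λ r → ⟦ Ĥ₁ (res a) (res (suc x)) r ⟧ (ι a ∷ ι (suc x) ∷ [])) (sym (res-+ x y)))))
              (cong (λ r → ⟦ Ĥ₁ (res a) (res x) r ⟧ (ι a ∷ ι x ∷ [])) (sym (res-+ x y)))))
        ; H₂    = Hᵛ₂
        ; H₂-Δ  = λ a b x → trans (δ₂ (res a) (res b) (res x) (ι a ∷ ι b ∷ []))
            (cong₂ (λ s v → s ℚ.- v) (H₂-at (suc a) a b x (one :+ x₀) (sym (ι-suc a))) (H₂-at a a b x x₀ refl))
        }
        where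
        H₂-at : ∀ a′ a b x (l : Polynomial 2) → ⟦ l ⟧ (ι a ∷ ι b ∷ []) ≡ ι a′ →
          ⟦ sub (Ĥ₂ (res a′) (res a +₃ res b) (res x)) ⟨ l ∣ x₀ :+ x₁ ⟩ ⟧ (ι a ∷ ι b ∷ []) ≡ Hᵛ₂ a′ (a ℕ.+ b) x
        H₂-at a′ a b x l eq = trans (sub-eval (Ĥ₂ (res a′) (res a +₃ res b) (res x)) _ _)
          (trans (at₂ (Ĥ₂ (res a′) (res a +₃ res b) (res x)) eq (sym (ι-+ a b)))
              (cong (λ r → ⟦ Ĥ₂ (res a′) r (res x) ⟧ (ι a′ ∷ ι (a ℕ.+ b) ∷ [])) (sym (res-+ a b))))
      total-eq : ∀ a x → Convolution.boundary conv a x ≡ ev₂ (linForm lin) a x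
      total-eq a x = trans (sym (cong₂ ℚ._-_
          (cong (λ z → ⟦ Ĥ₁ (res a) (res x) (res x) ⟧ (ι a ∷ ι x ∷ []) ℚ.- z)
              (sub-eval (Ĥ₁ (res a) r₁ (res x)) ⟨ x₀ ∣ one ⟩ (ι a ∷ ι x ∷ [])))
          (cong₂ ℚ._-_ (sub-eval (Ĥ₂ (res a) (res a) (res x)) ⟨ x₀ ∣ x₀ ⟩ (ι a ∷ ι x ∷ []))
              (sub-eval (Ĥ₂ r₁ (res a) (res x)) ⟨ one ∣ x₀ ⟩ (ι a ∷ ι x ∷ [])))))
        (tot (res a) (res x) (ι a ∷ ι x ∷ []))

    -- Proof by reflection: evaluating `valid?` normalises 81 instances of `shear`, 27 each of `Δ₁`
    -- and `Δ₂`, and 9 of `total`.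
    certified : T (is-just valid?) → quad quadratic ≈ linear lin
    certified ok = sound (to-witness-T valid? ok)

  -- The character χ₃, its square (the indicator of the residues prime to 3), and the indicator of
  -- the multiples of 3.
  χ̂ δ̂ ẑ : ∀ {k} → Tri → Polynomial k
  χ̂ r = con (sgn r)
  δ̂ r = con (sgn r ℤ.* sgn r)
  ẑ r = con (isZero r)

  v : Polynomial 1
  v = var zero

  -- The leading a or x tells which variable carries the character or the divisibility condition;
  -- the power is always a power of a. `bχ` encodes 3X(q³) - X(q), where X is the series of `aχ`.
  aχ xχ a¹ aζ xζ a²χ x²χ a⁴χ x⁴χ bχ : Form₁
  aχ  ra rx = χ̂ ra
  xχ  ra rx = χ̂ rx
  a¹  ra rx = v
  aζ  ra rx = v :* ẑ ra
  xζ  ra rx = # 3 :* v :* ẑ rx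
  a²χ ra rx = v :* v :* χ̂ ra
  x²χ ra rx = v :* v :* χ̂ rx
  a⁴χ ra rx = v :* v :* v :* v :* χ̂ ra
  x⁴χ ra rx = v :* v :* v :* v :* χ̂ rx
  bχ  ra rx = χ̂ ra :* (# 3 :* ẑ rx :- # 1)

  -- Each ĥ is a solution of the linear system `shear`, the unknowns being the coefficients of a homogeneous
  -- polynomial in a and b that are functions of residues mod 3; H₁⁰ and H₂⁰ are its discrete antiderivatives.
  cert-AA cert-AP cert-AP′ cert-BP cert-AL cert-LP cert-LZ cert-MZ : Certificate
  cert-AA = record
    { quadratic = (+ 18 , aχ , aχ) ∷ []
    ; lin = (plain , + 12 , a¹) ∷ (plain , ℤ.- + 12 , aζ) ∷ (plain , ℤ.- + 12 , aχ) ∷ []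
    ; ĥ   = λ ra rb rx ry → :- # 9 :* (χ̂ ra :* χ̂ rb :+ δ̂ ra :* δ̂ rb)
    ; H₁⁰ = λ ra rd → # 0
    ; H₂⁰ = λ rd rx → :- # 12 :* x₀ :* δ̂ rd }
  cert-AP = record
    { quadratic = (+ 36 , aχ , a¹) ∷ (ℤ.- + 108 , aχ , aζ) ∷ []
    ; lin = (derived , + 72 , aχ) ∷ (plain , ℤ.- + 24 , aχ) ∷ (plain , ℤ.- + 12 , a¹) ∷ (plain , + 36 , aζ) ∷
        (plain , ℤ.- + 36 , a²χ) ∷ []
    ; ĥ   = λ ra rb rx ry → # 18 :* x₁ :* (χ̂ rb :- χ̂ ra :+ # 3 :* χ̂ ra :* ẑ rb :+ # 3 :* ẑ ra :* χ̂ rb)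
    ; H₁⁰ = λ ra rd → # 72 :* x₀ :* x₁ :* χ̂ ra
    ; H₂⁰ = λ rd rx → x₀ :* (# 18 :* (χ̂ rd :+ δ̂ rd) :+ # 36 :* x₁ :* χ̂ rd :- # 24) }
  cert-AP′ = record
    { quadratic = (+ 36 , xχ , a¹) ∷ (ℤ.- + 12 , xχ , xζ) ∷ []
    ; lin = (derived , ℤ.- + 24 , xχ) ∷ (plain , + 4 , xζ) ∷ (plain , ℤ.- + 12 , a¹) ∷ (plain , + 36 , x²χ) ∷ []
    ; ĥ   = λ ra rb rx ry → # 18 :* x₁ :* (δ̂ rx :* χ̂ ry :- χ̂ rx :* δ̂ ry :- # 2 :* χ̂ ry)
    ; H₁⁰ = λ ra rd → :- # 24 :* x₀ :* x₁ :* χ̂ rd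
    ; H₂⁰ = λ rd rx → :- # 36 :* x₀ :* x₁ :* χ̂ rx }
  cert-BP = record
    { quadratic = (+ 6 , bχ , xζ) ∷ (ℤ.- + 18 , bχ , a¹) ∷ []
    ; lin = (derived , + 12 , bχ) ∷ (plain , ℤ.- + 4 , xζ) ∷ (plain , + 12 , a¹) ∷ []
    ; ĥ   = λ ra rb rx ry → # 3 :* x₁ :*
        ( χ̂ rb :* (# 12 :* δ̂ rx :- # 4 :* δ̂ ry :- # 12 :* δ̂ rx :* δ̂ ry)
       :+ δ̂ ra :* χ̂ rb :* (# 6 :* δ̂ ry :- # 12 :* δ̂ rx :+ # 9 :* δ̂ rx :* δ̂ ry)
       :+ χ̂ ra :* (# 6 :* δ̂ ry :- # 9 :* δ̂ rx :* δ̂ ry :- χ̂ rx :* χ̂ ry :- # 3 :* δ̂ rb :* χ̂ rx :* χ̂ ry))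
    ; H₁⁰ = λ ra rd → # 12 :* x₀ :* x₁ :* χ̂ ra :* (# 2 :- # 3 :* δ̂ rd)
    ; H₂⁰ = λ rd rx → :- # 12 :* x₀ :* ẑ rd :* δ̂ rx }
  cert-AL = record
    { quadratic = (+ 2592 , aζ , aζ) ∷ (ℤ.- + 288 , a¹ , a¹) ∷ (+ 2160 , aχ , a²χ) ∷ []
    ; lin = (plain , + 1296 , aζ) ∷ (derived , ℤ.- + 2592 , aζ) ∷ (plain , ℤ.- + 48 , a¹) ∷ (derived , + 288 , a¹) ∷
        (plain , + 480 , aχ) ∷ (plain , ℤ.- + 720 , a²χ) ∷ []
    ; ĥ   = λ ra rb rx ry →
        # 72 :* x₁ :* x₁ :* (# 15 :* ẑ rb :+ # 5 :* ẑ ra :- # 15 :* χ̂ ra :* χ̂ rb :- # 51 :* ẑ ra :* ẑ rb :- # 1)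
     :+ # 144 :* x₀ :* x₁ :* (# 1 :- # 5 :* χ̂ ra :* χ̂ rb :- # 9 :* ẑ ra :* ẑ rb)
    ; H₁⁰ = λ ra rd → # 288 :* x₀ :* x₀ :* x₁ :* (# 9 :* δ̂ ra :- # 8)
    ; H₂⁰ = λ rd rx →
        x₀ :* (# 1776 :* δ̂ rd :- # 1248 :- # 1152 :* x₁ :+ # 480 :* x₁ :* χ̂ rd :+ # 1296 :* x₁ :* δ̂ rd)
     :+ x₀ :* x₀ :* (# 1152 :- # 360 :* χ̂ rd :- # 1656 :* δ̂ rd)
     :+ (# 3 :* δ̂ rd :- # 2) :* x₀ :* (# 48 :* x₁ :* x₁ :- # 144 :* x₀ :* x₁ :+ # 96 :* x₀ :* x₀) }
  cert-LP = record
    { quadratic = (+ 54 , a²χ , a¹) ∷ (ℤ.- + 18 , a²χ , aζ) ∷ []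
    ; lin = (plain , + 12 , a¹) ∷ (plain , ℤ.- + 4 , aζ) ∷ (derived , ℤ.- + 12 , a²χ) ∷ []
    ; ĥ   = λ ra rb rx ry → # 3 :* x₁ :* x₁ :*
        ( x₀ :* (# 9 :* χ̂ ra :* ẑ rb :+ # 3 :* ẑ ra :* χ̂ rb :- # 9 :* χ̂ rb :- # 11 :* χ̂ ra)
       :- # 4 :* x₁ :* ẑ ra :* χ̂ rb)
    ; H₁⁰ = λ ra rd → :- # 12 :* x₀ :* x₀ :* x₀ :* x₁ :* χ̂ ra
    ; H₂⁰ = λ rd rx →
        # 4 :* ẑ rd :* x₀ :* (x₀ :* x₀ :- # 2) :+ # 8 :* χ̂ rd :* x₀ :* x₁
     :+ (# 2 :+ # 3 :* δ̂ rd) :* x₀ :* x₁ :* (x₁ :- x₀) :+ # 6 :* δ̂ rd :* x₀ :* x₁ :* x₁ :- # 4 :* x₀ :* x₀ :* x₁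
     :+ χ̂ rd :* x₀ :* x₁ :* (# 3 :* x₀ :- # 9 :* x₁ :- # 4 :* x₁ :* x₁ :+ # 12 :* x₀ :* x₁ :- # 8 :* x₀ :* x₀) }
  cert-LZ = record
    { quadratic = (+ 54 , a²χ , a¹) ∷ (ℤ.- + 54 , a²χ , aζ) ∷ []
    ; lin = (plain , + 12 , a¹) ∷ (plain , ℤ.- + 12 , aζ) ∷ (plain , ℤ.- + 9 , a²χ) ∷ (plain , ℤ.- + 3 , a⁴χ) ∷ []
    ; ĥ   = λ ra rb rx ry → :- # 27 :* x₀ :* x₁ :* x₁ :* (χ̂ ra :* δ̂ rb :+ δ̂ ra :* χ̂ rb)
    ; H₁⁰ = λ ra rd → # 0
    ; H₂⁰ = λ rd rx → # 3 :* x₀ :* x₁ :*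
        (# 3 :* χ̂ rd :+ # 3 :* δ̂ rd :* (x₁ :- x₀) :+ χ̂ rd :* (# 3 :* x₀ :* x₁ :- # 2 :* x₀ :* x₀)) }
  cert-MZ = record
    { quadratic = (+ 6 , x²χ , a¹) ∷ (ℤ.- + 6 , x²χ , xζ) ∷ []
    ; lin = (plain , + 1 , x⁴χ) ∷ (plain , ℤ.- + 1 , x²χ) ∷ []
    ; ĥ   = λ ra rb rx ry → # 3 :* x₀ :* x₁ :* x₁ :*
        (# 2 :* χ̂ rx :+ # 2 :* χ̂ ry :- # 3 :* χ̂ rx :* δ̂ ry :- # 3 :* δ̂ rx :* χ̂ ry)
    ; H₁⁰ = λ ra rd → # 0
    ; H₂⁰ = λ rd rx → χ̂ rx :* x₀ :* x₁ :*
        (# 1 :+ # 3 :* x₁ :- # 3 :* x₀ :- # 3 :* x₀ :* x₁ :+ # 2 :* x₀ :* x₀) }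

  Identity : Certificate → Set
  Identity C = quad (Certificate.quadratic C) ≈ linear (Certificate.lin C)

  opaque
    id-AA : Identity cert-AA
    id-AA = certified cert-AA tt

    id-AP : Identity cert-AP
    id-AP = certified cert-AP tt

    id-AP′ : Identity cert-AP′
    id-AP′ = certified cert-AP′ tt

    id-BP : Identity cert-BP
    id-BP = certified cert-BP tt

    id-AL : Identity cert-AL
    id-AL = certified cert-AL tt

    id-LP : Identity cert-LP
    id-LP = certified cert-LP tt

    id-LZ : Identity cert-LZ
    id-LZ = certified cert-LZ tt

    id-MZ : Identity cert-MZ
    id-MZ = certified cert-MZ tt

open Certificates

-- Logarithmic derivatives of the Euler products

zeroMod3 : ℕ → ℚ
zeroMod3 n = fromℤ (isZero (res n))

next³ : ∀ r → next (next (next r)) ≡ r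
next³ r₀ = refl
next³ r₁ = refl
next³ r₂ = refl

∑-multiples : ∀ n (G : ℕ → ℚ) → ∑ (n ℕ.* 3) (λ i → G (suc i) ℚ.* zeroMod3 (suc i)) ≡ ∑ n (λ i → G (suc i ℕ.* 3))
∑-multiples zero    G = refl
∑-multiples (suc n) G = trans
  (cong (λ z → G 1 ℚ.* 0ℚ ℚ.+ (G 2 ℚ.* 0ℚ ℚ.+ (G 3 ℚ.* 1ℚ ℚ.+ z)))
    (trans (∑-cong′ (n ℕ.* 3) (λ i → cong (λ r → G (4 ℕ.+ i) ℚ.* fromℤ (isZero r)) (next³ (res (suc i)))))
        (∑-multiples n (λ k → G (3 ℕ.+ k)))))
  (solve 4 (λ x y z w → x :* # 0 :+ (y :* # 0 :+ (z :* # 1 :+ w)) := z :+ w) refl (G 1) (G 2) (G 3)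
      (∑ n (λ i → G (3 ℕ.+ suc i ℕ.* 3))))
  where open ℚ-Solver

Lam-swap : ∀ f → Lam f ≈ Lam (λ a x → f x a)
Lam-swap f = ⟪ (λ n → trans (∑-swap n n _) (∑-cong₂ n n (λ x a → cong (λ z → f (suc a) (suc x) ℚ.* kd z n)
    (ℕₚ.*-comm (suc a) (suc x))))) ⟫

-- This is 3 Σ σ(n) q^(3n), minus the logarithmic derivative of `E 3`. Sieving a by 3, or x by 3
-- with an extra factor 3, produces the same series.
threefold : PS
threefold n = ∑ n (λ a → ∑ n (λ x → ι (suc a ℕ.* 3) ℚ.* kd (suc a ℕ.* 3 ℕ.* suc x) n))

aζ-threefold : ⟪ aζ ⟫₁ ≈ threefold
aζ-threefold = ⟪ (λ n → trans (sym (∑-extend (λ a → ∑ n (λ x → ev₁ aζ (suc a) (suc x) ℚ.* kd (suc a ℕ.* suc x) n)) (ℕₚ.m≤m*n n 3)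
      (λ a n≤a → ∑-zero n (λ x _ → vanish (ev₁ aζ (suc a) (suc x)) (ℕₚ.<-≤-trans (s≤s n≤a) (ℕₚ.m≤m*n (suc a) (suc x)))))))
    (trans (∑-cong′ (n ℕ.* 3) (λ a → trans (∑-cong′ n (λ x → rearrange (ι (suc a)) (zeroMod3 (suc a)) (kd (suc a ℕ.* suc x) n)))
        (∑-*ʳ n (λ x → ι (suc a) ℚ.* kd (suc a ℕ.* suc x) n) (zeroMod3 (suc a)))))
      (∑-multiples n (λ a → ∑ n (λ x → ι a ℚ.* kd (a ℕ.* suc x) n))))) ⟫
  where
  rearrange : ∀ i z k → i ℚ.* z ℚ.* k ≡ i ℚ.* k ℚ.* z
  rearrange = solve 3 (λ i z k → i :* z :* k := i :* k :* z) refl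
    where open ℚ-Solver

xζ-threefold : ⟪ xζ ⟫₁ ≈ threefold
xζ-threefold = ⟪ (λ n → ∑-cong′ n (λ a → trans
    (sym (∑-extend (λ x → ev₁ xζ (suc a) (suc x) ℚ.* kd (suc a ℕ.* suc x) n) (ℕₚ.m≤m*n n 3)
      (λ x n≤x → vanish (ev₁ xζ (suc a) (suc x)) (ℕₚ.<-≤-trans (s≤s n≤x) (ℕₚ.m≤n*m (suc x) (suc a))))))
    (trans (∑-cong′ (n ℕ.* 3) (λ x → rearrange (fromℤ (+ 3)) (ι (suc a)) (zeroMod3 (suc x)) (kd (suc a ℕ.* suc x) n)))
      (trans (∑-multiples n (λ x → ι (suc a) ℚ.* fromℤ (+ 3) ℚ.* kd (suc a ℕ.* x) n))
        (∑-cong′ n (λ x → cong₂ ℚ._*_ (sym (ι-* (suc a) 3)) (cong (λ z → kd z n) (assoc (suc a) (suc x))))))))) ⟫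
  where
  rearrange : ∀ c i z k → c ℚ.* i ℚ.* z ℚ.* k ≡ i ℚ.* c ℚ.* k ℚ.* z
  rearrange = solve 4 (λ c i z k → c :* i :* z :* k := i :* c :* k :* z) refl
    where open ℚ-Solver
  assoc : ∀ a x → a ℕ.* (x ℕ.* 3) ≡ a ℕ.* 3 ℕ.* x
  assoc a x = trans (cong (a ℕ.*_) (ℕₚ.*-comm x 3)) (sym (ℕₚ.*-assoc a 3 x))

S₁ S₃ : PS
S₁ = ⟪ a¹ ⟫₁
S₃ = ⟪ aζ ⟫₁

1-q^-≈ : ∀ n → 𝟙 ⊖ qˢ ^ˢ n ≈ 1# - kd n
1-q^-≈ n = ⊖→- 𝟙→1# (qˢ^ n)

1-kd-unit : ∀ {n k} → k ℕ.< n → (1# - kd n) k ≡ 1# k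
1-kd-unit {n} {k} k<n = trans (minus-at 1# (kd n) k) (trans (cong (λ z → 1# k ℚ.- z) (kd-> k<n)) (ℚₚ.+-identityʳ (1# k)))

D-small : ∀ m {k} → k ℕ.< m → D m k ≡ 0ℚ
D-small m {k} k<m = ∑-zero k (λ x _ → kd-> (ℕₚ.<-≤-trans k<m (ℕₚ.m≤n*m m (suc x))))

logq : ℕ → PS
logq m = - (K (+ m) * D m)

logq-at : ∀ m k → logq m k ≡ ℚ.- (ι m ℚ.* D m k)
logq-at m k = trans (neg-at (K (+ m) * D m) k) (cong ℚ.-_ (K-*-at (+ m) (D m) k))

logq-small : ∀ m {k} → k ℕ.< m → logq m k ≡ 0ℚ
logq-small m {k} k<m = trans (logq-at m k) (cong ℚ.-_ (trans (cong (ι m ℚ.*_) (D-small m k<m)) (ℚₚ.*-zeroʳ (ι m))))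

E-LogD : ∀ k → LogD (E (suc k)) (λ j → ∑ j (λ i → logq (suc k ℕ.* suc i) j))
E-LogD k = infProd-LogD {s = λ n → logq (suc k ℕ.* n)} record
  { unit  = λ n j j≤n → trans (at (1-q^-≈ (suc k ℕ.* suc n)) j) (1-kd-unit (big n j≤n))
  ; logD  = λ n → LogD-cong (≈-sym (1-q^-≈ (suc k ℕ.* suc n))) ≈-refl (LogD-1-q^ (n ℕ.+ k ℕ.* suc n))
  ; small = λ n j j≤n → logq-small (suc k ℕ.* suc n) (big n j≤n) }
  where
  big : ∀ n {j} → j ℕ.≤ n → j ℕ.< suc k ℕ.* suc n
  big n j≤n = ℕₚ.<-≤-trans (s≤s j≤n) (ℕₚ.m≤n*m (suc n) (suc k))

LogD-E₁ : LogD (E 1) (- S₁)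
LogD-E₁ = LogD-cong ≈-refl ⟪ (λ j → trans (trans (∑-cong′ j (λ i → trans (logq-at (1 ℕ.* suc i) j)
    (cong ℚ.-_ (trans (sym (∑-*ˡ j (ι (1 ℕ.* suc i)) (λ x → kd (suc x ℕ.* (1 ℕ.* suc i)) j)))
    (∑-cong′ j (λ x → cong₂ (λ y z → ι y ℚ.* kd z j) (ℕₚ.*-identityˡ (suc i))
        (trans (cong (suc x ℕ.*_) (ℕₚ.*-identityˡ (suc i))) (ℕₚ.*-comm (suc x) (suc i)))))))))
    (∑-neg j _)) (sym (neg-at S₁ j))) ⟫ (E-LogD 0)

LogD-E₃ : LogD (E 3) (- S₃)
LogD-E₃ = LogD-cong ≈-refl (≈-trans ⟪ (λ j → trans (trans (∑-cong′ j (λ i → trans (logq-at (3 ℕ.* suc i) j)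
    (cong ℚ.-_ (trans (sym (∑-*ˡ j (ι (3 ℕ.* suc i)) (λ x → kd (suc x ℕ.* (3 ℕ.* suc i)) j)))
    (∑-cong′ j (λ x → cong₂ (λ y z → ι y ℚ.* kd z j) (ℕₚ.*-comm 3 (suc i))
        (trans (ℕₚ.*-comm (suc x) (3 ℕ.* suc i)) (cong (ℕ._* suc x) (ℕₚ.*-comm 3 (suc i))))))))))
    (∑-neg j _)) (sym (neg-at threefold j))) ⟫ (-‿cong (≈-sym aζ-threefold))) (E-LogD 2)

-- The differential system of level 3

-- Ideal membership: to exploit l = r one names a cofactor k, and what remains, f = g + k(l - r), is
-- a polynomial identity for the ring solver. Nested uses eliminate several relations at once.
use : ∀ {l r f g} k → l ≈ r → f ≈ g + k * (l - r) → f ≈ g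
use {l} {r} {f} {g} k l≈r eq = ≈-trans eq (≈-trans (+-cong ≈-refl (*-cong ≈-refl (+-cong l≈r ≈-refl)))
  (solve 3 (λ g k r → g :+ k :* (r :- r) := g) ≈-refl g k r))
  where open PS-Solver

-- `P` is E₂(3τ), and `M` is the weight 3 Eisenstein series that will turn out to be η(3τ)⁹/η(τ)³.
X W M U P : PS
X = ⟪ aχ ⟫₁
W = ⟪ a²χ ⟫₁
M = ⟪ x²χ ⟫₁
U = ⟪ bχ ⟫₁
P = 1# - K (+ 8) * S₃

-- `A` has weight 1, `Z` = (3E₂(3τ) - E₂(τ))/2 has weight 2, `L` is the weight 3 Eisenstein series
-- equal to η(τ)⁹/η(3τ)³, and `B` = (3A(q³) - A(q))/2 will be η(τ)³/η(3τ).
A L Z B : PS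
A = 1# + K (+ 6) * X
L = 1# - K (+ 9) * W
Z = 1# + (K (+ 12) * S₁ - K (+ 12) * S₃)
B = 1# + K (+ 3) * U

xχ≈aχ : ⟪ xχ ⟫₁ ≈ X
xχ≈aχ = Lam-swap (ev₁ xχ)

xζ≈aζ : ⟪ xζ ⟫₁ ≈ S₃
xζ≈aζ = ≈-trans xζ-threefold (≈-sym aζ-threefold)

δ-affine : ∀ i f → δ (1# + K i * f) ≈ K i * δ f
δ-affine i f = ≈-trans (δ-+ 1# (K i * f)) (≈-trans (+-cong (δ-K (+ 1))
    (≈-trans (δ-* (K i) f) (+-cong (*-cong (δ-K i) ≈-refl) ≈-refl)))
  (solve 3 (λ k f d → # 0 :+ (# 0 :* f :+ k :* d) := k :* d) ≈-refl (K i) f (δ f)))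
  where open PS-Solver

δ-affine⁻ : ∀ i f → δ (1# - K i * f) ≈ - (K i * δ f)
δ-affine⁻ i f = ≈-trans (δ-cong (solve 2 (λ k f → # 1 :- k :* f := # 1 :+ (:- k) :* f) ≈-refl (K i) f))
  (≈-trans (δ-+ 1# (- K i * f)) (≈-trans (+-cong (δ-K (+ 1)) (≈-trans (δ-* (- K i) f)
      (+-cong (*-cong (≈-trans (δ-neg (K i)) (-‿cong (δ-K i))) ≈-refl) ≈-refl)))
  (solve 3 (λ k f d → # 0 :+ ((:- # 0) :* f :+ (:- k) :* d) := :- (k :* d)) ≈-refl (K i) f (δ f))))
  where open PS-Solver

A²≈Z : A * A ≈ Z
A²≈Z = use 1# id-AA (solve 3 (λ x s r →
    (# 1 :+ # 6 :* x) :* (# 1 :+ # 6 :* x)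
    := (# 1 :+ (# 12 :* s :- # 12 :* r))
    :+ # 1 :* ((# 18 :* (x :* x :+ x :* x) :+ # 0) :- (# 12 :* s :+ (con (ℤ.- + 12) :* r :+ (con (ℤ.- + 12) :* x :+ # 0)))))
  ≈-refl X S₁ S₃)
  where open PS-Solver

-- 12δA - 3PA is the Serre derivative of `A` formed with 3E₂(3τ). It has weight 3, so only `A * Z`
-- and `L` can appear.
δA-AL : K (+ 12) * δ A ≈ K (+ 3) * P * A + A * Z - K (+ 4) * L
δA-AL = ≈-trans (*-cong ≈-refl (δ-affine (+ 6) X)) (use (- 1#) id-AP (solve 5 (λ x s r w d →
    # 12 :* (# 6 :* d)
    := (# 3 :* (# 1 :- # 8 :* r) :* (# 1 :+ # 6 :* x)
        :+ (# 1 :+ # 6 :* x) :* (# 1 :+ (# 12 :* s :- # 12 :* r)) :- # 4 :* (# 1 :- # 9 :* w))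
    :+ (:- # 1) :* ((# 36 :* (x :* s :+ x :* s) :+ (con (ℤ.- + 108) :* (x :* r :+ x :* r) :+ # 0))
       :- (# 72 :* d :+ (con (ℤ.- + 24) :* x :+ (con (ℤ.- + 12) :* s :+ (# 36 :* r :+ (con (ℤ.- + 36) :* w :+ # 0)))))))
  ≈-refl X S₁ S₃ W (δ X)))
  where open PS-Solver

id-AP″ : K (+ 36) * (X * S₁ + X * S₁) + (K (ℤ.- + 12) * (X * S₃ + X * S₃) + 0#)
       ≈ K (ℤ.- + 24) * δ X + (K (+ 4) * S₃ + (K (ℤ.- + 12) * S₁ + (K (+ 36) * M + 0#)))
id-AP″ = ≈-trans (+-cong (*-cong ≈-refl (+-cong (*-cong X≈ ≈-refl) (*-cong X≈ ≈-refl)))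
    (+-cong (*-cong ≈-refl (+-cong (*-cong X≈ S≈) (*-cong X≈ S≈))) ≈-refl))
  (≈-trans id-AP′ (+-cong (*-cong ≈-refl (δ-cong xχ≈aχ)) (+-cong (*-cong ≈-refl xζ≈aζ) ≈-refl)))
  where
  X≈ : X ≈ ⟪ xχ ⟫₁
  X≈ = ≈-sym xχ≈aχ
  S≈ : S₃ ≈ ⟪ xζ ⟫₁
  S≈ = ≈-sym xζ≈aζ

-- `id-AP` and `id-AP″` both express δX, once with the remainder `W` and once with `M`. Eliminating
-- δX leaves this relation, the cubic identity in disguise since Z = A².
AZ≈L+27M : A * Z ≈ L + K (+ 27) * M
AZ≈L+27M = K-cancel 3 (use (- 1#) δA-AL (use (K (+ 12)) (δ-affine (+ 6) X) (use (K (+ 3)) id-AP″ (solve 7 (λ x s r w d m e →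
    # 4 :* ((# 1 :+ # 6 :* x) :* z s r)
    := ((# 4 :* (# 1 :- # 9 :* w :+ # 27 :* m)
    :+ (:- # 1) :* (# 12 :* e :- (# 3 :* (# 1 :- # 8 :* r) :* (# 1 :+ # 6 :* x)
        :+ (# 1 :+ # 6 :* x) :* z s r :- # 4 :* (# 1 :- # 9 :* w))))
    :+ # 12 :* (e :- # 6 :* d))
    :+ # 3 :* ((# 36 :* (x :* s :+ x :* s) :+ (con (ℤ.- + 12) :* (x :* r :+ x :* r) :+ # 0))
       :- (con (ℤ.- + 24) :* d :+ (# 4 :* r :+ (con (ℤ.- + 12) :* s :+ (# 36 :* m :+ # 0))))))
  ≈-refl X S₁ S₃ W (δ X) M (δ A)))))
  where
  open PS-Solver
  z : Polynomial 7 → Polynomial 7 → Polynomial 7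
  z s r = # 1 :+ (# 12 :* s :- # 12 :* r)

L-LogD : LogD L (K (+ 3) * S₃ - K (+ 9) * S₁)
L-LogD = K-cancel 3 (≈-trans (*-cong ≈-refl (δ-affine⁻ (+ 9) W)) (use (- K (+ 3)) id-LP (solve 4 (λ s r w d →
    # 4 :* :- (# 9 :* d)
    := # 4 :* ((# 1 :- # 9 :* w) :* (# 3 :* r :- # 9 :* s))
    :+ (:- # 3) :* ((# 54 :* (w :* s :+ w :* s) :+ (con (ℤ.- + 18) :* (w :* r :+ w :* r) :+ # 0))
       :- (# 12 :* s :+ (con (ℤ.- + 4) :* r :+ (con (ℤ.- + 12) :* d :+ # 0)))))
  ≈-refl S₁ S₃ W (δ W))))
  where open PS-Solver

-- The weight 5 series of the statement factor as weight 2 times weight 3: this is `C₀`, and `ZM≈`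
-- gives its companion without constant term.
ZL≈ : Z * L ≈ 1# + K (+ 3) * ⟪ a⁴χ ⟫₁
ZL≈ = use (- 1#) id-LZ (solve 4 (λ s r w f →
    (# 1 :+ (# 12 :* s :- # 12 :* r)) :* (# 1 :- # 9 :* w)
    := (# 1 :+ # 3 :* f)
    :+ (:- # 1) :* ((# 54 :* (w :* s :+ w :* s) :+ (con (ℤ.- + 54) :* (w :* r :+ w :* r) :+ # 0))
       :- (# 12 :* s :+ (con (ℤ.- + 12) :* r :+ (con (ℤ.- + 9) :* w :+ (con (ℤ.- + 3) :* f :+ # 0))))))
  ≈-refl S₁ S₃ W ⟪ a⁴χ ⟫₁)
  where open PS-Solver

ZM≈ : Z * M ≈ ⟪ x⁴χ ⟫₁
ZM≈ = use (- (K (+ 12) * M)) (≈-sym xζ≈aζ) (use 1# id-MZ (solve 5 (λ s r r′ w f →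
    (# 1 :+ (# 12 :* s :- # 12 :* r)) :* w
    := (f :+ (:- (# 12 :* w)) :* (r :- r′))
    :+ # 1 :* ((# 6 :* (w :* s :+ w :* s) :+ (con (ℤ.- + 6) :* (w :* r′ :+ w :* r′) :+ # 0))
       :- (# 1 :* f :+ (con (ℤ.- + 1) :* w :+ # 0))))
  ≈-refl S₁ S₃ ⟪ xζ ⟫₁ M ⟪ x⁴χ ⟫₁))
  where open PS-Solver

B-LogD : LogD B (S₃ - K (+ 3) * S₁)
B-LogD = K-cancel 3 (≈-trans (*-cong ≈-refl (δ-affine (+ 3) U)) (use (- (K (+ 4) * B)) (≈-sym xζ≈aζ)
    (use (- 1#) id-BP (solve 5 (λ s r r′ w d →
    # 4 :* (# 3 :* d)
    := (# 4 :* ((# 1 :+ # 3 :* w) :* (r :- # 3 :* s))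
    :+ (:- (# 4 :* (# 1 :+ # 3 :* w))) :* (r :- r′))
    :+ (:- # 1) :* ((# 6 :* (w :* r′ :+ w :* r′) :+ (con (ℤ.- + 18) :* (w :* s :+ w :* s) :+ # 0))
       :- (# 12 :* d :+ (con (ℤ.- + 4) :* r′ :+ (# 12 :* s :+ # 0)))))
  ≈-refl S₁ S₃ ⟪ xζ ⟫₁ U (δ U)))))
  where open PS-Solver

δ-K* : ∀ i f → δ (K i * f) ≈ K i * δ f
δ-K* i f = ≈-trans (δ-* (K i) f) (≈-trans (+-cong (*-cong (δ-K i) ≈-refl) ≈-refl)
  (solve 3 (λ k f d → # 0 :* f :+ k :* d := k :* d) ≈-refl (K i) f (δ f)))
  where open PS-Solver

δZ : δ Z ≈ K (+ 12) * δ S₁ - K (+ 12) * δ S₃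
δZ = ≈-trans (δ-+ 1# (K (+ 12) * S₁ - K (+ 12) * S₃)) (≈-trans (+-cong (δ-K (+ 1))
    (≈-trans (δ-minus (K (+ 12) * S₁) (K (+ 12) * S₃)) (+-cong (δ-K* (+ 12) S₁) (-‿cong (δ-K* (+ 12) S₃))))) (+-identityˡ _))

δA² : δ Z ≈ K (+ 2) * A * δ A
δA² = ≈-trans (δ-cong (≈-sym A²≈Z)) (≈-trans (δ-* A A) (solve 2 (λ a d → d :* a :+ a :* d := # 2 :* a :* d) ≈-refl A (δ A)))
  where open PS-Solver

-- Ramanujan's equation for δE₂ taken at 3τ, with 9E₄(3τ) = A⁴ + 8AL. The certificate also involves
-- δS₁, which is removed through δZ = 2A δA.
δP-AL : K (+ 36) * δ P ≈ K (+ 9) * (P * P) - Z * Z - K (+ 8) * (A * L)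
δP-AL = K-cancel 7 (≈-trans (*-cong ≈-refl (*-cong ≈-refl (δ-affine⁻ (+ 8) S₃)))
  (use (K (+ 12) * P + K (+ 4) * Z) (≈-sym A²≈Z) (use (- (K (+ 4) * A)) δA-AL
      (use (- K (+ 24)) (≈-trans (≈-sym δZ) δA²) (use (- 1#) id-AL
    (solve 7 (λ x s r w s′ r′ e → let a = # 1 :+ # 6 :* x
                                      l = # 1 :- # 9 :* w
                                      q = # 1 :- # 8 :* r
                                      z = # 1 :+ (# 12 :* s :- # 12 :* r) in
      # 8 :* (# 36 :* :- (# 8 :* r′))
      := # 8 :* (# 9 :* (q :* q) :- z :* z :- # 8 :* (a :* l))
         :+ (# 12 :* q :+ # 4 :* z) :* (z :- a :* a)
         :+ (:- (# 4 :* a)) :* (# 12 :* e :- (# 3 :* q :* a :+ a :* z :- # 4 :* l))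
         :+ (:- # 24) :* ((# 12 :* s′ :- # 12 :* r′) :- # 2 :* a :* e)
         :+ (:- # 1) :* ((# 2592 :* (r :* r :+ r :* r) :+ (con (ℤ.- + 288) :* (s :* s :+ s :* s) :+
             (# 2160 :* (x :* w :+ x :* w) :+ # 0)))
           :- (# 1296 :* r :+ (con (ℤ.- + 2592) :* r′ :+ (con (ℤ.- + 48) :* s :+
               (# 288 :* s′ :+ (# 480 :* x :+ (con (ℤ.- + 720) :* w :+ # 0))))))))
      ≈-refl X S₁ S₃ W (δ S₁) (δ S₃) (δ A)))))))
  where open PS-Solver

A³≈ : A * A * A ≈ L + K (+ 27) * M
A³≈ = ≈-trans (solve 1 (λ a → a :* a :* a := a :* (a :* a)) ≈-refl A) (≈-trans (*-cong ≈-refl A²≈Z) AZ≈L+27M)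
  where open PS-Solver

δA≈ : K (+ 12) * δ A ≈ K (+ 3) * P * A + A * A * A - K (+ 4) * L
δA≈ = ≈-trans δA-AL (+-cong (+-cong ≈-refl (≈-trans (*-cong ≈-refl (≈-sym A²≈Z))
    (solve 1 (λ a → a :* (a :* a) := a :* a :* a) ≈-refl A))) ≈-refl)
  where open PS-Solver

δL≈ : K (+ 4) * δ L ≈ K (+ 3) * (P - A * A) * L
δL≈ = ≈-trans (*-cong ≈-refl L-LogD) (≈-trans
  (solve 3 (λ l s r → # 4 :* (l :* (# 3 :* r :- # 9 :* s)) := # 3 :* ((# 1 :- # 8 :* r) :-
      (# 1 :+ (# 12 :* s :- # 12 :* r))) :* l) ≈-refl L S₁ S₃)
  (*-cong (*-cong ≈-refl (+-cong ≈-refl (-‿cong (≈-sym A²≈Z)))) ≈-refl))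
  where open PS-Solver

δP≈ : K (+ 36) * δ P ≈ K (+ 9) * (P * P) - A * A * (A * A) - K (+ 8) * (A * L)
δP≈ = ≈-trans δP-AL (+-cong (+-cong ≈-refl (-‿cong (*-cong (≈-sym A²≈Z) (≈-sym A²≈Z)))) ≈-refl)

δ-A³ : δ (A * A * A) ≈ K (+ 3) * (A * A) * δ A
δ-A³ = ≈-trans (δ-* (A * A) A) (≈-trans (+-cong (*-cong (δ-* A A) ≈-refl) ≈-refl)
  (solve 2 (λ a d → (d :* a :+ a :* d) :* a :+ a :* a :* d := # 3 :* (a :* a) :* d) ≈-refl A (δ A)))
  where open PS-Solver

δδA≈ : K (+ 12) * δ (δ A) ≈ K (+ 3) * (δ P * A + P * δ A) + K (+ 3) * (A * A) * δ A - K (+ 4) * δ L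
δδA≈ = ≈-trans (≈-sym (δ-K* (+ 12) (δ A))) (≈-trans (δ-cong δA≈) (≈-trans (δ-minus (K (+ 3) * P * A + A * A * A) (K (+ 4) * L))
  (+-cong (≈-trans (δ-+ (K (+ 3) * P * A) (A * A * A)) (+-cong (≈-trans (δ-cong (*-assoc (K (+ 3)) P A))
      (≈-trans (δ-K* (+ 3) (P * A)) (*-cong ≈-refl (δ-* P A)))) δ-A³)) (-‿cong (δ-K* (+ 4) L)))))

-- The left side is half the second Rankin-Cohen bracket of the weight 1 form `A` with itself, so
-- the quasimodular `P` has to cancel.
rankin-cohen : A * δ (δ A) - K (+ 2) * (δ A * δ A) ≈ K (+ 6) * (L * M)
-- The cancelled factor is 144 = 12 · 12: each derivative of `A` brings the 12 of `δA≈`.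
rankin-cohen = K-cancel 143
  (use (K (+ 12) * A) δδA≈ (use (A * A) δP≈ (use (- (K (+ 12) * A)) δL≈
  (use (K (+ 3) * (A * P + A * A * A) - K (+ 2) * (K (+ 12) * δ A + R)) δA≈ (use (K (+ 32) * L) A³≈
  (solve 8 (λ a p l m x y q k → let r = # 3 :* p :* a :+ a :* a :* a :- # 4 :* l in
    # 144 :* (a :* y :- # 2 :* (x :* x))
    := # 144 :* (# 6 :* (l :* m))
     :+ # 12 :* a :* (# 12 :* y :- (# 3 :* (q :* a :+ p :* x) :+ # 3 :* (a :* a) :* x :- # 4 :* k))
     :+ a :* a :* (# 36 :* q :- (# 9 :* (p :* p) :- a :* a :* (a :* a) :- # 8 :* (a :* l)))
     :+ (:- (# 12 :* a)) :* (# 4 :* k :- # 3 :* (p :- a :* a) :* l)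
     :+ (# 3 :* (a :* p :+ a :* a :* a) :- # 2 :* (# 12 :* x :+ r)) :* (# 12 :* x :- r)
     :+ # 32 :* l :* (a :* a :* a :- (l :+ # 27 :* m)))
  ≈-refl A P L M (δ A) (δ (δ A)) (δ P) (δ L)))))))
  where
  open PS-Solver
  R : PS
  R = K (+ 3) * P * A + A * A * A - K (+ 4) * L

-- No separate certificate is needed: differentiate A³ = L + 27M and insert the equations for `A`
-- and `L`. The summand 1 reflects that `M` starts at q.
δM≈ : δ M ≈ M * (1# + (K (+ 3) * S₁ - K (+ 9) * S₃))
δM≈ = K-cancel 3 (K-cancel 26 (use (K (+ 4)) (≈-sym δ27M) (use (A * A) δA≈
    (use (- 1#) δL≈ (use (K (+ 3) * P + A * A) A³≈ (use (K (+ 27) * M) A²≈Z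
  (solve 8 (λ a s r l m x k n → let p = # 1 :- # 8 :* r
                                    z = # 1 :+ (# 12 :* s :- # 12 :* r) in
    # 27 :* (# 4 :* n)
    := # 27 :* (# 4 :* (m :* (# 1 :+ (# 3 :* s :- # 9 :* r))))
     :+ # 4 :* (# 27 :* n :- (# 3 :* (a :* a) :* x :- k))
     :+ a :* a :* (# 12 :* x :- (# 3 :* p :* a :+ a :* a :* a :- # 4 :* l))
     :+ (:- # 1) :* (# 4 :* k :- # 3 :* (p :- a :* a) :* l)
     :+ (# 3 :* p :+ a :* a) :* (a :* a :* a :- (l :+ # 27 :* m))
     :+ # 27 :* m :* (a :* a :- z))
  ≈-refl A S₁ S₃ L M (δ A) (δ L) (δ M))))))))
  where
  open PS-Solver
  δ27M : K (+ 3) * (A * A) * δ A - δ L ≈ K (+ 27) * δ M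
  δ27M = use 1# δL+27M (solve 3 (λ x y z → x :- y := z :+ # 1 :* (x :- (y :+ z))) ≈-refl (K (+ 3) * (A * A) * δ A) (δ L)
      (K (+ 27) * δ M))
    where
    δL+27M : K (+ 3) * (A * A) * δ A ≈ δ L + K (+ 27) * δ M
    δL+27M = ≈-trans (≈-sym δ-A³) (≈-trans (δ-cong A³≈) (≈-trans (δ-+ L (K (+ 27) * M)) (+-cong ≈-refl (δ-K* (+ 27) M))))

-- Eta quotients

*-0-cong : ∀ {c d} f g → f 0 ≡ c → g 0 ≡ d → (f * g) 0 ≡ c ℚ.* d
*-0-cong f g p q = trans (*-0 f g) (cong₂ ℚ._*_ p q)

^ˢ-0 : ∀ f n → f 0 ≡ 1ℚ → (f ^ˢ n) 0 ≡ 1ℚ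
^ˢ-0 f zero    f0 = refl
^ˢ-0 f (suc n) f0 = cong₂ ℚ._*_ f0 (^ˢ-0 f n f0)

^-0 : ∀ f n → f 0 ≡ 1ℚ → (f ^ n) 0 ≡ 1ℚ
^-0 f n f0 = trans (sym (at (^ˢ→^ n ≈-refl) 0)) (^ˢ-0 f n f0)

^-inverse : ∀ {f g} → f * g ≈ 1# → ∀ n → f ^ n * g ^ n ≈ 1#
^-inverse fg zero    = *-identityˡ 1#
^-inverse {f} {g} fg (suc n) = ≈-trans
  (solve 4 (λ f g x y → f :* x :* (g :* y) := f :* g :* (x :* y)) ≈-refl f g (f ^ n) (g ^ n))
  (≈-trans (*-cong fg (^-inverse fg n)) (*-identityˡ 1#))
  where open PS-Solver

inv-^ˢ : ∀ f n → f 0 ≡ 1ℚ → inv (f ^ˢ n) ≈ inv f ^ n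
inv-^ˢ f n f0 = ≈-sym (≈inv (^ˢ-0 f n f0) (≈-trans (*-cong (^ˢ→^ n ≈-refl) ≈-refl) (^-inverse (*-inv f f0) n)))

δ-inv : ∀ f → f 0 ≡ 1ℚ → δ (inv f) ≈ - (inv f * inv f * δ f)
δ-inv f f0 = *-cancelˡ {f} f0 (use 1# δ1 (use (inv f * δ f) (*-inv f f0)
  (solve 4 (λ f i d e → f :* e := f :* :- (i :* i :* d) :+ # 1 :* ((d :* i :+ f :* e) :- # 0) :+ i :* d :* (f :* i :- # 1))
    ≈-refl f (inv f) (δ f) (δ (inv f)))))
  where
  open PS-Solver
  δ1 : δ f * inv f + f * δ (inv f) ≈ 0#
  δ1 = ≈-trans (≈-sym (δ-* f (inv f))) (≈-trans (δ-cong (*-inv f f0)) (δ-K (+ 1)))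

δ-kd1 : δ (kd 1) ≈ kd 1
δ-kd1 = ⟪ (λ n → trans (δ-at (kd 1) n) (trans (sym (kd-subst ι 1 n)) (ℚₚ.*-identityˡ (kd 1 n)))) ⟫

kd1-cancel : ∀ {f g} → kd 1 * f ≈ kd 1 * g → f ≈ g
kd1-cancel {f} {g} eq = ⟪ (λ n → trans (sym (kd-* 1 f n)) (trans (at eq (suc n)) (kd-* 1 g n))) ⟫

shift-tail : ∀ f → f 0 ≡ 0ℚ → f ≈ kd 1 * tail f
shift-tail f f0 = ≈-trans ⟪ (λ { zero → f0 ; (suc n) → refl }) ⟫ (shift-≈ (tail f))

δ-shift : ∀ f → δ (kd 1 * f) ≈ kd 1 * (f + δ f)
δ-shift f = ≈-trans (δ-* (kd 1) f) (≈-trans (+-cong (*-cong δ-kd1 ≈-refl) ≈-refl)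
  (solve 3 (λ k f d → k :* f :+ k :* d := k :* (f :+ d)) ≈-refl (kd 1) f (δ f)))
  where open PS-Solver

𝕖 𝕗 𝕚 𝕛 : PS
𝕖 = E 1
𝕗 = E 3
𝕚 = inv 𝕖
𝕛 = inv 𝕗

𝕖𝕚 : 𝕖 * 𝕚 ≈ 1#
𝕖𝕚 = *-inv 𝕖 refl

𝕗𝕛 : 𝕗 * 𝕛 ≈ 1#
𝕗𝕛 = *-inv 𝕗 refl

LogD-𝕚 : LogD 𝕚 S₁
LogD-𝕚 = LogD-cong ≈-refl (solve 1 (λ 𝕤 → :- (:- 𝕤) := 𝕤) ≈-refl S₁) (LogD-inv {𝕖} refl LogD-E₁)
  where open PS-Solver

LogD-𝕛 : LogD 𝕛 S₃
LogD-𝕛 = LogD-cong ≈-refl (solve 1 (λ 𝕤 → :- (:- 𝕤) := 𝕤) ≈-refl S₃) (LogD-inv {𝕗} refl LogD-E₃)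
  where open PS-Solver

combination-0 : ∀ i j → (K i * S₁ + K j * S₃) 0 ≡ 0ℚ
combination-0 i j = trans (+-at (K i * S₁) (K j * S₃) 0) (cong₂ ℚ._+_ (trans (K-*-at i S₁ 0) (ℚₚ.*-zeroʳ (fromℤ i)))
    (trans (K-*-at j S₃ 0) (ℚₚ.*-zeroʳ (fromℤ j))))

affine-0 : ∀ i h → (1# + K i * Lam h) 0 ≡ 1ℚ
affine-0 i h = trans (+-at 1# (K i * Lam h) 0) (cong₂ ℚ._+_ (1#-at 0) (trans (K-*-at i (Lam h) 0) (ℚₚ.*-zeroʳ (fromℤ i))))

affine⁻-0 : ∀ i h → (1# - K i * Lam h) 0 ≡ 1ℚ
affine⁻-0 i h = trans (minus-at 1# (K i * Lam h) 0) (cong₂ ℚ._-_ (1#-at 0) (trans (K-*-at i (Lam h) 0) (ℚₚ.*-zeroʳ (fromℤ i))))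

-- An Eisenstein series and an eta quotient with the same logarithmic derivative, here -9S₁ + 3S₃,
-- and the same constant term.
L≈η : L ≈ 𝕖 ^ 9 * 𝕛 ^ 3
L≈η = LogD-unique (combination-0 (ℤ.- + 9) (+ 3))
  (LogD-cong ≈-refl (solve 2 (λ 𝕤 r → # 3 :* r :- # 9 :* 𝕤 := con (ℤ.- + 9) :* 𝕤 :+ # 3 :* r) ≈-refl S₁ S₃) L-LogD)
  (LogD-cong ≈-refl (solve 2 (λ 𝕤 r → # 9 :* (:- 𝕤) :+ # 3 :* r := con (ℤ.- + 9) :* 𝕤 :+ # 3 :* r) ≈-refl S₁ S₃)
      (LogD-* (LogD-^ 9 LogD-E₁) (LogD-^ 3 LogD-𝕛)))
  (trans (affine⁻-0 (+ 9) (ev₁ a²χ)) (sym (*-0-cong (𝕖 ^ 9) (𝕛 ^ 3) (^-0 𝕖 9 refl) (^-0 𝕛 3 refl))))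
  where open PS-Solver

B≈η : B ≈ 𝕖 ^ 3 * 𝕛
B≈η = LogD-unique (combination-0 (ℤ.- + 3) (+ 1))
  (LogD-cong ≈-refl (solve 2 (λ 𝕤 r → r :- # 3 :* 𝕤 := con (ℤ.- + 3) :* 𝕤 :+ # 1 :* r) ≈-refl S₁ S₃) B-LogD)
  (LogD-cong ≈-refl (solve 2 (λ 𝕤 r → # 3 :* (:- 𝕤) :+ r := con (ℤ.- + 3) :* 𝕤 :+ # 1 :* r) ≈-refl S₁ S₃)
      (LogD-* (LogD-^ 3 LogD-E₁) LogD-𝕛))
  (trans (affine-0 (+ 3) (ev₁ bχ)) (sym (*-0-cong (𝕖 ^ 3) 𝕛 (^-0 𝕖 3 refl) refl)))
  where open PS-Solver

-- `LogD-unique` demands a logarithmic derivative without constant term, so the leading q is divided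
-- out before it is applied.
M≈η : M ≈ kd 1 * (𝕗 ^ 9 * 𝕚 ^ 3)
M≈η = ≈-trans M≈shift (*-cong ≈-refl (LogD-unique (combination-0 (+ 3) (ℤ.- + 9))
  (LogD-cong ≈-refl (solve 2 (λ 𝕤 r → # 3 :* 𝕤 :- # 9 :* r := # 3 :* 𝕤 :+ con (ℤ.- + 9) :* r) ≈-refl S₁ S₃) tail-LogD)
  (LogD-cong ≈-refl (solve 2 (λ 𝕤 r → # 9 :* (:- r) :+ # 3 :* 𝕤 := # 3 :* 𝕤 :+ con (ℤ.- + 9) :* r) ≈-refl S₁ S₃)
      (LogD-* (LogD-^ 9 LogD-E₃) (LogD-^ 3 LogD-𝕚)))
  (sym (*-0-cong (𝕗 ^ 9) (𝕚 ^ 3) (^-0 𝕗 9 refl) (^-0 𝕚 3 refl)))))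
  where
  open PS-Solver
  M≈shift : M ≈ kd 1 * tail M
  M≈shift = shift-tail M refl
  tail-LogD : LogD (tail M) (K (+ 3) * S₁ - K (+ 9) * S₃)
  tail-LogD = use 1# (kd1-cancel (≈-trans (≈-sym (δ-shift (tail M))) (≈-trans (δ-cong (≈-sym M≈shift))
      (≈-trans δM≈ (≈-trans (*-cong M≈shift ≈-refl) (*-assoc (kd 1) (tail M) _))))))
    (solve 3 (λ f d 𝕤 → d := f :* 𝕤 :+ # 1 :* ((f :+ d) :- f :* (# 1 :+ 𝕤))) ≈-refl (tail M) (δ (tail M))
        (K (+ 3) * S₁ - K (+ 9) * S₃))

u≈ : u ≈ kd 1 * (𝕗 ^ 12 * 𝕚 ^ 12)
u≈ = ≈-trans (shift-≈ _) (*-cong ≈-refl (⊛→* {g = inv (𝕖 ^ˢ 12)} (^ˢ→^ 12 {𝕗} ≈-refl) (inv-^ˢ 𝕖 12 refl)))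

uL≈M : u * L ≈ M
uL≈M = ≈-trans (*-cong (≈-trans u≈ (*-cong ≈-refl (*-cong (^-homo-* 𝕗 9 3) (^-homo-* 𝕚 9 3)))) L≈η) (≈-trans
  (use (kd 1 * (𝕗 ^ 9 * 𝕚 ^ 3) * (𝕗 ^ 3 * 𝕛 ^ 3)) (^-inverse 𝕖𝕚 9) (use (kd 1 * (𝕗 ^ 9 * 𝕚 ^ 3)) (^-inverse 𝕗𝕛 3)
    (solve 7 (λ k f9 f3 i9 i3 e9 j3 → k :* (f9 :* f3 :* (i9 :* i3)) :* (e9 :* j3)
      := k :* (f9 :* i3) :+ k :* (f9 :* i3) :* (f3 :* j3) :* (e9 :* i9 :- # 1) :+ k :* (f9 :* i3) :* (f3 :* j3 :- # 1))
     ≈-refl (kd 1) (𝕗 ^ 9) (𝕗 ^ 3) (𝕚 ^ 9) (𝕚 ^ 3) (𝕖 ^ 9) (𝕛 ^ 3)))) (≈-sym M≈η))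
  where open PS-Solver

-- The leading q of `u` contributes the 1 in `Z`, and the two twelfth powers contribute 12S₁ - 12S₃.
δu : δ u ≈ u * Z
δu = ≈-trans (δ-cong u≈) (≈-trans (δ-shift (𝕗 ^ 12 * 𝕚 ^ 12)) (≈-trans
    (*-cong ≈-refl (+-cong ≈-refl (LogD-* (LogD-^ 12 LogD-E₃) (LogD-^ 12 LogD-𝕚))))
  (≈-trans (solve 4 (λ k x 𝕤 r → k :* (x :+ x :* (# 12 :* (:- r) :+ # 12 :* 𝕤)) := k :* x :*
      (# 1 :+ (# 12 :* 𝕤 :- # 12 :* r))) ≈-refl (kd 1) (𝕗 ^ 12 * 𝕚 ^ 12) S₁ S₃)
    (*-cong (≈-sym u≈) ≈-refl))))
  where open PS-Solver

𝕨 𝕤 : PS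
𝕨 = 1# + K (+ 27) * u
𝕤 = inv onePlus27u

w≈ : onePlus27u ≈ 𝕨
w≈ = ⊕→+ 𝟙→1# (·→* 27 ≈-refl)

ws : 𝕨 * 𝕤 ≈ 1#
ws = ≈-trans (*-cong (≈-sym w≈) ≈-refl) (*-inv onePlus27u refl)

A³≈wL : A * A * A ≈ 𝕨 * L
A³≈wL = ≈-trans A³≈ (≈-trans (+-cong ≈-refl (*-cong ≈-refl (≈-sym uL≈M)))
  (solve 2 (λ l v → l :+ # 27 :* (v :* l) := (# 1 :+ # 27 :* v) :* l) ≈-refl L u))
  where open PS-Solver

t≈ : t ≈ u * (𝕤 * 𝕤)
t≈ = ⊛→* {u} ≈-refl (≈-trans (inv-^ˢ onePlus27u 2 refl) (*-cong ≈-refl (*-identityʳ 𝕤)))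

α≈ : α ≈ K (+ 27) * u * 𝕤
α≈ = ⊛→* {g = 𝕤} (·→* 27 {u} ≈-refl) ≈-refl

108t≈4α[1-α] : ℕ→ℚ 108 · t ≈ ℕ→ℚ 4 · (α ⊛ (𝟙 ⊖ α))
108t≈4α[1-α] = ≈-trans (·→* 108 t≈) (≈-trans (use (K (+ 108) * u * 𝕤) ws
    (solve 2 (λ v 𝕤 → # 108 :* (v :* (𝕤 :* 𝕤)) := # 4 :* (# 27 :* v :* 𝕤 :* (# 1 :- # 27 :* v :* 𝕤))
       :+ # 108 :* v :* 𝕤 :* ((# 1 :+ # 27 :* v) :* 𝕤 :- # 1)) ≈-refl u 𝕤))
  (≈-sym (·→* 4 (⊛→* α≈ (⊖→- 𝟙→1# α≈)))))
  where open PS-Solver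

δs : δ 𝕤 ≈ - (K (+ 27) * u * Z * (𝕤 * 𝕤))
δs = ≈-trans (δ-inv onePlus27u refl) (≈-trans (-‿cong (*-cong ≈-refl (≈-trans (δ-cong w≈)
    (≈-trans (δ-affine (+ 27) u) (*-cong ≈-refl δu)))))
  (solve 3 (λ v 𝕤 z → :- (𝕤 :* 𝕤 :* (# 27 :* (v :* z))) := :- (# 27 :* v :* z :* (𝕤 :* 𝕤))) ≈-refl u 𝕤 Z))
  where open PS-Solver

-- The logarithmic derivative of t. Here 2𝕤 - 1 = (1 - 27u)/(1 + 27u) = 1 - 2α, the origin of the
-- factor 1 - 27u in `Cmix`.
Wₜ : PS
Wₜ = Z * (K (+ 2) * 𝕤 - 1#)

δt : δ t ≈ t * Wₜ
δt = ≈-trans (δ-cong t≈) (≈-trans (≈-trans (δ-* u (𝕤 * 𝕤)) (+-cong (*-cong δu ≈-refl)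
    (*-cong ≈-refl (≈-trans (δ-* 𝕤 𝕤) (+-cong (*-cong δs ≈-refl) (*-cong ≈-refl δs))))))
  (≈-trans (use (- (K (+ 2) * u * Z * (𝕤 * 𝕤))) ws (solve 3 (λ v 𝕤 z → let d = :- (# 27 :* v :* z :* (𝕤 :* 𝕤)) in
      v :* z :* (𝕤 :* 𝕤) :+ v :* (d :* 𝕤 :+ 𝕤 :* d) := v :* (𝕤 :* 𝕤) :* (z :* (# 2 :* 𝕤 :- # 1)) :+
          (:- (# 2 :* v :* z :* (𝕤 :* 𝕤))) :* ((# 1 :+ # 27 :* v) :* 𝕤 :- # 1)) ≈-refl u 𝕤 Z))
    (*-cong (≈-sym t≈) ≈-refl)))
  where open PS-Solver

t≈shift : t ≈ kd 1 * tOverQ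
t≈shift = shift-tail t refl

H*deriv-t : Hmix * deriv t ≈ Wₜ
H*deriv-t = ≈-trans (*-cong ≈-refl dt) (≈-trans (solve 3 (λ h t 𝕨 → h :* (t :* 𝕨) := t :* h :* 𝕨) ≈-refl Hmix tOverQ Wₜ)
  (≈-trans (*-cong (*-inv tOverQ refl) ≈-refl) (*-identityˡ Wₜ)))
  where
  open PS-Solver
  δt≈shift : δ t ≈ kd 1 * deriv t
  δt≈shift = ≈-trans ⟪ (λ { zero → trans (δ-at t 0) (ℚₚ.*-zeroˡ (t 0)) ; (suc n) → δ-at t (suc n) }) ⟫ (shift-≈ (deriv t))
  dt : deriv t ≈ tOverQ * Wₜ
  dt = kd1-cancel (≈-trans (≈-sym δt≈shift) (≈-trans δt (≈-trans (*-cong t≈shift ≈-refl) (*-assoc (kd 1) tOverQ Wₜ))))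

-- Eisenstein series

kd-*ˡ : ∀ a m n → kd (suc a ℕ.* m) (suc a ℕ.* n) ≡ kd m n
kd-*ˡ a m n with m ℕ.≟ n
... | yes refl = trans (kd-refl (suc a ℕ.* m)) (sym (kd-refl m))
... | no m≢n   = trans (kd-≢ (λ eq → m≢n (ℕₚ.*-cancelˡ-≡ m n (suc a) eq))) (sym (kd-≢ m≢n))

∑-kd : ∀ n {k} (G : ℕ → ℚ) → k ℕ.< n → ∑ n (λ i → G i ℚ.* kd i k) ≡ G k
∑-kd (suc n) {zero} G _ = trans (cong₂ ℚ._+_ (ℚₚ.*-identityʳ (G 0)) (∑-zero n (λ i _ → ℚₚ.*-zeroʳ (G (suc i)))))
    (ℚₚ.+-identityʳ (G 0))
∑-kd (suc n) {suc k} G (s≤s k<n) = trans (cong₂ ℚ._+_ (ℚₚ.*-zeroʳ (G 0)) (∑-kd n (λ i → G (suc i)) k<n))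
    (ℚₚ.+-identityˡ (G (suc k)))

divTerm-∑ : ∀ n g a → divTerm (suc n) g (suc a) ≡ ∑ (suc n) (λ x → g (suc a) (suc x) ℚ.* kd (suc a ℕ.* suc x) (suc n))
divTerm-∑ n g a with suc a ∣? suc n
... | yes (divides (suc x) eq) = sym (trans
  (∑-cong′ (suc n) (λ y → cong (g (suc a) (suc y) ℚ.*_) (trans (cong (kd (suc a ℕ.* suc y))
      (trans eq (ℕₚ.*-comm (suc x) (suc a)))) (kd-*ˡ a (suc y) (suc x)))))
  (∑-kd (suc n) (λ y → g (suc a) (suc y)) (ℕₚ.≤-trans (ℕₚ.m≤m*n (suc x) (suc a)) (ℕₚ.≤-reflexive (sym eq)))))
... | no ¬a∣n = sym (∑-zero (suc n) (λ x _ → trans (cong (g (suc a) (suc x) ℚ.*_)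
    (kd-≢ (λ eq → ¬a∣n (divides (suc x) (trans (sym eq) (ℕₚ.*-comm (suc a) (suc x))))))) (ℚₚ.*-zeroʳ (g (suc a) (suc x)))))

divSum-Lam : ∀ n g → divSum (suc n) g ≡ Lam g (suc n)
divSum-Lam n g = trans (sumTo-∑ (suc n) (divTerm (suc n) g)) (trans (ℚₚ.+-identityˡ _) (∑-cong′ (suc n) (divTerm-∑ n g)))

divisible : Tri → Bool
divisible r₀ = true
divisible r₁ = false
divisible r₂ = false

does-3∣ : ∀ n → does (3 ∣? n) ≡ divisible (res n)
does-3∣ zero                = refl
does-3∣ (suc zero)          = refl
does-3∣ (suc (suc zero))    = refl
does-3∣ (suc (suc (suc n))) = trans (does-3∣ n) (cong divisible (sym (next³ (res n))))

χ₃-sgn : ∀ n → χ₃ n ≡ fromℤ (sgn (res n))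
χ₃-sgn zero    = refl
χ₃-sgn (suc n) = trans (cong₂ (λ b c → if b then 0ℚ else (if c then 1ℚ else ℚ.- 1ℚ)) (does-3∣ (suc n)) (does-3∣ n)) (table (res n))
  where
  table : ∀ r → (if divisible (next r) then 0ℚ else (if divisible r then 1ℚ else ℚ.- 1ℚ)) ≡ fromℤ (sgn (next r))
  table r₀ = refl
  table r₁ = refl
  table r₂ = refl

d⁴-ι : ∀ d → d⁴ d ≡ ι d ℚ.* ι d ℚ.* ι d ℚ.* ι d
d⁴-ι d = trans (ι-* d (d ℕ.* (d ℕ.* (d ℕ.* 1)))) (trans (cong (ι d ℚ.*_)
    (trans (ι-* d (d ℕ.* (d ℕ.* 1))) (cong (ι d ℚ.*_) (trans (ι-* d (d ℕ.* 1)) (cong (λ z → ι d ℚ.* ι z) (ℕₚ.*-identityʳ d))))))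
  (solve 1 (λ d → d :* (d :* (d :* d)) := d :* d :* d :* d) refl (ι d)))
  where open ℚ-Solver

χd⁴ : ∀ d e → χ₃ e ℚ.* d⁴ d ≡ ι d ℚ.* ι d ℚ.* ι d ℚ.* ι d ℚ.* fromℤ (sgn (res e))
χd⁴ d e = trans (cong₂ ℚ._*_ (χ₃-sgn e) (d⁴-ι d)) (ℚₚ.*-comm (fromℤ (sgn (res e))) (ι d ℚ.* ι d ℚ.* ι d ℚ.* ι d))

E5χ₃χ₀≈ : E5χ₃χ₀ ≈ ⟪ x⁴χ ⟫₁
E5χ₃χ₀≈ = ⟪ (λ { zero → refl ; (suc n) → trans (divSum-Lam n (λ d e → χ₃ e ℚ.* d⁴ d)) (Lam-cong (suc n) χd⁴) }) ⟫

C₀≈ : C₀ ≈ 1# + K (+ 3) * ⟪ a⁴χ ⟫₁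
C₀≈ = ⟪ (λ { zero → sym (affine-0 (+ 3) (ev₁ a⁴χ))
           ; (suc n) → sym (trans (+-at 1# (K (+ 3) * ⟪ a⁴χ ⟫₁) (suc n))
               (trans (cong₂ ℚ._+_ (1#-at (suc n)) (K-*-at (+ 3) ⟪ a⁴χ ⟫₁ (suc n))) (trans (ℚₚ.+-identityˡ _)
               (cong (ι 3 ℚ.*_) (sym (trans (divSum-Lam n (λ d e → χ₃ d ℚ.* d⁴ d)) (Lam-cong (suc n) (λ d e → χd⁴ d d)))))))) }) ⟫

C₀≈ZL : C₀ ≈ Z * L
C₀≈ZL = ≈-trans C₀≈ (≈-sym ZL≈)

-- Since uL = M, multiplication by u carries the product ZL to ZM.
uC₀ : u ⊛ C₀ ≈ E5χ₃χ₀
uC₀ = ≈-trans (⊛→* {u} ≈-refl C₀≈ZL) (≈-trans (solve 3 (λ v z l → v :* (z :* l) := z :* (v :* l)) ≈-refl u Z L)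
  (≈-trans (*-cong ≈-refl uL≈M) (≈-trans ZM≈ (≈-sym E5χ₃χ₀≈))))
  where open PS-Solver

1-27u : 𝟙 ⊖ ℕ→ℚ 27 · u ≈ 1# - K (+ 27) * u
1-27u = ⊖→- 𝟙→1# (·→* 27 ≈-refl)

eisenstein-combination : (𝟙 ⊖ ℕ→ℚ 27 · u) ⊛ C₀ ≈ ℕ→ℚ 3 · E5χ₀χ₃ ⊖ ℕ→ℚ 27 · E5χ₃χ₀
eisenstein-combination = ≈-trans (⊛→* 1-27u (≈-refl {C₀})) (≈-trans
  (solve 2 (λ v c → (# 1 :- # 27 :* v) :* c := c :- # 27 :* (v :* c)) ≈-refl u C₀)
  (≈-sym (⊖→- {C₀} ≈-refl (·→* 27 (≈-trans (≈-sym uC₀) (⊛→* {u} {g = C₀} ≈-refl ≈-refl))))))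
  where open PS-Solver

-- Omitting the multiples of 3 weights the n-th logarithmic derivative by one minus the indicator of
-- 3 | n; the total is that of the twelfth power of `E 1 / E 3`.
prodNot3-LogD : LogD prodNot3 (K (ℤ.- + 12) * S₁ + K (+ 12) * S₃)
prodNot3-LogD = LogD-cong ≈-refl ⟪ collect ⟫ (infProd-LogD {s = λ n → sₙ
    (res n) n} record { unit = unit ; logD = logD ; small = small })
  where
  Pₙ : Bool → ℕ → PS
  Pₙ b n = if b then 𝟙 else (𝟙 ⊖ qˢ ^ˢ n) ^ˢ 12
  sₙ : Tri → ℕ → PS
  sₙ r n = K (+ 12) * (K (+ 1 ℤ.- isZero r) * logq n)
  1^ : ∀ n → 1# ^ n ≈ 1#
  1^ zero    = ≈-refl
  1^ (suc n) = ≈-trans (*-identityˡ (1# ^ n)) (1^ n)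
  unit′ : ∀ n j → j ℕ.≤ n → ((𝟙 ⊖ qˢ ^ˢ suc n) ^ˢ 12) j ≡ 1# j
  unit′ n j j≤n = trans (at (^ˢ→^ 12 (1-q^-≈ (suc n))) j) (trans (go 12 j j≤n) (at (1^ 12) j))
    where
    go : ∀ k j → j ℕ.≤ n → ((1# - kd (suc n)) ^ k) j ≡ (1# ^ k) j
    go zero    j _   = refl
    go (suc k) j j≤n = *-cong-≤ (1# - kd (suc n)) 1# ((1# - kd (suc n)) ^ k) (1# ^ k) j
      (λ i i≤j → 1-kd-unit (s≤s (ℕₚ.≤-trans i≤j j≤n))) (λ i i≤j → go k i (ℕₚ.≤-trans i≤j j≤n))
  unit : ∀ n j → j ℕ.≤ n → Pₙ (does (3 ∣? suc n)) (suc n) j ≡ 1# j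
  unit n j j≤n with does (3 ∣? suc n)
  ... | true  = at 𝟙→1# j
  ... | false = unit′ n j j≤n
  logD′ : ∀ r n → LogD (Pₙ (divisible r) (suc n)) (sₙ r (suc n))
  logD′ r₀ n = LogD-cong (≈-sym 𝟙→1#) (solve 1 (λ l → # 0 := # 12 :* (# 0 :* l)) ≈-refl (logq (suc n))) LogD-1
    where open PS-Solver
  logD′ r₁ n = LogD-cong (≈-sym (^ˢ→^ 12 (1-q^-≈ (suc n)))) (*-cong ≈-refl (≈-sym (*-identityˡ (logq (suc n)))))
      (LogD-^ 12 (LogD-1-q^ n))
  logD′ r₂ n = LogD-cong (≈-sym (^ˢ→^ 12 (1-q^-≈ (suc n)))) (*-cong ≈-refl (≈-sym (*-identityˡ (logq (suc n)))))
      (LogD-^ 12 (LogD-1-q^ n))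
  logD : ∀ n → LogD (Pₙ (does (3 ∣? suc n)) (suc n)) (sₙ (res (suc n)) (suc n))
  logD n = subst (λ b → LogD (Pₙ b (suc n)) (sₙ (res (suc n)) (suc n))) (sym (does-3∣ (suc n))) (logD′ (res (suc n)) n)
  sₙ-at : ∀ r n j → sₙ r n j ≡ fromℤ (+ 12) ℚ.* (fromℤ (+ 1 ℤ.- isZero r) ℚ.* logq n j)
  sₙ-at r n j = trans (K-*-at (+ 12) (K (+ 1 ℤ.- isZero r) * logq n) j)
      (cong (fromℤ (+ 12) ℚ.*_) (K-*-at (+ 1 ℤ.- isZero r) (logq n) j))
  small : ∀ n j → j ℕ.≤ n → sₙ (res (suc n)) (suc n) j ≡ 0ℚ
  small n j j≤n = trans (sₙ-at (res (suc n)) (suc n) j) (trans (cong (λ z → fromℤ (+ 12) ℚ.*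
      (fromℤ (+ 1 ℤ.- isZero (res (suc n))) ℚ.* z)) (logq-small (suc n) (s≤s j≤n)))
    (trans (cong (fromℤ (+ 12) ℚ.*_) (ℚₚ.*-zeroʳ (fromℤ (+ 1 ℤ.- isZero (res (suc n)))))) (ℚₚ.*-zeroʳ (fromℤ (+ 12)))))
  term : ∀ j i → sₙ (res (suc i)) (suc i) j ≡
    fromℤ (ℤ.- + 12) ℚ.* ∑ j (λ x → ι (suc i) ℚ.* kd (suc i ℕ.* suc x) j) ℚ.+ fromℤ (+ 12) ℚ.* ∑ j
        (λ x → ι (suc i) ℚ.* zeroMod3 (suc i) ℚ.* kd (suc i ℕ.* suc x) j)
  term j i = begin
    sₙ (res (suc i)) (suc i) j
      ≡⟨ sₙ-at (res (suc i)) (suc i) j ⟩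
    fromℤ (+ 12) ℚ.* (fromℤ (+ 1 ℤ.- isZero (res (suc i))) ℚ.* logq (suc i) j)
      ≡⟨ cong₂ (λ a b → fromℤ (+ 12) ℚ.* (a ℚ.* b)) (trans (fromℤ-+ (+ 1) (ℤ.- isZero (res (suc i))))
          (cong (1ℚ ℚ.+_) (fromℤ-neg (isZero (res (suc i)))))) (logq-at (suc i) j) ⟩
    fromℤ (+ 12) ℚ.* ((1ℚ ℚ.- zeroMod3 (suc i)) ℚ.* ℚ.- (ι (suc i) ℚ.* D (suc i) j))
      ≡⟨ solve 3 (λ z i d → # 12 :* ((# 1 :- z) :* :- (i :* d)) := con (ℤ.- + 12) :* (i :* d) :+ # 12 :* (i :* z :* d)) refl
          (zeroMod3 (suc i)) (ι (suc i)) (D (suc i) j) ⟩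
    fromℤ (ℤ.- + 12) ℚ.* (ι (suc i) ℚ.* D (suc i) j) ℚ.+ fromℤ (+ 12) ℚ.* (ι (suc i) ℚ.* zeroMod3 (suc i) ℚ.* D (suc i) j)
      ≡⟨ cong₂ (λ a b → fromℤ (ℤ.- + 12) ℚ.* a ℚ.+ fromℤ (+ 12) ℚ.* b) (expand (ι (suc i)))
          (expand (ι (suc i) ℚ.* zeroMod3 (suc i))) ⟩
    _ ∎
    where
    open ≡-Reasoning
    open ℚ-Solver using (solve; _:=_; _:*_; _:+_; _:-_; :-_; con; #_)
    expand : ∀ c → c ℚ.* D (suc i) j ≡ ∑ j (λ x → c ℚ.* kd (suc i ℕ.* suc x) j)
    expand c = trans (sym (∑-*ˡ j c (λ x → kd (suc x ℕ.* suc i) j))) (∑-cong′ j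
        (λ x → cong (λ z → c ℚ.* kd z j) (ℕₚ.*-comm (suc x) (suc i))))
  collect : ∀ j → ∑ j (λ i → sₙ (res (suc i)) (suc i) j) ≡ (K (ℤ.- + 12) * S₁ + K (+ 12) * S₃) j
  collect j = trans (∑-cong′ j (term j)) (trans (∑-+ j _ _) (trans (cong₂ ℚ._+_ (∑-*ˡ j (fromℤ (ℤ.- + 12)) _)
      (∑-*ˡ j (fromℤ (+ 12)) _))
    (sym (trans (+-at (K (ℤ.- + 12) * S₁) (K (+ 12) * S₃) j) (cong₂ ℚ._+_ (K-*-at (ℤ.- + 12) S₁ j) (K-*-at (+ 12) S₃ j))))))

prodNot3≈ : prodNot3 ≈ 𝕖 ^ 12 * 𝕛 ^ 12
prodNot3≈ = LogD-unique (combination-0 (ℤ.- + 12) (+ 12)) prodNot3-LogD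
  (LogD-cong ≈-refl (solve 2 (λ 𝕤 r → # 12 :* (:- 𝕤) :+ # 12 :* r := con (ℤ.- + 12) :* 𝕤 :+ # 12 :* r) ≈-refl S₁ S₃)
      (LogD-* (LogD-^ 12 LogD-E₁) (LogD-^ 12 LogD-𝕛)))
  (sym (*-0-cong (𝕖 ^ 12) (𝕛 ^ 12) (^-0 𝕖 12 refl) (^-0 𝕛 12 refl)))
  where open PS-Solver

Hmix≈ : Hmix ≈ prodNot3 ⊛ onePlus27u ^ˢ 2
Hmix≈ = ≈-trans (≈-sym (≈inv refl T*)) (≈-sym (⊛→* prodNot3≈ (^ˢ→^ 2 w≈)))
  where
  open PS-Solver
  T≈ : tOverQ ≈ 𝕗 ^ 12 * 𝕚 ^ 12 * (𝕤 * 𝕤)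
  T≈ = kd1-cancel (≈-trans (≈-sym t≈shift) (≈-trans t≈ (≈-trans (*-cong u≈ ≈-refl) (*-assoc (kd 1) (𝕗 ^ 12 * 𝕚 ^ 12) (𝕤 * 𝕤)))))
  T* : tOverQ * (𝕖 ^ 12 * 𝕛 ^ 12 * 𝕨 ^ 2) ≈ 1#
  T* = ≈-trans (*-cong T≈ ≈-refl) (use (𝕖 ^ 12 * 𝕚 ^ 12 * (𝕤 * 𝕤) * (𝕨 * 𝕨)) (^-inverse 𝕗𝕛 12)
      (use ((𝕤 * 𝕤) * (𝕨 * 𝕨)) (^-inverse 𝕖𝕚 12) (use (𝕨 * 𝕤 + 1#) ws
    (solve 6 (λ f i e j 𝕤 𝕨 → f :* i :* (𝕤 :* 𝕤) :* (e :* j :* (𝕨 :* (𝕨 :* # 1)))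
      := # 1 :+ e :* i :* (𝕤 :* 𝕤) :* (𝕨 :* 𝕨) :* (f :* j :- # 1) :+ (𝕤 :* 𝕤) :* (𝕨 :* 𝕨) :* (e :* i :- # 1) :+
          (𝕨 :* 𝕤 :+ # 1) :* (𝕨 :* 𝕤 :- # 1))
    ≈-refl (𝕗 ^ 12) (𝕚 ^ 12) (𝕖 ^ 12) (𝕛 ^ 12) 𝕤 𝕨))))

A^3 : A ^ 3 ≈ A * A * A
A^3 = solve 1 (λ a → a :* (a :* (a :* # 1)) := a :* a :* a) ≈-refl A
  where open PS-Solver

-- The statements about the lattice sum are derived from its equality with the Lambert series, which
-- is established last by counting.
module _ (𝒜≈A : 𝒜 ≈ A) where

  𝒜³ : 𝒜 ^ˢ 3 ≈ A * A * A
  𝒜³ = ≈-trans (^ˢ→^ 3 𝒜≈A) A^3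

  borwein : 𝒜 ^ˢ 3 ≈ ℬ ^ˢ 3 ⊕ 𝒟³
  borwein = ≈-trans 𝒜³ (≈-trans A³≈ (≈-sym (⊕→+ ℬ³ 𝒟³≈)))
    where
    open PS-Solver
    cube : ∀ f → f ^ 9 ≈ f ^ 3 * f ^ 3 * f ^ 3
    cube f = ≈-trans (^-homo-* f 6 3) (*-cong (^-homo-* f 3 3) ≈-refl)
    ℬ³ : ℬ ^ˢ 3 ≈ L
    ℬ³ = ≈-trans (^ˢ→^ 3 (⊛→* {g = 𝕛} (^ˢ→^ 3 {𝕖} ≈-refl) ≈-refl)) (≈-trans
      (solve 2 (λ e j → e :* j :* (e :* j :* (e :* j :* # 1)) := e :* e :* e :* (j :* (j :* (j :* # 1)))) ≈-refl (𝕖 ^ 3) 𝕛)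
      (≈-trans (*-cong (≈-sym (cube 𝕖)) ≈-refl) (≈-sym L≈η)))
    𝒟³≈ : 𝒟³ ≈ K (+ 27) * M
    𝒟³≈ = ≈-trans (shift-≈ (𝒟₀ ^ˢ 3)) (≈-trans (*-cong ≈-refl (^ˢ→^ 3 (·→* 3 (⊛→* {g = 𝕚} (^ˢ→^ 3 {𝕗} ≈-refl) ≈-refl)))) (≈-trans
      (solve 3 (λ k f i → k :* (# 3 :* (f :* i) :* (# 3 :* (f :* i) :* (# 3 :* (f :* i) :* # 1))) := # 27 :*
          (k :* (f :* f :* f :* (i :* (i :* (i :* # 1)))))) ≈-refl (kd 1) (𝕗 ^ 3) 𝕚)
      (*-cong ≈-refl (≈-trans (*-cong ≈-refl (*-cong (≈-sym (cube 𝕗)) ≈-refl)) (≈-sym M≈η)))))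

  𝒜³-η : 𝒜 ^ˢ 3 ≈ onePlus27u ⊛ η9/η3³
  𝒜³-η = ≈-trans 𝒜³ (≈-trans A³≈wL (≈-sym (⊛→* w≈ (≈-trans (⊛→* {g = inv (𝕗 ^ˢ 3)} (^ˢ→^ 9 {𝕖} ≈-refl) (inv-^ˢ 𝕗 3 refl))
      (≈-sym L≈η)))))

-- A³ = (1 + 27u)L meets δt/t = Z(1 - 27u)/(1 + 27u); the denominators cancel and ZL = C₀.
Cmix≈ : Fmix ≈ A * A * A → Cmix ≈ (𝟙 ⊖ ℕ→ℚ 27 · u) ⊛ C₀
Cmix≈ F≈ = ≈-trans (⊛→* {g = deriv t} (⊛→* {g = Hmix} F≈ ≈-refl) ≈-refl)
    (≈-trans (*-assoc (A * A * A) Hmix (deriv t)) (≈-trans (*-cong A³≈wL H*deriv-t)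
  (≈-trans (use (K (+ 2) * Z * L) ws (solve 4 (λ v 𝕤 z l → let 𝕨 = # 1 :+ # 27 :* v in
      𝕨 :* l :* (z :* (# 2 :* 𝕤 :- # 1)) := (# 1 :- # 27 :* v) :* (z :* l) :+ # 2 :* z :* l :* (𝕨 :* 𝕤 :- # 1)) ≈-refl u 𝕤 Z L))
    (≈-sym (⊛→* 1-27u C₀≈ZL)))))
  where open PS-Solver

-- The hypergeometric equation

ι-reciprocal : ∀ n → ι (suc n) ℚ.* (+ 1 / suc n) ≡ 1ℚ
ι-reciprocal n = ℚₚ.toℚᵘ-injective (begin
  ℚ.toℚᵘ (ι (suc n) ℚ.* (+ 1 / suc n))              ≈⟨ ℚₚ.toℚᵘ-homo-* (ι (suc n)) (+ 1 / suc n) ⟩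
  ℚ.toℚᵘ (ι (suc n)) ℚᵘ.* ℚ.toℚᵘ (+ 1 / suc n)      ≈⟨ ℚᵘₚ.*-cong (toℚᵘ-fromℤ (+ suc n)) (ℚₚ.toℚᵘ-fromℚᵘ (mkℚᵘ (+ 1) n)) ⟩
  mkℚᵘ (+ suc n) 0 ℚᵘ.* mkℚᵘ (+ 1) n                ≈⟨ *≡* (trans (ℤₚ.*-identityʳ (+ suc n ℤ.* + 1))
      (trans (ℤₚ.*-comm (+ suc n) (+ 1)) (cong (λ z → + 1 ℤ.* + suc z) (sym (ℕₚ.+-identityʳ n))))) ⟩
  mkℚᵘ (+ 1) 0                                      ∎)
  where open ℚᵘₚ.≃-Reasoning

gauss : PS
gauss = ₂F₁-c1 (+ 1 / 6) (+ 1 / 3)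

-- The Euler operator of the hypergeometric variable, kept apart from δ, which belongs to q.
θ : PS → PS
θ g k = ι k ℚ.* g k

-- The factor 18 = 6 · 3 clears the parameters 1/6 and 1/3: (6k + 1)(3k + 1) = 18k² + 9k + 1.
gauss-suc : ∀ k → fromℤ (+ 18) ℚ.* (ι (suc k) ℚ.* (ι (suc k) ℚ.* gauss (suc k))) ≡ fromℤ (+ 18) ℚ.*
    (ι k ℚ.* (ι k ℚ.* gauss k)) ℚ.+ fromℤ (+ 9) ℚ.* (ι k ℚ.* gauss k) ℚ.+ gauss k
gauss-suc k = begin
  fromℤ (+ 18) ℚ.* (n ℚ.* (n ℚ.* (pa ℚ.* (a ℚ.+ ι k) ℚ.* (pb ℚ.* (b ℚ.+ ι k)) ℚ.* (f² ℚ.* r))))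
    ≡⟨ solve 8 (λ n pa pb v r a b k → # 18 :* (n :* (n :* (pa :* (a :+ k) :* (pb :* (b :+ k)) :* (v :* r))))
         := (n :* n :* r) :* (# 6 :* a :+ # 6 :* k) :* (# 3 :* b :+ # 3 :* k) :* (pa :* pb :* v)) refl n pa pb f² r a b (ι k) ⟩
  (n ℚ.* n ℚ.* r) ℚ.* (fromℤ (+ 6) ℚ.* a ℚ.+ fromℤ (+ 6) ℚ.* ι k) ℚ.* (fromℤ (+ 3) ℚ.* b ℚ.+ fromℤ (+ 3) ℚ.* ι k) ℚ.* gauss k
    ≡⟨ cong (λ z → z ℚ.* (1ℚ ℚ.+ fromℤ (+ 6) ℚ.* ι k) ℚ.* (1ℚ ℚ.+ fromℤ (+ 3) ℚ.* ι k) ℚ.* gauss k)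
         (trans (cong (ℚ._* r) (sym (ι-* (suc k) (suc k)))) (ι-reciprocal (k ℕ.+ k ℕ.* suc k))) ⟩
  1ℚ ℚ.* (1ℚ ℚ.+ fromℤ (+ 6) ℚ.* ι k) ℚ.* (1ℚ ℚ.+ fromℤ (+ 3) ℚ.* ι k) ℚ.* gauss k
    ≡⟨ solve 2 (λ k gauss → # 1 :* (# 1 :+ # 6 :* k) :* (# 1 :+ # 3 :* k) :* gauss := # 18 :* (k :* (k :* gauss)) :+ # 9 :*
        (k :* gauss) :+ gauss) refl (ι k) (gauss k) ⟩
  fromℤ (+ 18) ℚ.* (ι k ℚ.* (ι k ℚ.* gauss k)) ℚ.+ fromℤ (+ 9) ℚ.* (ι k ℚ.* gauss k) ℚ.+ gauss k ∎
  where
  open ≡-Reasoning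
  open ℚ-Solver using (solve; _:=_; _:+_; _:*_; #_)
  a b n pa pb f² r : ℚ
  a = + 1 / 6
  b = + 1 / 3
  n = ι (suc k)
  pa = pochhammer a k
  pb = pochhammer b k
  f² = invFact² k
  r = + 1 / (suc k ℕ.* suc k)

𝕪 : PS
𝕪 = ℕ→ℚ 108 · t

𝕪≈ : 𝕪 ≈ K (+ 108) * t
𝕪≈ = ·→* 108 ≈-refl

LogD-𝕪 : LogD 𝕪 Wₜ
LogD-𝕪 = LogD-cong (≈-sym 𝕪≈) ≈-refl (≈-trans (δ-K* (+ 108) t) (≈-trans (*-cong ≈-refl δt) (≈-sym (*-assoc (K (+ 108)) t Wₜ))))

𝕪^-small : ∀ k n → n ℕ.< k → (𝕪 ^ k) n ≡ 0ℚ
𝕪^-small (suc k) zero    _         = trans (*-0 𝕪 (𝕪 ^ k)) (ℚₚ.*-zeroˡ ((𝕪 ^ k) 0))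
𝕪^-small (suc k) (suc n) (s≤s n<k) = trans (*-suc 𝕪 (𝕪 ^ k) n) (trans (cong₂ ℚ._+_ (ℚₚ.*-zeroˡ ((𝕪 ^ k) (suc n)))
    (*-vanishes n (λ j j≤n → 𝕪^-small k j (ℕₚ.≤-<-trans j≤n n<k)))) (ℚₚ.+-identityˡ 0ℚ))

∘𝕪 : PS → PS
∘𝕪 g = compose g 𝕪

-- The k-th power of `𝕪` starts at q^k or later, so every cut beyond n gives the same coefficient. A
-- common cut is what makes products of composites manageable.
∘𝕪-at : ∀ g {n m} → n ℕ.< m → ∘𝕪 g n ≡ ∑ m (λ k → g k ℚ.* (𝕪 ^ k) n)
∘𝕪-at g {n} {m} n<m = trans (sumTo-∑ n (λ k → g k ℚ.* (𝕪 ^ˢ k) n)) (trans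
    (∑-cong′ (suc n) (λ k → cong (g k ℚ.*_) (at (^ˢ→^ k (≈-refl {𝕪})) n)))
  (sym (∑-extend (λ k → g k ℚ.* (𝕪 ^ k) n) n<m (λ k n<k → trans (cong (g k ℚ.*_) (𝕪^-small k n n<k)) (ℚₚ.*-zeroʳ (g k))))))

∘𝕪-diag : ∀ g n → ∘𝕪 g n ≡ ∑ (suc n) (λ k → g k ℚ.* (𝕪 ^ k) n)
∘𝕪-diag g n = ∘𝕪-at g ℕₚ.≤-refl

∘𝕪-* : ∀ g h n → (∘𝕪 g * h) n ≡ ∑ (suc n) (λ k → g k ℚ.* (𝕪 ^ k * h) n)
∘𝕪-* g h n = trans (*-cong-≤ (∘𝕪 g) (λ i → ∑ (suc n) (λ k → g k ℚ.* (𝕪 ^ k) i)) h h n (λ k k≤n → ∘𝕪-at g (s≤s k≤n)) (λ _ _ → refl))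
  (trans (∑-* (suc n) (λ k i → g k ℚ.* (𝕪 ^ k) i) h n) (∑-cong′ (suc n) (λ k → scale-* (g k) (𝕪 ^ k) h n)))

-- The chain rule, with δ𝕪 / 𝕪 = `Wₜ`.
δ-∘𝕪 : ∀ g → δ (∘𝕪 g) ≈ ∘𝕪 (θ g) * Wₜ
δ-∘𝕪 g = ⟪ (λ n → trans (δ-at (∘𝕪 g) n) (trans (cong (ι n ℚ.*_) (∘𝕪-diag g n))
    (trans (sym (∑-*ˡ (suc n) (ι n) (λ k → g k ℚ.* (𝕪 ^ k) n))) (trans (∑-cong′ (suc n) (λ k → term n k))
    (sym (∘𝕪-* (θ g) Wₜ n)))))) ⟫
  where
  open ℚ-Solver using (solve; _:=_; _:*_)
  term : ∀ n k → ι n ℚ.* (g k ℚ.* (𝕪 ^ k) n) ≡ θ g k ℚ.* (𝕪 ^ k * Wₜ) n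
  term n k = begin
    ι n ℚ.* (g k ℚ.* (𝕪 ^ k) n)       ≡⟨ solve 3 (λ i g z → i :* (g :* z) := g :* (i :* z)) refl (ι n) (g k) ((𝕪 ^ k) n) ⟩
    g k ℚ.* (ι n ℚ.* (𝕪 ^ k) n)       ≡⟨ cong (g k ℚ.*_) (trans (sym (δ-at (𝕪 ^ k) n))
        (trans (at logD n) (K-*-at (+ k) (𝕪 ^ k * Wₜ) n))) ⟩
    g k ℚ.* (ι k ℚ.* (𝕪 ^ k * Wₜ) n)  ≡⟨ solve 3 (λ i g z → g :* (i :* z) := i :* g :* z) refl (ι k) (g k) ((𝕪 ^ k * Wₜ) n) ⟩
    θ g k ℚ.* (𝕪 ^ k * Wₜ) n          ∎
    where
    open ≡-Reasoning
    logD : δ (𝕪 ^ k) ≈ K (+ k) * (𝕪 ^ k * Wₜ)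
    logD = ≈-trans (LogD-^ k LogD-𝕪) (PS-Solver.solve 3 (λ z k 𝕨 → z PS-Solver.:* (k PS-Solver.:* 𝕨) PS-Solver.:= k PS-Solver.:*
        (z PS-Solver.:* 𝕨)) ≈-refl (𝕪 ^ k) (K (+ k)) Wₜ)

∘𝕪-shift : ∀ g → ∘𝕪 (shift g) ≈ 𝕪 * ∘𝕪 g
∘𝕪-shift g = ⟪ (λ n → trans (∘𝕪-at (shift g) (ℕₚ.m≤n⇒m≤1+n ℕₚ.≤-refl))
    (trans (cong₂ ℚ._+_ (ℚₚ.*-zeroˡ ((𝕪 ^ 0) n)) (∑-cong′ (suc n) (λ k → cong (g k ℚ.*_) (at (*-comm 𝕪 (𝕪 ^ k)) n))))
  (trans (ℚₚ.+-identityˡ _) (trans (sym (∘𝕪-* g 𝕪 n)) (at (*-comm (∘𝕪 g) 𝕪) n))))) ⟫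

∘𝕪-cong : ∀ {g h} → (∀ k → g k ≡ h k) → ∘𝕪 g ≈ ∘𝕪 h
∘𝕪-cong {g} {h} p = ⟪ (λ n → trans (∘𝕪-diag g n) (trans (∑-cong′ (suc n) (λ k → cong (ℚ._* (𝕪 ^ k) n) (p k)))
    (sym (∘𝕪-diag h n)))) ⟫

∘𝕪-+ : ∀ g h → ∘𝕪 (λ k → g k ℚ.+ h k) ≈ ∘𝕪 g + ∘𝕪 h
∘𝕪-+ g h = ⟪ (λ n → trans (∘𝕪-diag (λ k → g k ℚ.+ h k) n) (trans (∑-cong′ (suc n)
    (λ k → ℚₚ.*-distribʳ-+ ((𝕪 ^ k) n) (g k) (h k))) (trans (∑-+ (suc n) (λ k → g k ℚ.* (𝕪 ^ k) n) (λ k → h k ℚ.* (𝕪 ^ k) n))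
  (trans (sym (cong₂ ℚ._+_ (∘𝕪-diag g n) (∘𝕪-diag h n))) (sym (+-at (∘𝕪 g) (∘𝕪 h) n)))))) ⟫

∘𝕪-scale : ∀ i g → ∘𝕪 (λ k → fromℤ i ℚ.* g k) ≈ K i * ∘𝕪 g
∘𝕪-scale i g = ⟪ (λ n → trans (∘𝕪-diag (λ k → fromℤ i ℚ.* g k) n) (trans
    (∑-cong′ (suc n) (λ k → ℚₚ.*-assoc (fromℤ i) (g k) ((𝕪 ^ k) n))) (trans (∑-*ˡ (suc n) (fromℤ i) (λ k → g k ℚ.* (𝕪 ^ k) n))
  (trans (cong (fromℤ i ℚ.*_) (sym (∘𝕪-diag g n))) (sym (K-*-at i (∘𝕪 g) n)))))) ⟫

F₀ F₁ F₂ : PS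
F₀ = ∘𝕪 gauss
F₁ = ∘𝕪 (θ gauss)
F₂ = ∘𝕪 (θ (θ gauss))

-- Gauss's equation: the coefficient recurrence says that 18θ² applied to `gauss` is a shift, and a
-- shift in the hypergeometric variable becomes multiplication by `𝕪`.
hypergeometric-ODE : K (+ 18) * F₂ ≈ 𝕪 * (K (+ 18) * F₂ + K (+ 9) * F₁ + F₀)
hypergeometric-ODE = ≈-trans (≈-sym (∘𝕪-scale (+ 18) (θ (θ gauss)))) (≈-trans (∘𝕪-cong recurrence) (≈-trans (∘𝕪-shift rhs)
  (*-cong ≈-refl (≈-trans (∘𝕪-+ (λ k → fromℤ (+ 18) ℚ.* θ (θ gauss) k ℚ.+ fromℤ (+ 9) ℚ.* θ gauss k) gauss)
      (+-cong (≈-trans (∘𝕪-+ (λ k → fromℤ (+ 18) ℚ.* θ (θ gauss) k) (λ k → fromℤ (+ 9) ℚ.* θ gauss k))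
    (+-cong (∘𝕪-scale (+ 18) (θ (θ gauss))) (∘𝕪-scale (+ 9) (θ gauss)))) ≈-refl)))))
  where
  rhs : PS
  rhs k = fromℤ (+ 18) ℚ.* θ (θ gauss) k ℚ.+ fromℤ (+ 9) ℚ.* θ gauss k ℚ.+ gauss k
  recurrence : ∀ k → fromℤ (+ 18) ℚ.* θ (θ gauss) k ≡ shift rhs k
  recurrence zero    = refl
  recurrence (suc k) = gauss-suc k

A⁵ : PS
A⁵ = A * A * (A * A) * A

-- In terms of q, the hypergeometric equation at 108 t reads 18 (A δ²h - 2 δA δh) = 108 t A⁵ h.
Solution : PS → Set
Solution h = K (+ 18) * (A * δ (δ h) - K (+ 2) * (δ A * δ h)) ≈ 𝕪 * A⁵ * h

-- By `rankin-cohen` the left side is 108LM. On the right A⁶ = (1 + 27u)²L² cancels the denominator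
-- of t, leaving 108uL² = 108LM.
A-solution : Solution A
A-solution = ≈-trans (*-cong ≈-refl rankin-cohen) (≈-sym (≈-trans (*-cong (*-cong (≈-trans 𝕪≈ (*-cong ≈-refl t≈)) ≈-refl) ≈-refl)
  (use (K (+ 108) * (u * (𝕤 * 𝕤)) * (A * A * A + 𝕨 * L)) A³≈wL (use (K (+ 108) * u * (L * L) * (𝕨 * 𝕤 + 1#)) ws
      (use (K (+ 108) * L) uL≈M
    (solve 5 (λ a v 𝕤 l m → let 𝕨 = # 1 :+ # 27 :* v in
      # 108 :* (v :* (𝕤 :* 𝕤)) :* (a :* a :* (a :* a) :* a) :* a
      := # 18 :* (# 6 :* (l :* m))
       :+ # 108 :* (v :* (𝕤 :* 𝕤)) :* (a :* a :* a :+ 𝕨 :* l) :* (a :* a :* a :- 𝕨 :* l)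
       :+ # 108 :* v :* (l :* l) :* (𝕨 :* 𝕤 :+ # 1) :* (𝕨 :* 𝕤 :- # 1)
       :+ # 108 :* l :* (v :* l :- m)) ≈-refl A u 𝕤 L M))))))
  where open PS-Solver

-- Write `Wₜ` = A²V with V = 2𝕤 - 1. The term -2 δA δh is what cancels δA here, V² = 1 - 𝕪 handles
-- the coefficient of `F₂`, and δV = -𝕪A²/2 that of `F₁`; the rest is A⁵ times Gauss's equation.
F₀-solution : Solution F₀
F₀-solution = ≈-trans
  (*-cong ≈-refl (+-cong (*-cong ≈-refl (≈-trans δδF₀ (+-cong (*-cong (*-cong ≈-refl W≈) W≈) (*-cong ≈-refl δWₜ))))
      (-‿cong (*-cong ≈-refl (*-cong ≈-refl (≈-trans (δ-∘𝕪 gauss) (*-cong ≈-refl W≈)))))))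
  (use A⁵ hypergeometric-ODE (use (A⁵ * (K (+ 9) * F₁ + K (+ 18) * F₂)) (≈-trans 𝕪≈ (*-cong ≈-refl t≈))
      (use (K (+ 72) * (A⁵ * F₂ * 𝕤)) ws
    (solve 8 (λ a x v 𝕤 f₀ f₁ f₂ 𝕪 → let a⁵ = a :* a :* (a :* a) :* a
                                         ω = # 1 :+ # 27 :* v
                                         V = # 2 :* 𝕤 :- # 1
                                         W = a :* a :* V
                                         z = a :* a
                                         δW = # 2 :* a :* x :* V :+ z :* (# 2 :* :- (# 27 :* v :* z :* (𝕤 :* 𝕤))) in
      # 18 :* (a :* (f₂ :* W :* W :+ f₁ :* δW) :- # 2 :* (x :* (f₁ :* W)))
      := 𝕪 :* a⁵ :* f₀
       :+ a⁵ :* (# 18 :* f₂ :- 𝕪 :* (# 18 :* f₂ :+ # 9 :* f₁ :+ f₀))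
       :+ a⁵ :* (# 9 :* f₁ :+ # 18 :* f₂) :* (𝕪 :- # 108 :* (v :* (𝕤 :* 𝕤)))
       :+ # 72 :* (a⁵ :* f₂ :* 𝕤) :* (ω :* 𝕤 :- # 1))
     ≈-refl A (δ A) u 𝕤 F₀ F₁ F₂ 𝕪))))
  where
  open PS-Solver
  V : PS
  V = K (+ 2) * 𝕤 - 1#
  W≈ : Wₜ ≈ A * A * V
  W≈ = *-cong (≈-sym A²≈Z) ≈-refl
  δδF₀ : δ (δ F₀) ≈ F₂ * Wₜ * Wₜ + F₁ * δ Wₜ
  δδF₀ = ≈-trans (δ-cong (δ-∘𝕪 gauss)) (≈-trans (δ-* F₁ Wₜ) (+-cong (*-cong (δ-∘𝕪 (θ gauss)) ≈-refl) ≈-refl))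
  δV : δ V ≈ K (+ 2) * - (K (+ 27) * u * (A * A) * (𝕤 * 𝕤))
  δV = ≈-trans (δ-minus (K (+ 2) * 𝕤) 1#) (≈-trans (+-cong (δ-K* (+ 2) 𝕤) (-‿cong (δ-K (+ 1))))
      (≈-trans (solve 1 (λ x → x :- # 0 := x) ≈-refl (K (+ 2) * δ 𝕤))
    (*-cong ≈-refl (≈-trans δs (-‿cong (*-cong (*-cong ≈-refl (≈-sym A²≈Z)) ≈-refl))))))
  δWₜ : δ Wₜ ≈ K (+ 2) * A * δ A * V + A * A * (K (+ 2) * - (K (+ 27) * u * (A * A) * (𝕤 * 𝕤)))
  δWₜ = ≈-trans (δ-* Z V) (+-cong (*-cong δA² ≈-refl) (*-cong (≈-sym A²≈Z) δV))

*-leading : ∀ f h n → (∀ k → k ℕ.≤ n → h k ≡ 0ℚ) → (f * h) (suc n) ≡ f 0 ℚ.* h (suc n)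
*-leading f h n h0 = trans (*-suc f h n) (trans (cong (f 0 ℚ.* h (suc n) ℚ.+_) (*-vanishes n h0))
    (ℚₚ.+-identityʳ (f 0 ℚ.* h (suc n))))

solution-minus : ∀ {f g} → Solution f → Solution g → Solution (f - g)
solution-minus {f} {g} sf sg = ≈-trans
  (*-cong ≈-refl (+-cong (*-cong ≈-refl (≈-trans (δ-cong (δ-minus f g)) (δ-minus (δ f) (δ g))))
      (-‿cong (*-cong ≈-refl (*-cong ≈-refl (δ-minus f g))))))
  (use 1# sf (use (- 1#) sg (solve 9 (λ a x f f′ f″ g g′ g″ r →
      # 18 :* (a :* (f″ :- g″) :- # 2 :* (x :* (f′ :- g′)))
      := r :* (f :- g)
       :+ # 1 :* (# 18 :* (a :* f″ :- # 2 :* (x :* f′)) :- r :* f)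
       :+ (:- # 1) :* (# 18 :* (a :* g″ :- # 2 :* (x :* g′)) :- r :* g))
    ≈-refl A (δ A) f (δ f) (δ (δ f)) g (δ g) (δ (δ g)) (𝕪 * A⁵))))
  where open PS-Solver

-- If the difference h vanishes below N, the equation at q^N reads 18N²h_N = 0, because `A` starts
-- with 1 while δA and `𝕪` have no constant term. The indicial root 0 is double, so one initial
-- value suffices.
solution-unique : ∀ {f g} → Solution f → Solution g → f 0 ≡ g 0 → f ≈ g
solution-unique {f} {g} sf sg f0≡g0 = -≈0 (strong-induction step)
  where
  h : PS
  h = f - g
  sh : Solution h
  sh = solution-minus sf sg
  δ-0 : ∀ (f : PS) k → f k ≡ 0ℚ → δ f k ≡ 0ℚ
  δ-0 f k fk = trans (δ-at f k) (trans (cong (ι k ℚ.*_) fk) (ℚₚ.*-zeroʳ (ι k)))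
  A0 : A 0 ≡ 1ℚ
  A0 = affine-0 (+ 6) (ev₁ aχ)
  step : ∀ n → (∀ k → k ℕ.< n → h k ≡ 0ℚ) → h n ≡ 0ℚ
  step zero    _  = trans (minus-at f g 0) (trans (cong (ℚ._- g 0) f0≡g0) (ℚₚ.+-inverseʳ (g 0)))
  step (suc n) ih = ℚ-cancelˡ (ι-suc≢0 n) (ℚ-cancelˡ (ι-suc≢0 n) (ℚ-cancelˡ (ι-suc≢0 17) (begin
    ι 18 ℚ.* (N ℚ.* (N ℚ.* h (suc n)))
      ≡⟨ solve 1 (λ x → # 18 :* x := # 18 :* (# 1 :* x :- # 2 :* # 0)) refl (N ℚ.* (N ℚ.* h (suc n))) ⟩
    ι 18 ℚ.* (1ℚ ℚ.* (N ℚ.* (N ℚ.* h (suc n))) ℚ.- ι 2 ℚ.* 0ℚ)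
      ≡⟨ cong₂ (λ a b → ι 18 ℚ.* (a ℚ.- ι 2 ℚ.* b)) lead₂ lead₁ ⟨
    ι 18 ℚ.* ((A * δ (δ h)) (suc n) ℚ.- ι 2 ℚ.* (δ A * δ h) (suc n))
      ≡⟨ trans (K-*-at (+ 18) (A * δ (δ h) - K (+ 2) * (δ A * δ h)) (suc n))
          (cong (ι 18 ℚ.*_) (trans (minus-at (A * δ (δ h)) (K (+ 2) * (δ A * δ h)) (suc n))
          (cong (λ z → (A * δ (δ h)) (suc n) ℚ.- z) (K-*-at (+ 2) (δ A * δ h) (suc n))))) ⟨
    (K (+ 18) * (A * δ (δ h) - K (+ 2) * (δ A * δ h))) (suc n)
      ≡⟨ at sh (suc n) ⟩
    (𝕪 * A⁵ * h) (suc n)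
      ≡⟨ *-leading (𝕪 * A⁵) h n h0 ⟩
    (𝕪 * A⁵) 0 ℚ.* h (suc n)
      ≡⟨ cong (ℚ._* h (suc n)) (trans (*-0 𝕪 A⁵) (ℚₚ.*-zeroˡ (A⁵ 0))) ⟩
    0ℚ ℚ.* h (suc n)
      ≡⟨ solve 2 (λ x n → # 0 :* x := # 18 :* (n :* (n :* # 0))) refl (h (suc n)) N ⟩
    ι 18 ℚ.* (N ℚ.* (N ℚ.* 0ℚ)) ∎)))
    where
    open ≡-Reasoning
    open ℚ-Solver using (solve; _:=_; _:*_; _:-_; #_)
    N : ℚ
    N = ι (suc n)
    h0 : ∀ k → k ℕ.≤ n → h k ≡ 0ℚ
    h0 k k≤n = ih k (s≤s k≤n)
    lead₂ : (A * δ (δ h)) (suc n) ≡ 1ℚ ℚ.* (N ℚ.* (N ℚ.* h (suc n)))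
    lead₂ = trans (*-leading A (δ (δ h)) n (λ k k≤n → δ-0 (δ h) k (δ-0 h k (h0 k k≤n))))
        (cong₂ ℚ._*_ A0 (trans (δ-at (δ h) (suc n)) (cong (N ℚ.*_) (δ-at h (suc n)))))
    lead₁ : (δ A * δ h) (suc n) ≡ 0ℚ
    lead₁ = trans (*-leading (δ A) (δ h) n (λ k k≤n → δ-0 h k (h0 k k≤n)))
        (trans (cong (ℚ._* δ h (suc n)) (trans (δ-at A 0) (ℚₚ.*-zeroˡ (A 0)))) (ℚₚ.*-zeroˡ (δ h (suc n))))

F₀≈A : F₀ ≈ A
F₀≈A = solution-unique F₀-solution A-solution (sym (affine-0 (+ 6) (ev₁ aχ)))

Fmix≈ : Fmix ≈ A * A * A
Fmix≈ = ≈-trans (^ˢ→^ 3 F₀≈A) A^3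

-- The pentagonal number theorem

sg : ℕ → ℤ
sg zero    = + 1
sg (suc n) = ℤ.- sg n

triangle : ℕ → ℕ
triangle zero    = 0
triangle (suc n) = suc n ℕ.+ triangle n

-- pent k = k(3k - 1)/2
pent : ℤ → ℕ
pent (+ zero)    = 0
pent (+ suc n)   = suc n ℕ.* suc n ℕ.+ triangle n
pent ℤ.-[1+ n ]  = suc n ℕ.* suc n ℕ.+ triangle (suc n)

ε : ℤ → ℚ
ε k = fromℤ (sg ℤ.∣ k ∣)

-- The product (1 - q^(s+1)) ⋯ (1 - q^(s+d)), a q-Pochhammer symbol.
R : ℕ → ℕ → PS
R s zero    = 1#
R s (suc d) = R s d * (1# - kd (suc (s ℕ.+ d)))

R-front : ∀ s d → R s (suc d) ≈ (1# - kd (suc s)) * R (suc s) d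
R-front s zero    = ≈-trans (*-identityˡ (1# - kd (suc (s ℕ.+ 0)))) (≈-trans ⟪
    (λ n → cong (λ z → (1# - kd (suc z)) n) (ℕₚ.+-identityʳ s)) ⟫ (≈-sym (*-identityʳ (1# - kd (suc s)))))
R-front s (suc d) = ≈-trans (*-cong (R-front s d) ⟪ (λ n → cong (λ z → (1# - kd (suc z)) n) (ℕₚ.+-suc s d)) ⟫)
    (*-assoc (1# - kd (suc s)) (R (suc s) d) (1# - kd (suc (suc s ℕ.+ d))))

partial : (ℕ → PS) → ℕ → PS
partial f zero    = f 0
partial f (suc m) = partial f m + f (suc m)

-- Summands of Shanks' finite form of the theorem: summed over 0 ≤ s ≤ n they give exactly the
-- pentagonal terms with |k| ≤ n.
shanks : ℕ → ℕ → PS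
shanks n s = K (sg s) * (R s (n ∸ s) * kd (s ℕ.* n ℕ.+ triangle s))

-- Shanks' telescoping; the subtracted term is what remains of the sum for N + 1 after step m.
shanks-step : ∀ N m d → N ≡ m ℕ.+ d →
  partial (shanks (suc N)) m ≈ partial (shanks N) m - K (sg m) * (R m d * kd (suc m ℕ.* suc N ℕ.+ triangle m))
shanks-step N zero d refl = ≈-trans (solve 3 (λ r z x → # 1 :* (r :* (# 1 :- z) :* x) := # 1 :* (r :* x) :- # 1 :*
    (r :* (z :* x))) ≈-refl (R 0 d) (kd (suc d)) (kd 0))
  (+-cong ≈-refl (-‿cong (*-cong ≈-refl (*-cong ≈-refl (≈-trans (kd-*-kd (suc d) 0) ⟪
      (λ n → cong (λ z → kd (z ℕ.+ 0) n) (sym (ℕₚ.*-identityˡ (suc d)))) ⟫)))))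
  where open PS-Solver
shanks-step N (suc m) d refl = ≈-trans (+-cong (shanks-step N m (suc d) (sym (ℕₚ.+-suc m d))) a₁≈)
  (≈-trans (+-cong (+-cong ≈-refl (-‿cong (*-cong (≈-refl {σ}) (*-cong (R-front m d) ≈-refl))))
      (≈-refl {K (ℤ.- sg m) * (r * (1# - z) * (x * y))}))
  (≈-trans (+-cong ≈-refl (*-cong (K-neg (sg m)) ≈-refl)) (≈-trans
   (solve 6 (λ f σ r x y z →
      (f :- σ :* ((# 1 :- y) :* r :* x)) :+ (:- σ) :* (r :* (# 1 :- z) :* (x :* y))
      := (f :+ (:- σ) :* (r :* x)) :- (:- σ) :* (r :* (z :* (x :* y)))) ≈-refl (partial (shanks N) m) σ r x y z)
   (+-cong (+-cong ≈-refl (≈-trans (*-cong (≈-sym (K-neg (sg m))) ≈-refl) (≈-sym a₀≈)))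
       (-‿cong (*-cong (≈-sym (K-neg (sg m))) (*-cong ≈-refl zxy≈)))))))
  where
  open PS-Solver
  σ r x y z : PS
  σ = K (sg m)
  r = R (suc m) d
  x = kd (suc m ℕ.* suc N ℕ.+ triangle m)
  y = kd (suc m)
  z = kd (suc N)
  open ≡-Reasoning
  kd-≡ : ∀ {i j} → i ≡ j → kd i ≈ kd j
  kd-≡ refl = ≈-refl
  xy≈ : kd (suc m ℕ.* suc N ℕ.+ triangle (suc m)) ≈ x * y
  xy≈ = ≈-sym (≈-trans (kd-*-kd (suc m ℕ.* suc N ℕ.+ triangle m) (suc m))
      (kd-≡ (trans (ℕₚ.+-assoc (suc m ℕ.* suc N) (triangle m) (suc m))
      (cong (suc m ℕ.* suc N ℕ.+_) (ℕₚ.+-comm (triangle m) (suc m))))))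
  zxy≈ : z * (x * y) ≈ kd (suc (suc m) ℕ.* suc N ℕ.+ triangle (suc m))
  zxy≈ = ≈-trans (*-cong ≈-refl (≈-sym xy≈)) (≈-trans (kd-*-kd (suc N) (suc m ℕ.* suc N ℕ.+ triangle (suc m)))
      (kd-≡ (sym (ℕₚ.+-assoc (suc N) (suc m ℕ.* suc N) (triangle (suc m))))))
  a₁≈ : shanks (suc N) (suc m) ≈ K (ℤ.- sg m) * (r * (1# - z) * (x * y))
  a₁≈ = *-cong ≈-refl (*-cong ⟪ (λ n → cong (λ e → R (suc m) e n) (trans (cong (ℕ._∸ m) (sym (ℕₚ.+-suc m d)))
      (ℕₚ.m+n∸m≡n m (suc d)))) ⟫ xy≈)
  a₀≈ : shanks N (suc m) ≈ K (ℤ.- sg m) * (r * x)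
  a₀≈ = *-cong ≈-refl (*-cong ⟪ (λ n → cong (λ e → R (suc m) e n) (ℕₚ.m+n∸m≡n m d)) ⟫ (kd-≡ (begin
    suc m ℕ.* N ℕ.+ (suc m ℕ.+ triangle m)   ≡⟨ ℕₚ.+-assoc (suc m ℕ.* N) (suc m) (triangle m) ⟨
    suc m ℕ.* N ℕ.+ suc m ℕ.+ triangle m     ≡⟨ cong (ℕ._+ triangle m)
        (trans (ℕₚ.+-comm (suc m ℕ.* N) (suc m)) (sym (ℕₚ.*-suc (suc m) N))) ⟩
    suc m ℕ.* suc N ℕ.+ triangle m           ∎)))

-- At m = N the remainder in `shanks-step` is the term of pent(N + 1), and the last new summand s =
-- N + 1 is the term of pent(-N - 1).
finite-pentagonal : ∀ N → partial (shanks (suc N)) (suc N) ≈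
  partial (shanks N) N + K (sg (suc N)) * (kd (pent (+ suc N)) + kd (pent ℤ.-[1+ N ]))
finite-pentagonal N = ≈-trans (+-cong (shanks-step N N 0 (sym (ℕₚ.+-identityʳ N)))
    (*-cong ≈-refl (*-cong ⟪ (λ n → cong (λ e → R (suc N) e n) (ℕₚ.n∸n≡0 N)) ⟫ ≈-refl)))
  (≈-trans (+-cong ≈-refl (*-cong (K-neg (sg N)) ≈-refl)) (≈-trans
    (solve 4 (λ f σ x y → (f :- σ :* (# 1 :* x)) :+ (:- σ) :* (# 1 :* y) := f :+ (:- σ) :* (x :+ y)) ≈-refl
        (partial (shanks N) N) (K (sg N)) (kd (pent (+ suc N))) (kd (pent ℤ.-[1+ N ])))
    (+-cong ≈-refl (*-cong (≈-sym (K-neg (sg N))) ≈-refl))))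
  where open PS-Solver

R-finProd : ∀ N → R 0 N ≈ finProd (λ n → 𝟙 ⊖ qˢ ^ˢ (1 ℕ.* n)) N
R-finProd zero    = ≈-sym 𝟙→1#
R-finProd (suc N) = ≈-sym (⊛→* (≈-sym (R-finProd N)) (≈-trans (1-q^-≈ (1 ℕ.* suc N)) ⟪
    (λ n → cong (λ z → (1# - kd z) n) (ℕₚ.*-identityˡ (suc N))) ⟫))

-- Summands with s ≥ 1 start beyond q^N; only s = 0, the finite Euler product itself, is visible up
-- to that order.
E₁-shanks : ∀ {N n} → n ℕ.≤ N → E 1 n ≡ partial (shanks N) N n
E₁-shanks {N} {n} n≤N = trans (sym (finProd-infProd unit n≤N)) (trans (sym (at (R-finProd N) n)) (sym (trans (go N) (at first n))))
  where
  unit : ∀ i k → k ℕ.≤ i → (𝟙 ⊖ qˢ ^ˢ (1 ℕ.* suc i)) k ≡ 1# k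
  unit i k k≤i = trans (at (1-q^-≈ (1 ℕ.* suc i)) k) (1-kd-unit (ℕₚ.<-≤-trans (s≤s k≤i) (ℕₚ.m≤n*m (suc i) 1)))
  first : shanks N 0 ≈ R 0 N
  first = ≈-trans (*-identityˡ (R 0 N * kd 0)) (≈-trans (*-cong ≈-refl ⟪ (λ n → sym (1#-at n)) ⟫) (*-identityʳ (R 0 N)))
  later : ∀ s → shanks N (suc s) n ≡ 0ℚ
  later s = trans (K-*-at (sg (suc s)) (R (suc s) (N ∸ suc s) * kd e) n) (trans (cong (fromℤ (sg (suc s)) ℚ.*_)
      (*-vanishes n (λ k k≤n → kd-> (ℕₚ.≤-<-trans (ℕₚ.≤-trans k≤n n≤N)
          (ℕₚ.≤-<-trans (ℕₚ.m≤m+n N (s ℕ.* N)) (ℕₚ.m<m+n (suc s ℕ.* N) (s≤s z≤n))))))) (ℚₚ.*-zeroʳ (fromℤ (sg (suc s)))))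
    where
    e : ℕ
    e = suc s ℕ.* N ℕ.+ triangle (suc s)
  go : ∀ m → partial (shanks N) m n ≡ shanks N 0 n
  go zero    = refl
  go (suc m) = trans (+-at (partial (shanks N) m) (shanks N (suc m)) n)
      (trans (cong₂ ℚ._+_ (go m) (later m)) (ℚₚ.+-identityʳ (shanks N 0 n)))

-- The interval from -N to N is indexed as in `intRange`, so counts over that list become such sums
-- term by term.
∑ᶻ : ℕ → (ℤ → ℚ) → ℚ
∑ᶻ N f = ∑ (suc (N ℕ.+ N)) (λ i → f (+ i ℤ.- + N))

∑ᶻ-suc : ∀ N f → ∑ᶻ (suc N) f ≡ f ℤ.-[1+ N ] ℚ.+ ∑ᶻ N f ℚ.+ f (+ suc N)
∑ᶻ-suc N f = trans (cong (f ℤ.-[1+ N ] ℚ.+_) (trans (cong (λ z → ∑ (suc z) g) (ℕₚ.+-suc N N)) (trans (∑-last (suc (N ℕ.+ N)) g)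
    (cong₂ ℚ._+_ (∑-cong′ (suc (N ℕ.+ N)) (λ i → cong f (shift-index i))) (cong f top)))))
  (sym (ℚₚ.+-assoc (f ℤ.-[1+ N ]) (∑ᶻ N f) (f (+ suc N))))
  where
  g : ℕ → ℚ
  g i = f (+ suc i ℤ.- + suc N)
  shift-index : ∀ i → + suc i ℤ.- + suc N ≡ + i ℤ.- + N
  shift-index i = trans (ℤₚ.m-n≡m⊖n (suc i) (suc N)) (trans (ℤₚ.[1+m]⊖[1+n]≡m⊖n i N) (sym (ℤₚ.m-n≡m⊖n i N)))
  top : + suc (suc (N ℕ.+ N)) ℤ.- + suc N ≡ + suc N
  top = trans (shift-index (suc (N ℕ.+ N))) (trans (ℤₚ.m-n≡m⊖n (suc N ℕ.+ N) N)
      (trans (cong (ℤ._⊖ N) (ℕₚ.+-comm (suc N) N)) (trans (ℤₚ.⊖-≥ (ℕₚ.m≤m+n N (suc N))) (cong +_ (ℕₚ.m+n∸m≡n N (suc N))))))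

pentagonal : ∀ {N n} → n ℕ.≤ N → E 1 n ≡ ∑ᶻ N (λ k → ε k ℚ.* kd (pent k) n)
pentagonal {N} {n} n≤N = trans (E₁-shanks n≤N) (go N)
  where
  go : ∀ N → partial (shanks N) N n ≡ ∑ᶻ N (λ k → ε k ℚ.* kd (pent k) n)
  go zero    = trans (at (≈-trans (*-identityˡ (1# * kd 0)) (*-identityˡ (kd 0))) n)
      (sym (trans (ℚₚ.+-identityʳ _) (ℚₚ.*-identityˡ (kd 0 n))))
  go (suc N) = trans (at (finite-pentagonal N) n) (trans (+-at (partial (shanks N) N) σ n) (trans (cong₂ ℚ._+_ (go N)
      (trans (K-*-at (sg (suc N)) (kd (pent (+ suc N)) + kd (pent ℤ.-[1+ N ])) n)
          (cong (fromℤ (sg (suc N)) ℚ.*_) (+-at (kd (pent (+ suc N))) (kd (pent ℤ.-[1+ N ])) n))))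
    (trans (solve 4 (λ f σ x y → f :+ σ :* (x :+ y) := σ :* y :+ f :+ σ :* x) refl (∑ᶻ N (λ k → ε k ℚ.* kd (pent k) n))
        (ε (+ suc N)) (kd (pent (+ suc N)) n) (kd (pent ℤ.-[1+ N ]) n))
      (sym (∑ᶻ-suc N (λ k → ε k ℚ.* kd (pent k) n))))))
    where
    open ℚ-Solver
    σ : PS
    σ = K (sg (suc N)) * (kd (pent (+ suc N)) + kd (pent ℤ.-[1+ N ]))

-- The hexagonal lattice

indicator : ∀ {P : Set} → Dec P → ℚ
indicator d = if does d then 1ℚ else 0ℚ

δᶻ : ℤ → ℤ → ℚ
δᶻ a b = indicator (a ℤ.≟ b)

δᶻ-≡ : ∀ {a b} → a ≡ b → δᶻ a b ≡ 1ℚ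
δᶻ-≡ {a} {b} eq with a ℤ.≟ b
... | yes _ = refl
... | no ne = contradiction eq ne

δᶻ-≢ : ∀ {a b} → a ≢ b → δᶻ a b ≡ 0ℚ
δᶻ-≢ {a} {b} ne with a ℤ.≟ b
... | yes eq = contradiction eq ne
... | no _   = refl

∑-foldr : ∀ {B : Set} (g : B → ℕ) (h : ℕ → B) (p : ℕ → ℕ) k →
  ι (foldr ℕ._+_ 0 (List.map g (List.map h (applyUpTo p k)))) ≡ ∑ k (λ i → ι (g (h (p i))))
∑-foldr g h p zero    = refl
∑-foldr g h p (suc k) = trans (ι-+ (g (h (p 0))) (foldr ℕ._+_ 0 (List.map g (List.map h (applyUpTo (λ i → p (suc i)) k)))))
    (cong (ι (g (h (p 0))) ℚ.+_) (∑-foldr g h (λ i → p (suc i)) k))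

∑-filter : ∀ {B : Set} {P : B → Set} (P? : ∀ b → Dec (P b)) (h : ℕ → B) (p : ℕ → ℕ) k →
  ι (length (filter P? (List.map h (applyUpTo p k)))) ≡ ∑ k (λ i → indicator (P? (h (p i))))
∑-filter P? h p zero    = refl
∑-filter P? h p (suc k) with does (P? (h (p 0)))
... | true  = trans (ι-suc (length (filter P? (List.map h (applyUpTo (λ i → p (suc i)) k)))))
    (cong (1ℚ ℚ.+_) (∑-filter P? h (λ i → p (suc i)) k))
... | false = trans (∑-filter P? h (λ i → p (suc i)) k) (sym (ℚₚ.+-identityˡ _))

Q : ℤ → ℤ → ℤ
Q m n = m ℤ.* m ℤ.+ m ℤ.* n ℤ.+ n ℤ.* n

𝒜-∑ : ∀ N → 𝒜 N ≡ ∑ᶻ N (λ m → ∑ᶻ N (λ n → δᶻ (Q m n) (+ N)))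
𝒜-∑ N = trans (∑-foldr (λ m → length (filter (λ n → Q m n ℤ.≟ + N) (intRange N))) (λ i → + i ℤ.- + N) (λ i → i) (suc (N ℕ.+ N)))
  (∑-cong′ (suc (N ℕ.+ N)) (λ i → ∑-filter (λ n → Q (+ i ℤ.- + N) n ℤ.≟ + N) (λ i → + i ℤ.- + N) (λ i → i) (suc (N ℕ.+ N))))

+∣∣² : ∀ z → + (ℤ.∣ z ∣ ℕ.* ℤ.∣ z ∣) ≡ z ℤ.* z
+∣∣² (+ n)        = ℤₚ.pos-* n n
+∣∣² ℤ.-[1+ n ]   = refl

-- Completing the square shows that the form is nonnegative, which justifies `Qℕ`, and that 3m² ≤
-- 4Q, which bounds the coordinates.
4Q : ∀ m n → + 4 ℤ.* Q m n ≡ + (ℤ.∣ m ℤ.+ + 2 ℤ.* n ∣ ℕ.* ℤ.∣ m ℤ.+ + 2 ℤ.* n ∣ ℕ.+ 3 ℕ.* (ℤ.∣ m ∣ ℕ.* ℤ.∣ m ∣))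
4Q m n = trans (solve 2 (λ m n → con (+ 4) :* (m :* m :+ m :* n :+ n :* n) :=
    (m :+ con (+ 2) :* n) :* (m :+ con (+ 2) :* n) :+ con (+ 3) :* (m :* m)) refl m n)
  (sym (cong₂ ℤ._+_ (+∣∣² (m ℤ.+ + 2 ℤ.* n)) (trans (ℤₚ.pos-* 3 (ℤ.∣ m ∣ ℕ.* ℤ.∣ m ∣)) (cong (+ 3 ℤ.*_) (+∣∣² m)))))
  where open ℤ-Solver

Qℕ : ℤ → ℤ → ℕ
Qℕ m n = ℤ.∣ Q m n ∣

+Qℕ : ∀ m n → + Qℕ m n ≡ Q m n
+Qℕ m n with Q m n in eq
... | + k        = refl
... | ℤ.-[1+ k ] with trans (sym (cong (+ 4 ℤ.*_) eq)) (4Q m n)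
...   | ()

4Qℕ : ∀ m n → 4 ℕ.* Qℕ m n ≡ ℤ.∣ m ℤ.+ + 2 ℤ.* n ∣ ℕ.* ℤ.∣ m ℤ.+ + 2 ℤ.* n ∣ ℕ.+ 3 ℕ.* (ℤ.∣ m ∣ ℕ.* ℤ.∣ m ∣)
4Qℕ m n = ℤₚ.+-injective (trans (ℤₚ.pos-* 4 (Qℕ m n)) (trans (cong (+ 4 ℤ.*_) (+Qℕ m n)) (4Q m n)))

3m²≤4k⇒m≤k : ∀ m k → 3 ℕ.* (m ℕ.* m) ℕ.≤ 4 ℕ.* k → m ℕ.≤ k
3m²≤4k⇒m≤k zero          k       le = z≤n
3m²≤4k⇒m≤k (suc zero)    (suc k) le = s≤s z≤n
3m²≤4k⇒m≤k (suc (suc m)) k       le = ℕₚ.*-cancelˡ-≤ 4 (ℕₚ.≤-trans 4m≤3m² le)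
  where
  n : ℕ
  n = suc (suc m)
  4m≤3m² : 4 ℕ.* n ℕ.≤ 3 ℕ.* (n ℕ.* n)
  4m≤3m² = ℕₚ.≤-trans (ℕₚ.*-monoˡ-≤ n {4} {6} (s≤s (s≤s (s≤s (s≤s z≤n)))))
      (ℕₚ.≤-trans (ℕₚ.≤-reflexive (ℕₚ.*-assoc 3 2 n)) (ℕₚ.*-monoʳ-≤ 3 (ℕₚ.*-monoˡ-≤ n {2} {n} (s≤s (s≤s z≤n)))))

∣m∣≤Qℕ : ∀ m n → ℤ.∣ m ∣ ℕ.≤ Qℕ m n
∣m∣≤Qℕ m n = 3m²≤4k⇒m≤k ℤ.∣ m ∣ (Qℕ m n) (ℕₚ.≤-trans (ℕₚ.m≤n+m _ (ℤ.∣ m ℤ.+ + 2 ℤ.* n ∣ ℕ.* ℤ.∣ m ℤ.+ + 2 ℤ.* n ∣))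
    (ℕₚ.≤-reflexive (sym (4Qℕ m n))))

Qℕ-comm : ∀ m n → Qℕ m n ≡ Qℕ n m
Qℕ-comm m n = cong ℤ.∣_∣ (solve 2 (λ m n → m :* m :+ m :* n :+ n :* n := n :* n :+ n :* m :+ m :* m) refl m n)
  where open ℤ-Solver

∣n∣≤Qℕ : ∀ m n → ℤ.∣ n ∣ ℕ.≤ Qℕ m n
∣n∣≤Qℕ m n = ℕₚ.≤-trans (∣m∣≤Qℕ n m) (ℕₚ.≤-reflexive (Qℕ-comm n m))

δᶻ-kd : ∀ m n i → δᶻ (Q m n) (+ i) ≡ kd (Qℕ m n) i
δᶻ-kd m n i with Qℕ m n ℕ.≟ i
... | yes eq = trans (δᶻ-≡ (trans (sym (+Qℕ m n)) (cong +_ eq))) (sym (trans (cong (kd (Qℕ m n)) (sym eq)) (kd-refl (Qℕ m n))))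
... | no ne  = trans (δᶻ-≢ (λ eq → ne (ℤₚ.+-injective (trans (+Qℕ m n) eq)))) (sym (kd-≢ ne))

∑ᶻ-extend : ∀ {j N} f → j ℕ.≤ N → (∀ z → j ℕ.< ℤ.∣ z ∣ → f z ≡ 0ℚ) → ∑ᶻ N f ≡ ∑ᶻ j f
∑ᶻ-extend {j} f j≤N h with ℕₚ.m≤n⇒∃[o]m+o≡n j≤N
... | o , refl = go o
  where
  go : ∀ o → ∑ᶻ (j ℕ.+ o) f ≡ ∑ᶻ j f
  go zero    = cong (λ z → ∑ᶻ z f) (ℕₚ.+-identityʳ j)
  go (suc o) = trans (cong (λ z → ∑ᶻ z f) (ℕₚ.+-suc j o)) (trans (∑ᶻ-suc (j ℕ.+ o) f)
    (trans (cong₂ (λ a b → a ℚ.+ ∑ᶻ (j ℕ.+ o) f ℚ.+ b) (h ℤ.-[1+ j ℕ.+ o ] (s≤s (ℕₚ.m≤m+n j o)))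
        (h (+ suc (j ℕ.+ o)) (s≤s (ℕₚ.m≤m+n j o))))
      (trans (ℚₚ.+-identityʳ _) (trans (ℚₚ.+-identityˡ _) (go o)))))

-- A point of norm i has coordinates of absolute value at most i, so enlarging the box adds nothing;
-- one box then serves all coefficients of a product.
𝒜-box : ∀ {N i} → i ℕ.≤ N → 𝒜 i ≡ ∑ᶻ N (λ m → ∑ᶻ N (λ n → kd (Qℕ m n) i))
𝒜-box {N} {i} i≤N = trans (𝒜-∑ i) (trans (∑-cong₂ (suc (i ℕ.+ i)) (suc (i ℕ.+ i)) (λ a b → δᶻ-kd (+ a ℤ.- + i) (+ b ℤ.- + i) i))
  (sym (trans (∑ᶻ-extend (λ m → ∑ᶻ N (λ n → kd (Qℕ m n) i)) i≤N (λ m i<m → ∑-zero (suc (N ℕ.+ N))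
      (λ b _ → kd-> (ℕₚ.<-≤-trans i<m (∣m∣≤Qℕ m (+ b ℤ.- + N))))))
    (∑-cong′ (suc (i ℕ.+ i)) (λ a → ∑ᶻ-extend (λ n → kd (Qℕ (+ a ℤ.- + i) n) i) i≤N
        (λ n i<n → kd-> (ℕₚ.<-≤-trans i<n (∣n∣≤Qℕ (+ a ℤ.- + i) n))))))))

2triangle : ∀ n → 2 ℕ.* triangle n ≡ n ℕ.* suc n
2triangle zero    = refl
2triangle (suc n) = trans (ℕₚ.*-distribˡ-+ 2 (suc n) (triangle n)) (trans (cong (2 ℕ.* suc n ℕ.+_) (2triangle n))
  (solve 1 (λ n → con 2 :* (con 1 :+ n) :+ n :* (con 1 :+ n) := (con 1 :+ n) :* (con 2 :+ n)) refl n))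
  where
  open ℕ-Solver

2pent : ∀ k → + 2 ℤ.* + pent k ≡ + 3 ℤ.* (k ℤ.* k) ℤ.- k
2pent (+ zero)   = refl
2pent (+ suc n)  = begin
  + 2 ℤ.* + (N ℕ.* N ℕ.+ triangle n)                ≡⟨ cong (λ z → + 2 ℤ.* (z ℤ.+ + triangle n)) (ℤₚ.pos-* N N) ⟩
  + 2 ℤ.* (+ N ℤ.* + N ℤ.+ + triangle n)            ≡⟨ solve 2 (λ x t → con (+ 2) :* (x :* x :+ t) := con (+ 2) :*
      (x :* x) :+ con (+ 2) :* t) refl (+ N) (+ triangle n) ⟩
  + 2 ℤ.* (+ N ℤ.* + N) ℤ.+ + 2 ℤ.* + triangle n    ≡⟨ cong (λ z → + 2 ℤ.* (+ N ℤ.* + N) ℤ.+ z)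
      (trans (sym (ℤₚ.pos-* 2 (triangle n))) (trans (cong +_ (2triangle n)) (ℤₚ.pos-* n N))) ⟩
  + 2 ℤ.* (+ N ℤ.* + N) ℤ.+ + n ℤ.* + N             ≡⟨ solve 1 (λ n → con (+ 2) :*
      ((con (+ 1) :+ n) :* (con (+ 1) :+ n)) :+ n :* (con (+ 1) :+ n) := con (+ 3) :* ((con (+ 1) :+ n) :* (con (+ 1) :+ n)) :-
      (con (+ 1) :+ n)) refl (+ n) ⟩
  + 3 ℤ.* (+ N ℤ.* + N) ℤ.- + N                     ∎
  where
  open ≡-Reasoning
  open ℤ-Solver
  N : ℕ
  N = suc n
2pent ℤ.-[1+ n ] = begin
  + 2 ℤ.* + (N ℕ.* N ℕ.+ triangle N)                ≡⟨ cong (λ z → + 2 ℤ.* (z ℤ.+ + triangle N)) (ℤₚ.pos-* N N) ⟩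
  + 2 ℤ.* (+ N ℤ.* + N ℤ.+ + triangle N)            ≡⟨ solve 2 (λ x t → con (+ 2) :* (x :* x :+ t) := con (+ 2) :*
      (x :* x) :+ con (+ 2) :* t) refl (+ N) (+ triangle N) ⟩
  + 2 ℤ.* (+ N ℤ.* + N) ℤ.+ + 2 ℤ.* + triangle N    ≡⟨ cong (λ z → + 2 ℤ.* (+ N ℤ.* + N) ℤ.+ z)
      (trans (sym (ℤₚ.pos-* 2 (triangle N))) (trans (cong +_ (2triangle N)) (ℤₚ.pos-* N (suc N)))) ⟩
  + 2 ℤ.* (+ N ℤ.* + N) ℤ.+ + N ℤ.* + suc N         ≡⟨ solve 1 (λ x → con (+ 2) :* (x :* x) :+ x :* (con (+ 1) :+ x) := con
      (+ 3) :* ((:- x) :* (:- x)) :- (:- x)) refl (+ N) ⟩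
  + 3 ℤ.* (ℤ.-[1+ n ] ℤ.* ℤ.-[1+ n ]) ℤ.- ℤ.-[1+ n ] ∎
  where
  open ≡-Reasoning
  open ℤ-Solver
  N : ℕ
  N = suc n

∣k∣≤pent : ∀ k → ℤ.∣ k ∣ ℕ.≤ pent k
∣k∣≤pent (+ zero)   = z≤n
∣k∣≤pent (+ suc n)  = ℕₚ.≤-trans (ℕₚ.m≤m*n (suc n) (suc n)) (ℕₚ.m≤m+n (suc n ℕ.* suc n) (triangle n))
∣k∣≤pent ℤ.-[1+ n ] = ℕₚ.≤-trans (ℕₚ.m≤m*n (suc n) (suc n)) (ℕₚ.m≤m+n (suc n ℕ.* suc n) (triangle (suc n)))

-- The quadratic form of the pentagonal exponents splits along (1,1,1) and its orthogonal lattice.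
pent-split : ∀ k m n → pent (m ℤ.+ k) ℕ.+ (pent (n ℤ.+ k) ℕ.+ pent (k ℤ.- m ℤ.- n)) ≡ 3 ℕ.* (pent k ℕ.+ Qℕ m n)
pent-split k m n = ℤₚ.+-injective (ℤₚ.*-cancelˡ-≡ (+ 2) _ _ (begin
  + 2 ℤ.* (+ pent v₁ ℤ.+ (+ pent v₂ ℤ.+ + pent v₃))
    ≡⟨ solve 3 (λ x y z → con (+ 2) :* (x :+ (y :+ z)) := con (+ 2) :* x :+ (con (+ 2) :* y :+ con (+ 2) :* z)) refl (+ pent v₁)
        (+ pent v₂) (+ pent v₃) ⟩
  + 2 ℤ.* + pent v₁ ℤ.+ (+ 2 ℤ.* + pent v₂ ℤ.+ + 2 ℤ.* + pent v₃)
    ≡⟨ cong₂ ℤ._+_ (2pent v₁) (cong₂ ℤ._+_ (2pent v₂) (2pent v₃)) ⟩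
  (+ 3 ℤ.* (v₁ ℤ.* v₁) ℤ.- v₁) ℤ.+ ((+ 3 ℤ.* (v₂ ℤ.* v₂) ℤ.- v₂) ℤ.+ (+ 3 ℤ.* (v₃ ℤ.* v₃) ℤ.- v₃))
    ≡⟨ solve 3 (λ k m n → let a = m :+ k
                              b = n :+ k
                              c = k :- m :- n in
         (con (+ 3) :* (a :* a) :- a) :+ ((con (+ 3) :* (b :* b) :- b) :+ (con (+ 3) :* (c :* c) :- c))
         := con (+ 3) :* ((con (+ 3) :* (k :* k) :- k) :+ con (+ 2) :* (m :* m :+ m :* n :+ n :* n))) refl k m n ⟩
  + 3 ℤ.* ((+ 3 ℤ.* (k ℤ.* k) ℤ.- k) ℤ.+ + 2 ℤ.* Q m n)
    ≡⟨ cong₂ (λ x y → + 3 ℤ.* (x ℤ.+ + 2 ℤ.* y)) (sym (2pent k)) (sym (+Qℕ m n)) ⟩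
  + 3 ℤ.* (+ 2 ℤ.* + pent k ℤ.+ + 2 ℤ.* + Qℕ m n)
    ≡⟨ solve 2 (λ x y → con (+ 3) :* (con (+ 2) :* x :+ con (+ 2) :* y) := con (+ 2) :* (con (+ 3) :* (x :+ y))) refl (+ pent k)
        (+ Qℕ m n) ⟩
  + 2 ℤ.* (+ 3 ℤ.* + (pent k ℕ.+ Qℕ m n))
    ≡⟨ cong (+ 2 ℤ.*_) (sym (ℤₚ.pos-* 3 (pent k ℕ.+ Qℕ m n))) ⟩
  + 2 ℤ.* + (3 ℕ.* (pent k ℕ.+ Qℕ m n)) ∎))
  where
  open ≡-Reasoning
  open ℤ-Solver using (solve; _:=_; _:+_; _:*_; _:-_; con)
  v₁ v₂ v₃ : ℤ
  v₁ = m ℤ.+ k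
  v₂ = n ℤ.+ k
  v₃ = k ℤ.- m ℤ.- n

ε-suc : ∀ z → ε (+ 1 ℤ.+ z) ≡ ℚ.- ε z
ε-suc (+ n)          = fromℤ-neg (sg n)
ε-suc ℤ.-[1+ zero ]  = refl
ε-suc ℤ.-[1+ suc n ] = trans (cong fromℤ (sym (ℤₚ.neg-involutive (sg (suc n))))) (fromℤ-neg (ℤ.- sg (suc n)))

ε-+n : ∀ n z → ε (+ n ℤ.+ z) ≡ ε (+ n) ℚ.* ε z
ε-+n zero    z = trans (cong ε (ℤₚ.+-identityˡ z)) (sym (ℚₚ.*-identityˡ (ε z)))
ε-+n (suc n) z = trans (cong ε (ℤₚ.+-assoc (+ 1) (+ n) z)) (trans (ε-suc (+ n ℤ.+ z)) (trans (cong ℚ.-_ (ε-+n n z))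
  (trans (ℚₚ.neg-distribˡ-* (ε (+ n)) (ε z)) (cong (ℚ._* ε z) (sym (ε-suc (+ n)))))))

ε²≡1 : ∀ z → ε z ℚ.* ε z ≡ 1ℚ
ε²≡1 z = go ℤ.∣ z ∣
  where
  go : ∀ n → fromℤ (sg n) ℚ.* fromℤ (sg n) ≡ 1ℚ
  go zero    = refl
  go (suc n) = trans (cong₂ ℚ._*_ (fromℤ-neg (sg n)) (fromℤ-neg (sg n)))
      (trans (solve 1 (λ x → (:- x) :* (:- x) := x :* x) refl (fromℤ (sg n))) (go n))
    where open ℚ-Solver

ε-neg : ∀ z → ε (ℤ.- z) ≡ ε z
ε-neg z = cong (λ n → fromℤ (sg n)) (ℤₚ.∣-i∣≡∣i∣ z)

ε-+ : ∀ a b → ε (a ℤ.+ b) ≡ ε a ℚ.* ε b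
ε-+ (+ n)      b = ε-+n n b
ε-+ ℤ.-[1+ n ] b = trans (sym (ε-neg (ℤ.-[1+ n ] ℤ.+ b))) (trans (cong ε (ℤₚ.neg-distrib-+ ℤ.-[1+ n ] b))
    (trans (ε-+n (suc n) (ℤ.- b)) (cong (ε (+ suc n) ℚ.*_) (ε-neg b))))

-- The three arguments add up to 3k, which has the parity of k.
ε-split : ∀ k m n → ε (m ℤ.+ k) ℚ.* (ε (n ℤ.+ k) ℚ.* ε (k ℤ.- m ℤ.- n)) ≡ ε k
ε-split k m n = begin
  ε (m ℤ.+ k) ℚ.* (ε (n ℤ.+ k) ℚ.* ε (k ℤ.- m ℤ.- n))   ≡⟨ cong (ε (m ℤ.+ k) ℚ.*_) (sym (ε-+ (n ℤ.+ k) (k ℤ.- m ℤ.- n))) ⟩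
  ε (m ℤ.+ k) ℚ.* ε ((n ℤ.+ k) ℤ.+ (k ℤ.- m ℤ.- n))     ≡⟨ sym (ε-+ (m ℤ.+ k) _) ⟩
  ε ((m ℤ.+ k) ℤ.+ ((n ℤ.+ k) ℤ.+ (k ℤ.- m ℤ.- n)))     ≡⟨ cong ε (solve 3
      (λ k m n → (m :+ k) :+ ((n :+ k) :+ (k :- m :- n)) := k :+ (k :+ k)) refl k m n) ⟩
  ε (k ℤ.+ (k ℤ.+ k))                                    ≡⟨ trans (ε-+ k (k ℤ.+ k)) (cong (ε k ℚ.*_) (trans (ε-+ k k) (ε²≡1 k))) ⟩
  ε k ℚ.* 1ℚ                                             ≡⟨ ℚₚ.*-identityʳ (ε k) ⟩
  ε k                                                    ∎
  where
  open ≡-Reasoning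
  open ℤ-Solver using (solve; _:=_; _:+_; _:-_)

index : ∀ N c → ℤ.∣ c ∣ ℕ.≤ N → ∃ λ i → i ℕ.< suc (N ℕ.+ N) × + i ℤ.- + N ≡ c
index N (+ a) a≤N = a ℕ.+ N , s≤s (ℕₚ.+-monoˡ-≤ N a≤N) , solve 2 (λ a n → (a :+ n) :- n := a) refl (+ a) (+ N)
  where open ℤ-Solver
index N ℤ.-[1+ a ] a<N with ℕₚ.m≤n⇒∃[o]m+o≡n a<N
... | j , refl = j , s≤s (ℕₚ.≤-trans (ℕₚ.m≤n+m j (suc a)) (ℕₚ.m≤m+n (suc a ℕ.+ j) (suc a ℕ.+ j))) , solve 2
    (λ a j → j :- (a :+ j) := :- a) refl (+ suc a) (+ j)
  where open ℤ-Solver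

collapse : ∀ N {k} (f : ℤ → ℚ) → ℤ.∣ k ∣ ℕ.≤ N → ∑ᶻ N (λ z → δᶻ z k ℚ.* f z) ≡ f k
collapse N {k} f k≤N with index N k k≤N
... | i , i<2N , refl = trans (∑-cong′ (suc (N ℕ.+ N)) pt) (∑-kd (suc (N ℕ.+ N)) (λ j → f (+ j ℤ.- + N)) i<2N)
  where
  cancel : ∀ j → + j ℤ.- + N ≡ + i ℤ.- + N → j ≡ i
  cancel j eq = ℤₚ.+-injective (trans (solve 2 (λ j n → j := (j :- n) :+ n) refl (+ j) (+ N))
      (trans (cong (ℤ._+ + N) eq) (solve 2 (λ j n → (j :- n) :+ n := j) refl (+ i) (+ N))))
    where open ℤ-Solver
  pt : ∀ j → δᶻ (+ j ℤ.- + N) (+ i ℤ.- + N) ℚ.* f (+ j ℤ.- + N) ≡ f (+ j ℤ.- + N) ℚ.* kd j i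
  pt j with j ℕ.≟ i
  ... | yes refl = trans (ℚₚ.*-comm (δᶻ (+ j ℤ.- + N) (+ j ℤ.- + N)) (f (+ j ℤ.- + N)))
      (cong (f (+ j ℤ.- + N) ℚ.*_) (trans (δᶻ-≡ {+ j ℤ.- + N} refl) (sym (kd-refl j))))
  ... | no j≢i   = trans (ℚₚ.*-comm (δᶻ (+ j ℤ.- + N) (+ i ℤ.- + N)) (f (+ j ℤ.- + N)))
      (cong (f (+ j ℤ.- + N) ℚ.*_) (trans (δᶻ-≢ (λ eq → j≢i (cancel j eq))) (sym (kd-≢ j≢i))))

collapse₁ : ∀ N k → ℤ.∣ k ∣ ℕ.≤ N → ∑ᶻ N (λ z → δᶻ z k) ≡ 1ℚ
collapse₁ N k k≤N = trans (∑-cong′ (suc (N ℕ.+ N)) (λ i → sym (ℚₚ.*-identityʳ (δᶻ (+ i ℤ.- + N) k)))) (collapse N (λ _ → 1ℚ) k≤N)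

∑³ : ℕ → (ℤ → ℤ → ℤ → ℚ) → ℚ
∑³ N f = ∑ᶻ N (λ a → ∑ᶻ N (λ b → ∑ᶻ N (f a b)))

∑³-cong : ∀ N {f g : ℤ → ℤ → ℤ → ℚ} → (∀ a b c → f a b c ≡ g a b c) → ∑³ N f ≡ ∑³ N g
∑³-cong N h = ∑-cong₂ (suc (N ℕ.+ N)) (suc (N ℕ.+ N)) (λ i j → ∑-cong′ (suc (N ℕ.+ N))
    (λ k → h (+ i ℤ.- + N) (+ j ℤ.- + N) (+ k ℤ.- + N)))

∑ᶻ-cong : ∀ N {f g : ℤ → ℚ} → (∀ z → f z ≡ g z) → ∑ᶻ N f ≡ ∑ᶻ N g
∑ᶻ-cong N h = ∑-cong′ (suc (N ℕ.+ N)) (λ i → h (+ i ℤ.- + N))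

∑ᶻ-*ˡ : ∀ N c f → ∑ᶻ N (λ z → c ℚ.* f z) ≡ c ℚ.* ∑ᶻ N f
∑ᶻ-*ˡ N c f = ∑-*ˡ (suc (N ℕ.+ N)) c (λ i → f (+ i ℤ.- + N))

∑ᶻ-*ʳ : ∀ N f c → ∑ᶻ N (λ z → f z ℚ.* c) ≡ ∑ᶻ N f ℚ.* c
∑ᶻ-*ʳ N f c = ∑-*ʳ (suc (N ℕ.+ N)) (λ i → f (+ i ℤ.- + N)) c

∑-∑ᶻ : ∀ m N (F : ℕ → ℤ → ℚ) → ∑ m (λ i → ∑ᶻ N (F i)) ≡ ∑ᶻ N (λ z → ∑ m (λ i → F i z))
∑-∑ᶻ m N F = ∑-swap m (suc (N ℕ.+ N)) (λ i j → F i (+ j ℤ.- + N))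

∑-∑³ : ∀ m N (F : ℕ → ℤ → ℤ → ℤ → ℚ) → ∑ m (λ i → ∑³ N (F i)) ≡ ∑³ N (λ a b c → ∑ m (λ i → F i a b c))
∑-∑³ m N F = trans (∑-∑ᶻ m N (λ i a → ∑ᶻ N (λ b → ∑ᶻ N (F i a b)))) (∑ᶻ-cong N
    (λ a → trans (∑-∑ᶻ m N (λ i b → ∑ᶻ N (F i a b))) (∑ᶻ-cong N (λ b → ∑-∑ᶻ m N (λ i → F i a b)))))

∑³-swap : ∀ M N (F : ℤ → ℤ → ℤ → ℤ → ℤ → ℤ → ℚ) →
  ∑³ M (λ k m n → ∑³ N (F k m n)) ≡ ∑³ N (λ a b c → ∑³ M (λ k m n → F k m n a b c))
∑³-swap M N F = trans (∑-cong′ (suc (M ℕ.+ M)) (λ i → trans (∑-cong′ (suc (M ℕ.+ M))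
    (λ j → ∑-∑³ (suc (M ℕ.+ M)) N (λ l → F (+ i ℤ.- + M) (+ j ℤ.- + M) (+ l ℤ.- + M))))
    (∑-∑³ (suc (M ℕ.+ M)) N (λ j a b c → ∑ᶻ M (λ n → F (+ i ℤ.- + M) (+ j ℤ.- + M) n a b c)))))
  (∑-∑³ (suc (M ℕ.+ M)) N (λ i a b c → ∑ᶻ M (λ m → ∑ᶻ M (λ n → F (+ i ℤ.- + M) m n a b c))))

∑³-*ʳ : ∀ N (f : ℤ → ℤ → ℤ → ℚ) x → ∑³ N (λ a b c → f a b c ℚ.* x) ≡ ∑³ N f ℚ.* x
∑³-*ʳ N f x = trans (∑ᶻ-cong N (λ a → trans (∑ᶻ-cong N (λ b → ∑ᶻ-*ʳ N (f a b) x)) (∑ᶻ-*ʳ N (λ b → ∑ᶻ N (f a b)) x)))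
    (∑ᶻ-*ʳ N (λ a → ∑ᶻ N (λ b → ∑ᶻ N (f a b))) x)

∑³-nest : ∀ N (f : ℤ → ℚ) (g : ℤ → ℤ → ℚ) (h : ℤ → ℤ → ℤ → ℚ) →
  ∑³ N (λ a b c → f a ℚ.* (g a b ℚ.* h a b c)) ≡ ∑ᶻ N (λ a → f a ℚ.* ∑ᶻ N (λ b → g a b ℚ.* ∑ᶻ N (h a b)))
∑³-nest N f g h = ∑ᶻ-cong N (λ a → trans
  (∑ᶻ-cong N (λ b → trans (∑ᶻ-*ˡ N (f a) (λ c → g a b ℚ.* h a b c)) (cong (f a ℚ.*_) (∑ᶻ-*ˡ N (g a b) (h a b)))))
  (∑ᶻ-*ˡ N (f a) (λ b → g a b ℚ.* ∑ᶻ N (h a b))))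

index-bound : ∀ N i → i ℕ.< suc (N ℕ.+ N) → ℤ.∣ + i ℤ.- + N ∣ ℕ.≤ N
index-bound N i (s≤s i≤2N) with ℕₚ.≤-total N i
... | inj₁ N≤i = ℕₚ.≤-trans (ℕₚ.≤-reflexive (cong ℤ.∣_∣ (trans (ℤₚ.m-n≡m⊖n i N) (ℤₚ.⊖-≥ N≤i)))) (ℕₚ.m≤n+o⇒m∸n≤o i N i≤2N)
... | inj₂ i≤N = ℕₚ.≤-trans (ℕₚ.≤-reflexive (trans (cong ℤ.∣_∣ (trans (ℤₚ.m-n≡m⊖n i N) (ℤₚ.⊖-≤ i≤N)))
    (ℤₚ.∣-i∣≡∣i∣ (+ (N ∸ i))))) (ℕₚ.m∸n≤m N i)

-- The coefficients of E₁ 𝒜 and of the exponents 3n in E₁³ are compared through the correspondence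
-- (a,b,c) = (m+k, l+k, k-m-l), which maps onto the triples with sum divisible by 3.
module _ (n : ℕ) where

  private
    V : ℕ
    V = 3 ℕ.* n

  -- `F` is the contribution of (k,m,l) to the coefficient of q^n in `E 1 * 𝒜`, and `G` that of
  -- (a,b,c) to the coefficient of q^(3n) in the cube of `E 1`.
  F G : ℤ → ℤ → ℤ → ℚ
  F k m l = ε k ℚ.* kd (pent k ℕ.+ Qℕ m l) n
  G a b c = ε a ℚ.* (ε b ℚ.* ε c) ℚ.* kd (pent a ℕ.+ (pent b ℕ.+ pent c)) V

  -- The indicator of one correspondence, solved for (a,b,c) in `match` and for (k,m,l) in `match′`;
  -- the condition on 3k avoids a division by 3.
  match match′ : ℤ → ℤ → ℤ → ℤ → ℤ → ℤ → ℚ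
  match  k m l a b c = δᶻ a (m ℤ.+ k) ℚ.* (δᶻ b (l ℤ.+ k) ℚ.* δᶻ c (k ℤ.- m ℤ.- l))
  match′ k m l a b c = δᶻ (+ 3 ℤ.* k) (a ℤ.+ b ℤ.+ c) ℚ.* (δᶻ m (a ℤ.- k) ℚ.* δᶻ l (b ℤ.- k))

  F≡G : ∀ k m l → F k m l ≡ G (m ℤ.+ k) (l ℤ.+ k) (k ℤ.- m ℤ.- l)
  F≡G k m l = cong₂ ℚ._*_ (sym (ε-split k m l)) (trans (sym (kd-*ˡ 2 (pent k ℕ.+ Qℕ m l) n))
      (cong (λ z → kd z V) (sym (pent-split k m l))))

  match-match′ : ∀ k m l a b c → match k m l a b c ℚ.* F k m l ≡ match′ k m l a b c ℚ.* G a b c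
  match-match′ k m l a b c with a ℤ.≟ m ℤ.+ k | b ℤ.≟ l ℤ.+ k | c ℤ.≟ k ℤ.- m ℤ.- l
  ... | yes refl | yes refl | yes refl = cong₂ ℚ._*_
        (sym (cong₂ ℚ._*_ (δᶻ-≡ (solve 3 (λ k m l → con (+ 3) :* k := (m :+ k) :+ (l :+ k) :+ (k :- m :- l)) refl k m l))
          (cong₂ ℚ._*_ (δᶻ-≡ (minus m)) (δᶻ-≡ (minus l)))))
        (F≡G k m l)
    where
    open ℤ-Solver
    minus : ∀ m → m ≡ (m ℤ.+ k) ℤ.- k
    minus m = solve 2 (λ m k → m := (m :+ k) :- k) refl m k
  ... | no ne | d₂ | d₃ = trans (P.solve 3 (λ x y f → P.con (+ 0) P.:* (x P.:* y) P.:* f P.:= P.con (+ 0)) refl (indicator d₂)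
      (indicator d₃) (F k m l))
      (sym (trans (cong (λ z → δᶻ (+ 3 ℤ.* k) (a ℤ.+ b ℤ.+ c) ℚ.* (z ℚ.* δᶻ l (b ℤ.- k)) ℚ.* G a b c)
          (δᶻ-≢ {m} (λ eq → ne (trans (solve 2 (λ a k → a := (a :- k) :+ k) refl a k) (cong (ℤ._+ k) (sym eq))))))
        (P.solve 3 (λ x y f → x P.:* (P.con (+ 0) P.:* y) P.:* f P.:= P.con (+ 0)) refl (δᶻ (+ 3 ℤ.* k) (a ℤ.+ b ℤ.+ c))
            (δᶻ l (b ℤ.- k)) (G a b c))))
    where
    open ℤ-Solver
    module P = ℚ-Solver
  ... | yes refl | no ne | d₃ = trans (P.solve 3 (λ x y f → x P.:* (P.con (+ 0) P.:* y) P.:* f P.:= P.con (+ 0)) refl 1ℚ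
      (indicator d₃) (F k m l))
      (sym (trans (cong (λ z → δᶻ (+ 3 ℤ.* k) (a ℤ.+ b ℤ.+ c) ℚ.* (δᶻ m (a ℤ.- k) ℚ.* z) ℚ.* G a b c)
          (δᶻ-≢ {l} (λ eq → ne (trans (solve 2 (λ a k → a := (a :- k) :+ k) refl b k) (cong (ℤ._+ k) (sym eq))))))
        (P.solve 3 (λ x y f → x P.:* (y P.:* P.con (+ 0)) P.:* f P.:= P.con (+ 0)) refl (δᶻ (+ 3 ℤ.* k) (a ℤ.+ b ℤ.+ c))
            (δᶻ m (a ℤ.- k)) (G a b c))))
    where
    open ℤ-Solver
    module P = ℚ-Solver
  ... | yes refl | yes refl | no ne = trans (P.solve 1 (λ f → P.con (+ 1) P.:* (P.con (+ 1) P.:* P.con (+ 0)) P.:* f P.:= P.con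
      (+ 0)) refl (F k m l))
      (sym (trans (cong (λ z → z ℚ.* (δᶻ m (a ℤ.- k) ℚ.* δᶻ l (b ℤ.- k)) ℚ.* G a b c) (δᶻ-≢ {+ 3 ℤ.* k} (λ eq → ne
          (trans (solve 4 (λ k m l c → c := ((m :+ k) :+ (l :+ k) :+ c) :- (m :+ k) :- (l :+ k)) refl k m l c)
              (trans (cong (λ z → z ℤ.- (m ℤ.+ k) ℤ.- (l ℤ.+ k)) (sym eq))
              (solve 3 (λ k m l → con (+ 3) :* k :- (m :+ k) :- (l :+ k) := k :- m :- l) refl k m l))))))
        (P.solve 2 (λ x f → P.con (+ 0) P.:* x P.:* f P.:= P.con (+ 0)) refl (δᶻ m (a ℤ.- k) ℚ.* δᶻ l (b ℤ.- k)) (G a b c))))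
    where
    open ℤ-Solver
    module P = ℚ-Solver

  -- Each (k,m,l) in the box of size n has exactly one partner, and since its entries involve at
  -- most three summands it lies in the box of size 3n.
  match-total : ∀ k m l → ℤ.∣ k ∣ ℕ.≤ n → ℤ.∣ m ∣ ℕ.≤ n → ℤ.∣ l ∣ ℕ.≤ n → ∑³ V (match k m l) ≡ 1ℚ
  match-total k m l k≤ m≤ l≤ = trans (∑³-nest V (λ a → δᶻ a (m ℤ.+ k)) (λ _ b → δᶻ b (l ℤ.+ k)) (λ _ _ c → δᶻ c (k ℤ.- m ℤ.- l)))
    (trans (collapse V {m ℤ.+ k} (λ _ → ∑ᶻ V (λ b → δᶻ b (l ℤ.+ k) ℚ.* ∑ᶻ V (λ c → δᶻ c (k ℤ.- m ℤ.- l)))) (two m k m≤ k≤))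
    (trans (collapse V {l ℤ.+ k} (λ _ → ∑ᶻ V (λ c → δᶻ c (k ℤ.- m ℤ.- l))) (two l k l≤ k≤))
    (collapse₁ V (k ℤ.- m ℤ.- l) three)))
    where
    two : ∀ x y → ℤ.∣ x ∣ ℕ.≤ n → ℤ.∣ y ∣ ℕ.≤ n → ℤ.∣ x ℤ.+ y ∣ ℕ.≤ V
    two x y x≤ y≤ = ℕₚ.≤-trans (ℤₚ.∣i+j∣≤∣i∣+∣j∣ x y) (ℕₚ.+-mono-≤ x≤ (ℕₚ.≤-trans y≤ (ℕₚ.m≤m+n n (n ℕ.+ 0))))
    three : ℤ.∣ k ℤ.- m ℤ.- l ∣ ℕ.≤ V
    three = ℕₚ.≤-trans (ℤₚ.∣i+j∣≤∣i∣+∣j∣ (k ℤ.- m) (ℤ.- l)) (ℕₚ.≤-trans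
        (ℕₚ.+-mono-≤ (ℕₚ.≤-trans (ℤₚ.∣i+j∣≤∣i∣+∣j∣ k (ℤ.- m)) (ℕₚ.+-mono-≤ k≤ (ℕₚ.≤-trans (ℕₚ.≤-reflexive (ℤₚ.∣-i∣≡∣i∣ m)) m≤)))
        (ℕₚ.≤-trans (ℕₚ.≤-reflexive (ℤₚ.∣-i∣≡∣i∣ l)) l≤))
      (ℕₚ.≤-reflexive (trans (ℕₚ.+-assoc n n n) (cong (λ z → n ℕ.+ (n ℕ.+ z)) (sym (ℕₚ.+-identityʳ n))))))

  match′-total : ∀ a b c → pent a ℕ.+ (pent b ℕ.+ pent c) ≡ V → ∑³ n (λ k m l → match′ k m l a b c) ≡ 1ℚ
  match′-total a b c eq = trans (∑³-nest n (λ k → δᶻ (+ 3 ℤ.* k) (a ℤ.+ b ℤ.+ c)) (λ k m → δᶻ m (a ℤ.- k))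
      (λ k _ l → δᶻ l (b ℤ.- k)))
    (trans (∑-cong′ (suc (n ℕ.+ n)) (λ i → cong (ℚ._* rest (+ i ℤ.- + n)) (δ3 (+ i ℤ.- + n))))
    (trans (collapse n {κ} rest κ≤) (trans (collapse n {m} (λ _ → ∑ᶻ n (λ l → δᶻ l (b ℤ.- κ))) m≤) (collapse₁ n l l≤))))
    where
    open ℤ-Solver
    κ m l : ℤ
    -- `energy` reads 3(a² + b² + c²) - (a + b + c) = 6n. Hence a + b + c is divisible by 3, and
    -- this expression is its third.
    κ = a ℤ.* a ℤ.+ b ℤ.* b ℤ.+ c ℤ.* c ℤ.- + 2 ℤ.* + n
    m = a ℤ.- κ
    l = b ℤ.- κ
    rest : ℤ → ℚ
    rest k = ∑ᶻ n (λ m → δᶻ m (a ℤ.- k) ℚ.* ∑ᶻ n (λ l → δᶻ l (b ℤ.- k)))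
    energy : + 3 ℤ.* (a ℤ.* a ℤ.+ b ℤ.* b ℤ.+ c ℤ.* c) ℤ.- (a ℤ.+ b ℤ.+ c) ≡ + 2 ℤ.* (+ 3 ℤ.* + n)
    energy = trans (solve 3 (λ a b c → con (+ 3) :* (a :* a :+ b :* b :+ c :* c) :- (a :+ b :+ c) :=
        (con (+ 3) :* (a :* a) :- a) :+ ((con (+ 3) :* (b :* b) :- b) :+ (con (+ 3) :* (c :* c) :- c))) refl a b c)
      (trans (sym (cong₂ ℤ._+_ (2pent a) (cong₂ ℤ._+_ (2pent b) (2pent c))))
          (trans (solve 3 (λ x y z → con (+ 2) :* x :+ (con (+ 2) :* y :+ con (+ 2) :* z) := con (+ 2) :* (x :+ (y :+ z))) refl
          (+ pent a) (+ pent b) (+ pent c))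
        (cong (+ 2 ℤ.*_) (trans (cong +_ eq) (ℤₚ.pos-* 3 n)))))
    sum≡3κ : a ℤ.+ b ℤ.+ c ≡ + 3 ℤ.* κ
    sum≡3κ = trans (solve 4 (λ a b c n → a :+ b :+ c := con (+ 3) :* (a :* a :+ b :* b :+ c :* c) :-
        (con (+ 3) :* (a :* a :+ b :* b :+ c :* c) :- (a :+ b :+ c))) refl a b c (+ n))
      (trans (cong (λ z → + 3 ℤ.* (a ℤ.* a ℤ.+ b ℤ.* b ℤ.+ c ℤ.* c) ℤ.- z) energy)
          (solve 2 (λ s n → con (+ 3) :* s :- con (+ 2) :* (con (+ 3) :* n) := con (+ 3) :* (s :- con (+ 2) :* n)) refl
          (a ℤ.* a ℤ.+ b ℤ.* b ℤ.+ c ℤ.* c) (+ n)))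
    c≡ : κ ℤ.- m ℤ.- l ≡ c
    c≡ = trans (solve 3 (λ a b k → k :- (a :- k) :- (b :- k) := con (+ 3) :* k :- a :- b) refl a b κ)
        (trans (cong (λ z → z ℤ.- a ℤ.- b) (sym sum≡3κ)) (solve 3 (λ a b c → (a :+ b :+ c) :- a :- b := c) refl a b c))
    undo : ∀ a → (a ℤ.- κ) ℤ.+ κ ≡ a
    undo a = solve 2 (λ a k → (a :- k) :+ k := a) refl a κ
    -- Dividing `pent-split` by 3 places the preimage at level n; both summands are nonnegative, and
    -- this gives the bounds on κ, m and l.
    level : pent κ ℕ.+ Qℕ m l ≡ n
    level = ℕₚ.*-cancelˡ-≡ (pent κ ℕ.+ Qℕ m l) n 3 (trans (sym (pent-split κ m l))
        (trans (cong₂ (λ x y → pent x ℕ.+ y) (undo a) (cong₂ (λ x y → pent x ℕ.+ pent y) (undo b) c≡)) eq))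
    κ≤ : ℤ.∣ κ ∣ ℕ.≤ n
    κ≤ = ℕₚ.≤-trans (∣k∣≤pent κ) (ℕₚ.≤-trans (ℕₚ.m≤m+n (pent κ) (Qℕ m l)) (ℕₚ.≤-reflexive level))
    Qℕ≤ : Qℕ m l ℕ.≤ n
    Qℕ≤ = ℕₚ.≤-trans (ℕₚ.m≤n+m (Qℕ m l) (pent κ)) (ℕₚ.≤-reflexive level)
    m≤ : ℤ.∣ m ∣ ℕ.≤ n
    m≤ = ℕₚ.≤-trans (∣m∣≤Qℕ m l) Qℕ≤
    l≤ : ℤ.∣ l ∣ ℕ.≤ n
    l≤ = ℕₚ.≤-trans (∣n∣≤Qℕ m l) Qℕ≤
    δ3 : ∀ k → δᶻ (+ 3 ℤ.* k) (a ℤ.+ b ℤ.+ c) ≡ δᶻ k κ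
    δ3 k with k ℤ.≟ κ
    ... | yes refl = δᶻ-≡ (sym sum≡3κ)
    ... | no ne    = δᶻ-≢ (λ eq → ne (ℤₚ.*-cancelˡ-≡ (+ 3) k κ (trans eq sum≡3κ)))

  -- Insert the total 1 of `match`, pass to `match′` and `G`, and exchange the sums. Where `G` is
  -- nonzero its exponent is 3n, the hypothesis under which `match′` also has total 1.
  double-count : ∑³ n F ≡ ∑³ V G
  double-count = begin
    ∑³ n F
      ≡⟨ ∑-cong (suc (n ℕ.+ n)) (λ i i< → ∑-cong (suc (n ℕ.+ n)) (λ j j< → ∑-cong (suc (n ℕ.+ n)) (λ l l< → sym (trans
           (cong (ℚ._* F (+ i ℤ.- + n) (+ j ℤ.- + n) (+ l ℤ.- + n)) (match-total (+ i ℤ.- + n) (+ j ℤ.- + n) (+ l ℤ.- + n)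
               (index-bound n i i<) (index-bound n j j<) (index-bound n l l<)))
           (ℚₚ.*-identityˡ (F (+ i ℤ.- + n) (+ j ℤ.- + n) (+ l ℤ.- + n))))))) ⟩
    ∑³ n (λ k m l → ∑³ V (match k m l) ℚ.* F k m l)
      ≡⟨ ∑³-cong n (λ k m l → trans (sym (∑³-*ʳ V (match k m l) (F k m l))) (∑³-cong V (match-match′ k m l))) ⟩
    ∑³ n (λ k m l → ∑³ V (λ a b c → match′ k m l a b c ℚ.* G a b c))
      ≡⟨ ∑³-swap n V (λ k m l a b c → match′ k m l a b c ℚ.* G a b c) ⟩
    ∑³ V (λ a b c → ∑³ n (λ k m l → match′ k m l a b c ℚ.* G a b c))
      ≡⟨ ∑³-cong V (λ a b c → trans (∑³-*ʳ n (λ k m l → match′ k m l a b c) (G a b c)) (absorb a b c)) ⟩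
    ∑³ V G ∎
    where
    open ≡-Reasoning
    absorb : ∀ a b c → ∑³ n (λ k m l → match′ k m l a b c) ℚ.* G a b c ≡ G a b c
    absorb a b c with pent a ℕ.+ (pent b ℕ.+ pent c) ℕ.≟ V
    ... | yes eq = trans (cong (ℚ._* G a b c) (match′-total a b c eq)) (ℚₚ.*-identityˡ (G a b c))
    ... | no ne  = trans (cong (∑³ n (λ k m l → match′ k m l a b c) ℚ.*_) G≡0)
        (trans (ℚₚ.*-zeroʳ (∑³ n (λ k m l → match′ k m l a b c))) (sym G≡0))
      where
      G≡0 : G a b c ≡ 0ℚ
      G≡0 = trans (cong (ε a ℚ.* (ε b ℚ.* ε c) ℚ.*_) (kd-≢ ne)) (ℚₚ.*-zeroʳ (ε a ℚ.* (ε b ℚ.* ε c)))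

-- Coefficients of E₁³ and of E₁𝒜 as lattice sums

box : ℕ → PS
box N i = ∑ᶻ N (λ k → ε k ℚ.* kd (pent k) i)

box-* : ∀ N h n → (box N * h) n ≡ ∑ᶻ N (λ k → ε k ℚ.* (kd (pent k) * h) n)
box-* N h n = trans (∑-* (suc (N ℕ.+ N)) (λ j i → ε (+ j ℤ.- + N) ℚ.* kd (pent (+ j ℤ.- + N)) i) h n)
  (∑ᶻ-cong N (λ k → scale-* (ε k) (kd (pent k)) h n))

kd-box-* : ∀ N m h n → (kd m * (box N * h)) n ≡ ∑ᶻ N (λ k → ε k ℚ.* (kd (m ℕ.+ pent k) * h) n)
kd-box-* N m h n = trans (at (solve 3 (λ m b h → m :* (b :* h) := b :* (m :* h)) ≈-refl (kd m) (box N) h) n)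
  (trans (box-* N (kd m * h) n) (∑ᶻ-cong N (λ k → cong (ε k ℚ.*_) (at (≈-trans
      (solve 3 (λ m b h → b :* (m :* h) := (m :* b) :* h) ≈-refl (kd m) (kd (pent k)) h) (*-cong (kd-*-kd m (pent k)) ≈-refl)) n))))
  where open PS-Solver

E₁³-G : ∀ n → (E 1 * (E 1 * E 1)) (3 ℕ.* n) ≡ ∑³ (3 ℕ.* n) (G n)
E₁³-G n = begin
  (E 1 * (E 1 * E 1)) V
    ≡⟨ *-cong-≤ (E 1) b (E 1 * E 1) (b * b) V trunc (λ k k≤V → *-cong-≤ (E 1) b (E 1) b k
        (λ i i≤k → trunc i (ℕₚ.≤-trans i≤k k≤V)) (λ i i≤k → trunc i (ℕₚ.≤-trans i≤k k≤V))) ⟩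
  (b * (b * b)) V
    -- The extra factor 1 lets `kd-box-*` expand the last copy of the series in the same way as the
    -- second one.
    ≡⟨ at (*-cong (≈-refl {b}) (*-cong ≈-refl (≈-sym (*-identityʳ b)))) V ⟩
  (b * (b * (b * 1#))) V
    ≡⟨ trans (box-* V (b * (b * 1#)) V) (∑ᶻ-cong V (λ x → cong (ε x ℚ.*_)
        (trans (kd-box-* V (pent x) (b * 1#) V) (∑ᶻ-cong V (λ y → cong (ε y ℚ.*_) (trans (kd-box-* V (pent x ℕ.+ pent y) 1# V)
         (∑ᶻ-cong V (λ z → cong (ε z ℚ.*_) (trans (at (*-identityʳ (kd (pent x ℕ.+ pent y ℕ.+ pent z))) V)
             (cong (λ e → kd e V) (ℕₚ.+-assoc (pent x) (pent y) (pent z)))))))))))) ⟩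
  ∑ᶻ V (λ x → ε x ℚ.* ∑ᶻ V (λ y → ε y ℚ.* ∑ᶻ V (λ z → ε z ℚ.* kd (pent x ℕ.+ (pent y ℕ.+ pent z)) V)))
    ≡⟨ ∑³-nest V ε (λ _ y → ε y) (λ x y z → ε z ℚ.* kd (pent x ℕ.+ (pent y ℕ.+ pent z)) V) ⟨
  ∑³ V (λ x y z → ε x ℚ.* (ε y ℚ.* (ε z ℚ.* kd (pent x ℕ.+ (pent y ℕ.+ pent z)) V)))
    ≡⟨ ∑³-cong V (λ x y z → solve 4 (λ x y z k → x :* (y :* (z :* k)) := x :* (y :* z) :* k) refl (ε x) (ε y) (ε z)
        (kd (pent x ℕ.+ (pent y ℕ.+ pent z)) V)) ⟩
  ∑³ V (G n) ∎
  where
  open ≡-Reasoning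
  open ℚ-Solver using (solve; _:=_; _:*_)
  V : ℕ
  V = 3 ℕ.* n
  b : PS
  b = box V
  trunc : ∀ k → k ℕ.≤ V → E 1 k ≡ b k
  trunc k k≤V = pentagonal k≤V

E₁𝒜-F : ∀ n → (E 1 * 𝒜) n ≡ ∑³ n (F n)
E₁𝒜-F n = begin
  (E 1 * 𝒜) n
    ≡⟨ *-cong-≤ (E 1) (box n) 𝒜 θ-box n (λ k k≤n → pentagonal k≤n) (λ k k≤n → 𝒜-box k≤n) ⟩
  (box n * θ-box) n
    ≡⟨ trans (box-* n θ-box n) (∑ᶻ-cong n (λ k → cong (ε k ℚ.*_) (expand k))) ⟩
  ∑ᶻ n (λ k → ε k ℚ.* ∑ᶻ n (λ m → ∑ᶻ n (λ l → kd (pent k ℕ.+ Qℕ m l) n)))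
    ≡⟨ ∑ᶻ-cong n (λ k → trans (sym (∑ᶻ-*ˡ n (ε k) (λ m → ∑ᶻ n (λ l → kd (pent k ℕ.+ Qℕ m l) n))))
        (∑ᶻ-cong n (λ m → sym (∑ᶻ-*ˡ n (ε k) (λ l → kd (pent k ℕ.+ Qℕ m l) n))))) ⟩
  ∑³ n (F n) ∎
  where
  open ≡-Reasoning
  θ-box : PS
  θ-box i = ∑ᶻ n (λ m → ∑ᶻ n (λ l → kd (Qℕ m l) i))
  expand : ∀ k → (kd (pent k) * θ-box) n ≡ ∑ᶻ n (λ m → ∑ᶻ n (λ l → kd (pent k ℕ.+ Qℕ m l) n))
  expand k = trans (at (*-comm (kd (pent k)) θ-box) n)
    (trans (∑-* (suc (n ℕ.+ n)) (λ j i → ∑ᶻ n (λ l → kd (Qℕ (+ j ℤ.- + n) l) i)) (kd (pent k)) n)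
    (∑ᶻ-cong n (λ m → trans (∑-* (suc (n ℕ.+ n)) (λ j → kd (Qℕ m (+ j ℤ.- + n))) (kd (pent k)) n)
      (∑ᶻ-cong n (λ l → at (≈-trans (*-comm (kd (Qℕ m l)) (kd (pent k))) (kd-*-kd (pent k) (Qℕ m l))) n)))))

-- Atkin's operator U₃ and the equality of the lattice sum with the Lambert series

U₃ : PS → PS
U₃ f n = f (3 ℕ.* n)

U₃-cong : ∀ {f g} → f ≈ g → U₃ f ≈ U₃ g
U₃-cong p = ⟪ (λ n → at p (3 ℕ.* n)) ⟫

E₁𝒜≈U₃E₁³ : E 1 * 𝒜 ≈ U₃ (E 1 * (E 1 * E 1))
E₁𝒜≈U₃E₁³ = ⟪ (λ n → trans (E₁𝒜-F n) (trans (double-count n) (sym (E₁³-G n)))) ⟫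

U₃-kd : ∀ g m → U₃ (g * kd (3 ℕ.* m)) ≈ U₃ g * kd m
U₃-kd g m = ⟪ go ⟫
  where
  go : ∀ n → (g * kd (3 ℕ.* m)) (3 ℕ.* n) ≡ (U₃ g * kd m) n
  go n with ℕₚ.<-≤-connex n m
  ... | inj₁ n<m = trans (at (*-comm g (kd (3 ℕ.* m))) (3 ℕ.* n)) (trans (kd-*-< (3 ℕ.* m) g (3 ℕ.* n) (ℕₚ.*-monoʳ-< 3 n<m))
    (sym (trans (at (*-comm (U₃ g) (kd m)) n) (kd-*-< m (U₃ g) n n<m))))
  ... | inj₂ m≤n with ℕₚ.m≤n⇒∃[o]m+o≡n m≤n
  ...   | j , refl = trans (at (*-comm g (kd (3 ℕ.* m))) (3 ℕ.* (m ℕ.+ j)))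
      (trans (cong (kd (3 ℕ.* m) * g) (ℕₚ.*-distribˡ-+ 3 m j)) (trans (kd-* (3 ℕ.* m) g (3 ℕ.* j))
    (sym (trans (at (*-comm (U₃ g) (kd m)) (m ℕ.+ j)) (kd-* m (U₃ g) j)))))

U₃-minus : ∀ f g → U₃ (f - g) ≈ U₃ f - U₃ g
U₃-minus f g = ⟪ (λ n → trans (minus-at f g (3 ℕ.* n)) (sym (minus-at (U₃ f) (U₃ g) n))) ⟫

eulerFactor : ℕ → ℕ → PS
eulerFactor k n = 𝟙 ⊖ qˢ ^ˢ (k ℕ.* n)

eulerFactor-unit : ∀ k n j → j ℕ.≤ n → eulerFactor (suc k) (suc n) j ≡ 1# j
eulerFactor-unit k n j j≤n = trans (at (1-q^-≈ (suc k ℕ.* suc n)) j) (1-kd-unit (ℕₚ.<-≤-trans (s≤s j≤n) (ℕₚ.m≤n*m (suc n) (suc k))))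

U₃-finProd : ∀ h N → U₃ (h * finProd (eulerFactor 3) N) ≈ U₃ h * finProd (eulerFactor 1) N
U₃-finProd h zero    = ≈-trans (U₃-cong (≈-trans (*-cong (≈-refl {h}) 𝟙→1#) (*-identityʳ h)))
    (≈-sym (≈-trans (*-cong ≈-refl 𝟙→1#) (*-identityʳ (U₃ h))))
U₃-finProd h (suc N) = ≈-trans (U₃-cong (≈-trans (*-cong ≈-refl (⊛→* (≈-refl {p₃}) (1-q^-≈ (3 ℕ.* suc N))))
    (expand h p₃ (kd (3 ℕ.* suc N)))))
  (≈-trans (U₃-minus (h * p₃) (h * p₃ * kd (3 ℕ.* suc N))) (≈-trans (+-cong ≈-refl (-‿cong (U₃-kd (h * p₃) (suc N))))
  (≈-trans (+-cong (U₃-finProd h N) (-‿cong (*-cong (U₃-finProd h N) ≈-refl))) (≈-trans (≈-sym (expand (U₃ h) p₁ (kd (suc N))))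
    (*-cong ≈-refl (≈-sym (⊛→* (≈-refl {p₁}) (≈-trans (1-q^-≈ (1 ℕ.* suc N)) ⟪
        (λ n → cong (λ z → (1# - kd z) n) (ℕₚ.*-identityˡ (suc N))) ⟫))))))))
  where
  open PS-Solver
  p₁ p₃ : PS
  p₁ = finProd (eulerFactor 1) N
  p₃ = finProd (eulerFactor 3) N
  expand : ∀ h p k → h * (p * (1# - k)) ≈ h * p - h * p * k
  expand = solve 3 (λ h p k → h :* (p :* (# 1 :- k)) := h :* p :- h :* p :* k) ≈-refl

-- `E 3` is `E 1` at q³, and a factor in q³ passes through U₃ with q³ replaced by q. The proof
-- treats one binomial factor at a time and then truncates.
U₃-E₃ : ∀ h → U₃ (h * E 3) ≈ U₃ h * E 1
U₃-E₃ h = ⟪ (λ n → trans (*-cong-≤ h h (E 3) (finProd (eulerFactor 3) (3 ℕ.* n)) (3 ℕ.* n) (λ _ _ → refl)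
    (λ k k≤ → sym (finProd-infProd (eulerFactor-unit 2) k≤)))
  (trans (at (U₃-finProd h (3 ℕ.* n)) n) (*-cong-≤ (U₃ h) (U₃ h) (finProd (eulerFactor 1) (3 ℕ.* n)) (E 1) n (λ _ _ → refl)
    (λ k k≤ → finProd-infProd (eulerFactor-unit 0) (ℕₚ.≤-trans k≤ (ℕₚ.m≤m+n n (n ℕ.+ (n ℕ.+ 0)))))))) ⟫

mul₃ : Tri → Tri → Tri
mul₃ r₀ v = r₀
mul₃ r₁ v = v
mul₃ r₂ v = v +₃ v

mul₃-next : ∀ r v → mul₃ (next r) v ≡ v +₃ mul₃ r v
mul₃-next r₀ r₀ = refl
mul₃-next r₀ r₁ = refl
mul₃-next r₀ r₂ = refl
mul₃-next r₁ v  = refl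
mul₃-next r₂ r₀ = refl
mul₃-next r₂ r₁ = refl
mul₃-next r₂ r₂ = refl

res-* : ∀ a b → res (a ℕ.* b) ≡ mul₃ (res a) (res b)
res-* zero    b = refl
res-* (suc a) b = trans (res-+ b (a ℕ.* b)) (trans (cong (res b +₃_) (res-* a b)) (sym (mul₃-next (res a) (res b))))

-- If 3 divides ax and χ₃(a) is nonzero, then 3 divides x, so the weight 3[3 | x] - 1 equals 2;
-- writing x = 3x′ gives the coefficient of `X` at n.
U₃U : ∀ n → U (3 ℕ.* n) ≡ ι 2 ℚ.* X n
U₃U n = begin
  U (3 ℕ.* n)
    ≡⟨ Lam-bound (ev₁ bχ) (ℕₚ.≤-reflexive (ℕₚ.*-comm 3 n)) ⟩
  ∑ 3n (λ a → ∑ 3n (λ x → ev₁ bχ (suc a) (suc x) ℚ.* kd (suc a ℕ.* suc x) (3 ℕ.* n)))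
    ≡⟨ ∑-cong₂ 3n 3n (λ a x → pt (suc a) (suc x)) ⟩
  ∑ 3n (λ a → ∑ 3n (λ x → ι 2 ℚ.* (ev₁ aχ (suc a) (suc x) ℚ.* kd (suc a ℕ.* suc x) (3 ℕ.* n)) ℚ.* zeroMod3 (suc x)))
    ≡⟨ ∑-cong′ 3n (λ a → ∑-multiples n (λ x → ι 2 ℚ.* (ev₁ aχ (suc a) x ℚ.* kd (suc a ℕ.* x) (3 ℕ.* n)))) ⟩
  ∑ 3n (λ a → ∑ n (λ x → ι 2 ℚ.* (ev₁ aχ (suc a) (suc x) ℚ.* kd (suc a ℕ.* (suc x ℕ.* 3)) (3 ℕ.* n))))
    ≡⟨ ∑-cong₂ 3n n (λ a x → cong (λ z → ι 2 ℚ.* (ev₁ aχ (suc a) (suc x) ℚ.* z))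
        (trans (cong (λ z → kd z (3 ℕ.* n)) (reorder (suc a) (suc x))) (kd-*ˡ 2 (suc a ℕ.* suc x) n))) ⟩
  ∑ 3n (λ a → ∑ n (λ x → ι 2 ℚ.* (ev₁ aχ (suc a) (suc x) ℚ.* kd (suc a ℕ.* suc x) n)))
    ≡⟨ ∑-extend (λ a → ∑ n (λ x → ι 2 ℚ.* (ev₁ aχ (suc a) (suc x) ℚ.* kd (suc a ℕ.* suc x) n))) (ℕₚ.m≤m*n n 3)
         (λ a n≤a → ∑-zero n (λ x _ → trans (cong (ι 2 ℚ.*_) (vanish (ev₁ aχ (suc a) (suc x))
             (ℕₚ.<-≤-trans (s≤s n≤a) (ℕₚ.m≤m*n (suc a) (suc x))))) (ℚₚ.*-zeroʳ (ι 2)))) ⟩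
  ∑ n (λ a → ∑ n (λ x → ι 2 ℚ.* (ev₁ aχ (suc a) (suc x) ℚ.* kd (suc a ℕ.* suc x) n)))
    ≡⟨ trans (∑-cong′ n (λ a → ∑-*ˡ n (ι 2) (λ x → ev₁ aχ (suc a) (suc x) ℚ.* kd (suc a ℕ.* suc x) n)))
        (∑-*ˡ n (ι 2) (λ a → ∑ n (λ x → ev₁ aχ (suc a) (suc x) ℚ.* kd (suc a ℕ.* suc x) n))) ⟩
  ι 2 ℚ.* X n ∎
  where
  open ≡-Reasoning
  3n : ℕ
  3n = n ℕ.* 3
  reorder : ∀ a x → a ℕ.* (x ℕ.* 3) ≡ 3 ℕ.* (a ℕ.* x)
  reorder a x = trans (sym (ℕₚ.*-assoc a x 3)) (ℕₚ.*-comm (a ℕ.* x) 3)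
  table : ∀ r v → mul₃ r v ≡ r₀ → fromℤ (sgn r) ℚ.* (fromℤ (+ 3) ℚ.* fromℤ (isZero v) ℚ.+ ℚ.- fromℤ (+ 1)) ≡ ι 2 ℚ.* fromℤ
      (sgn r) ℚ.* fromℤ (isZero v)
  table r₀ r₀ _ = refl
  table r₀ r₁ _ = refl
  table r₀ r₂ _ = refl
  table r₁ r₀ _ = refl
  table r₂ r₀ _ = refl
  pt : ∀ a x → ev₁ bχ a x ℚ.* kd (a ℕ.* x) (3 ℕ.* n) ≡ ι 2 ℚ.* (ev₁ aχ a x ℚ.* kd (a ℕ.* x) (3 ℕ.* n)) ℚ.* zeroMod3 x
  pt a x with a ℕ.* x ℕ.≟ 3 ℕ.* n
  ... | yes eq = trans (cong (ℚ._* kd (a ℕ.* x) (3 ℕ.* n)) (table (res a) (res x)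
      (trans (sym (res-* a x)) (trans (cong res eq) (res-* 3 n)))))
        (solve 4 (λ c s z k → c :* s :* z :* k := c :* (s :* k) :* z) refl (ι 2) (ev₁ aχ a x) (zeroMod3 x) (kd (a ℕ.* x) (3 ℕ.* n)))
    where open ℚ-Solver
  ... | no ne  = trans (cong (ev₁ bχ a x ℚ.*_) (kd-≢ ne)) (trans (solve 4 (λ b c s z → b :* # 0 := c :* (s :* # 0) :* z) refl
      (ev₁ bχ a x) (ι 2) (ev₁ aχ a x) (zeroMod3 x))
        (cong (λ k → ι 2 ℚ.* (ev₁ aχ a x ℚ.* k) ℚ.* zeroMod3 x) (sym (kd-≢ ne))))
    where open ℚ-Solver

U₃B≈A : U₃ B ≈ A
U₃B≈A = ⟪ (λ n → trans (+-at 1# (K (+ 3) * U) (3 ℕ.* n)) (trans (cong₂ ℚ._+_ (unit n)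
    (trans (K-*-at (+ 3) U (3 ℕ.* n)) (trans (cong (fromℤ (+ 3) ℚ.*_) (U₃U n))
  (trans (sym (ℚₚ.*-assoc (fromℤ (+ 3)) (ι 2) (X n))) (sym (K-*-at (+ 6) X n)))))) (sym (+-at 1# (K (+ 6) * X) n)))) ⟫
  where
  unit : ∀ n → 1# (3 ℕ.* n) ≡ 1# n
  unit zero    = refl
  unit (suc n) = trans (1#-at (3 ℕ.* suc n)) (sym (1#-at (suc n)))

-- E₁𝒜 = U₃(E₁³) = U₃(B E₃) = U₃(B) E₁ = A E₁, and `E 1` can be cancelled because its constant term
-- is 1.
𝒜≈A : 𝒜 ≈ A
𝒜≈A = *-cancelˡ {E 1} refl (≈-trans E₁𝒜≈U₃E₁³ (≈-trans (U₃-cong E₁³≈) (≈-trans (U₃-E₃ B)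
    (≈-trans (*-cong U₃B≈A ≈-refl) (*-comm A (E 1))))))
  where
  open PS-Solver
  E₁³≈ : E 1 * (E 1 * E 1) ≈ B * E 3
  E₁³≈ = ≈-sym (≈-trans (*-cong B≈η ≈-refl) (use (𝕖 ^ 3) 𝕗𝕛
    (solve 3 (λ e f j → e :* (e :* (e :* # 1)) :* j :* f := e :* (e :* e) :+ e :* (e :* (e :* # 1)) :*
        (f :* j :- # 1)) ≈-refl 𝕖 𝕗 𝕛)))

theorem2p4 : ((𝒜 ^ˢ 3 ≋ ℬ ^ˢ 3 ⊕ 𝒟³) × (ℕ→ℚ 108 · t ≋ ℕ→ℚ 4 · (α ⊛ (𝟙 ⊖ α))))
    × ((Fmix ≋ 𝒜 ^ˢ 3) × (𝒜 ^ˢ 3 ≋ onePlus27u ⊛ η9/η3³))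
    × ((Cmix ≋ (𝟙 ⊖ ℕ→ℚ 27 · u) ⊛ C₀)
    × ((𝟙 ⊖ ℕ→ℚ 27 · u) ⊛ C₀ ≋ ℕ→ℚ 3 · E5χ₀χ₃ ⊖ ℕ→ℚ 27 · E5χ₃χ₀)
    × (u ⊛ C₀ ≋ E5χ₃χ₀))
    × (Hmix ≋ prodNot3 ⊛ onePlus27u ^ˢ 2)
theorem2p4 = (at (borwein 𝒜≈A) , at 108t≈4α[1-α])
  , (at (≈-trans Fmix≈ (≈-sym (𝒜³ 𝒜≈A))) , at (𝒜³-η 𝒜≈A))
  , (at (Cmix≈ Fmix≈) , at eisenstein-combination , at uC₀)
  , at Hmix≈
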